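{- Let $p>3$ be a prime. Then $$\sum_{n=0}^{p-1}\frac{n+1}{8^n}\sum_{k=0}^n\binom{2k}{k}^2\binom{2n-2k}{n-k}^2\equiv(-1)^{(p-1)/2}p+5p^3E_{p-3}\pmod{p^4}$$ and $$\sum_{n=0}^{p-1}\frac{2n+1}{(-16)^n}\sum_{k=0}^n\binom{2k}{k}^2\binom{2n-2k}{n-k}^2\equiv(-1)^{(p-1)/2}p+3p^3E_{p-3}\pmod{p^4}.$$
   Context: The Euler numbers $E_n$ ($n\in\mathbb{N}$) are defined by $E_0=1$ and $\sum_{k=0,\,2\mid k}^{n}\binom{n}{k}E_{n-k}=0$ for $n=1,2,\ldots$. Congruences between rational numbers whose denominators are prime to $p$ are understood in the ring of $p$-integral rationals. -}

module Defs where

open import Data.Nat as ℕ using (ℕ; zero; suc; _∸_; _≤_)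
open import Data.Nat.Properties using (m^n≢0)
open import Data.Nat.Divisibility using (_∣_)
open import Data.Nat.DivMod using (_%_; _/_)
open import Data.Nat.Combinatorics using (_C_)
open import Data.Integer as ℤ using (ℤ; +_; -1ℤ)
open import Data.Rational as ℚ using (ℚ; ↧ₙ_)
open import Data.List using (List; []; _∷_; _++_; map; upTo; foldr)
open import Data.Nat.ListAction using (sum)
open import Data.Product using (Σ; _×_)
open import Relation.Nullary using (¬_)
open import Relation.Binary.PropositionalEquality using (_≡_)

ℕ→ℚ : ℕ → ℚ
ℕ→ℚ n = (+ n) ℚ./ 1

sumQ : ℕ → (ℕ → ℚ) → ℚ
sumQ n f = foldr ℚ._+_ ℚ.0ℚ (map f (upTo (suc n)))

sumN : ℕ → (ℕ → ℕ) → ℕ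
sumN n f = sum (map f (upTo (suc n)))

at : List ℚ → ℕ → ℚ
at []       _       = ℚ.0ℚ
at (x ∷ xs) zero    = x
at (x ∷ xs) (suc i) = at xs i

-- Given l = [E_0, …, E_{m-1}], the value E_m forced by the recurrence
--   Σ_{k=0, 2∣k}^{m} C(m,k) E_{m-k} = 0,  i.e.
--   E_m = - Σ_{1≤k≤m, 2∣k} C(m,k) E_{m-k}.
nextEuler : ℕ → List ℚ → ℚ
nextEuler m l = ℚ.-_ (sumQ m term)
  where
  term : ℕ → ℚ
  term zero = ℚ.0ℚ
  term k@(suc _) with k % 2
  ... | zero  = ℕ→ℚ (m C k) ℚ.* at l (m ∸ k)
  ... | suc _ = ℚ.0ℚ

eulerList : ℕ → List ℚ
eulerList zero    = ℚ.1ℚ ∷ []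
eulerList (suc n) = eulerList n ++ (nextEuler (suc n) (eulerList n) ∷ [])

-- Euler numbers E_n (E_0 = 1, Σ_{k even} C(n,k) E_{n-k} = 0 for n ≥ 1)
E : ℕ → ℚ
E n = at (eulerList n) n

pIntegral : ℕ → ℚ → Set
pIntegral p r = ¬ (p ∣ ↧ₙ r)

CongPow : ℕ → ℕ → ℚ → ℚ → Set
CongPow p k x y = Σ ℚ (λ r → pIntegral p r × (x ℚ.- y ≡ ℕ→ℚ (p ℕ.^ k) ℚ.* r))

S : ℕ → ℕ
S n = sumN n (λ k → ((2 ℕ.* k) C k) ℕ.^ 2 ℕ.* (((2 ℕ.* n) ∸ (2 ℕ.* k)) C (n ∸ k)) ℕ.^ 2)

term₁ : ℕ → ℚ
term₁ n = (+ ((suc n) ℕ.* S n)) ℚ./ (8 ℕ.^ n)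
  where instance _ = m^n≢0 8 n

term₂ : ℕ → ℚ
term₂ n = ((-1ℤ ℤ.^ n) ℤ.* (+ ((suc (2 ℕ.* n)) ℕ.* S n))) ℚ./ (16 ℕ.^ n)
  where instance _ = m^n≢0 16 n

rhs : ℕ → ℕ → ℚ
rhs c p = ((-1ℤ ℤ.^ ((p ∸ 1) / 2)) ℤ.* (+ p)) ℚ./ 1
          ℚ.+ ℕ→ℚ (c ℕ.* p ℕ.^ 3) ℚ.* E (p ∸ 3)

{-# OPTIONS --safe #-}
-- Write a k = C(2k,k)/4^k and s n = S n/16^n, so that the two sums are ∑ (n+1) 2ⁿ s n and ∑ (2n+1) (-1)ⁿ s n.
-- The generating function of s is the square of ∑ (a k)² xᵏ, and Clausen-type quadratic transformations give two
-- expansions of s n (both checked by comparing three-term recurrences):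
--   s n = ∑ₖ (a k)² (-1)ᵏ C(n,k) C(n+k,k)   and   s n = ∑ₖ (a k)³ (-1/4)ᵏ [xⁿ⁻²ᵏ] (1-x)^(-1/2-k).
-- In the first one (2n+1)(-1)ⁿ and in the second one (n+1) 2ⁿ turn the sum over n < p into a closed form; with
-- p = 2h+1 and σ = (-1)ʰ the two sums become exactly
--   p ∑_{k<p} (a k)² ∏_{j≤k} (1 - p²/j²)   and   p σ ∑_{r≤h} (a (h-r))³ (a r)⁻¹ ∏_{j≤r} (1 - p²/4j²).
-- Modulo p one has a (h-r) ≡ a h · a r, hence ∑ (a r)⁻¹ (a (h-r) - a h · a r)³ ≡ 0 (mod p³); together with
-- ∑ a r · a (h-r) = 1 this reduces the second sum to ∑_{k≤h} (a k)².  The latter, ∑_{k<p} (a k)² and the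
-- harmonic corrections are found modulo p³ from the values w k (2n+1) = (-1)ᵏ C(n,k) C(n+k,k), extended to a
-- polynomial in an arbitrary argument, by means of ∑_{k≤N} (w k (z+1) + w k (z-1)) = 2 ∏_{j≤N} (1 - (z/2j)²).
-- Everything is then expressed by ∑_{j≤h} (-1)ʲ/j², which is E_{p-3} modulo p up to a factor because the power
-- sums ∑ (-1)ʲ (2j)ⁿ over |j| ≤ h satisfy the recurrence of the Euler numbers modulo p.
module Submission where

import Defs
open import Level using (0ℓ)
open import Algebra using (CommutativeRing; IsCommutativeRing)
import Algebra.Properties.Semiring.Mult.TCOptimised as SemiringMult
import Algebra.Properties.Ring as RingProperties
import Algebra.Solver.Ring as RingSolver
open import Algebra.Solver.Ring.AlmostCommutativeRing
  using (AlmostCommutativeRing; fromCommutativeRing; _-Raw-AlmostCommutative⟶_)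
open import Data.Integer.Base as ℤ using (ℤ; -[1+_]; -1ℤ) renaming (+_ to pos)
open import Data.Integer.GCD using (gcd)
import Data.Integer.Properties as ℤₚ
open import Data.List.Base using (List; []; _∷_; _++_; length; map; applyUpTo; foldr)
open import Data.List.Properties using (map-applyUpTo; length-++)
open import Data.Maybe.Base using (Maybe; just; nothing)
open import Data.Nat using (ℕ; _<_; _∸_)
open import Data.Nat.Base as ℕ using (zero; suc; z≤n; s≤s)
open import Data.Nat.Combinatorics
  using (nCk≡nC[n∸k]; nCk+nC[k+1]≡[n+1]C[k+1]; nCn≡1) renaming (_C_ to _choose_)
open import Data.Nat.Combinatorics.Specification using (k>n⇒nCk≡0)
open import Data.Nat.Divisibility
  using (_∣_; _∤_; divides; ∣⇒≤; ∣-trans; ∣1⇒≡1; ∣m+n∣m⇒∣n; n∣m*n)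
open import Data.Nat.DivMod using (_%_; _/_; m*n/n≡m)
open import Data.Nat.ListAction using (sum)
open import Data.Nat.Primality using (Prime; euclidsLemma; prime⇒irreducible; ¬prime[1])
import Data.Nat.Properties as ℕₚ
open import Data.Product using (_×_; _,_; proj₁; proj₂; Σ; ∃-syntax)
open import Data.Rational as ℚ using (ℚ; 0ℚ; 1ℚ; ↧ₙ_; fromℚᵘ)
import Data.Rational.Properties as ℚₚ
open import Data.Rational.Unnormalised as ℚᵘ using (mkℚᵘ; *≡*)
import Data.Rational.Unnormalised.Properties as ℚᵘₚ
open import Data.Sum using (_⊎_; inj₁; inj₂)
open import Relation.Nullary using (¬_; yes; no; contradiction)
open import Relation.Binary.PropositionalEquality
  using (_≡_; refl; sym; trans; cong; cong₂; subst; module ≡-Reasoning)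

-- Both closed forms carry an explicit factor `p`, so what multiplies it is needed only modulo p³.
-- The obstacle is the range of the sums. Expanding `w k P` around `b k = (a k)²` divides by the odd
-- numbers `odd j` with `j < k` and therefore stops at `k = h`, where `odd h = P`. For `k > h` the
-- numbers `b k` are divisible by P² in general and no further, so the tail of `∑_{k<p} b k` is not
-- negligible modulo p³. This sum is instead read as the value at `y = 0` of `∑_{k<p} w k y`. The
-- relation between arguments at distance two leads in `h` steps from `y = 1 - P` to `y = 0`, and at
-- the starting point a congruence of Wolstenholme type evaluates the sum. In the cubic sum the
-- number `A = a h` is known only modulo p, as `σ + P ε`. Its powers occur precisely in the
-- combination `3A - 3σA² + A³ = σ + (A - σ)³`, so the unknown `ε` disappears modulo p³.

-- All identities are proved over an abstract ring: the operations of ℚ would unfold to normalised fractions.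
record Ring≡ : Set₁ where
  infixl 7 _*_
  infixl 6 _+_ _-_
  infix  8 -_
  field
    Carrier : Set
    _+_ _*_ : Carrier → Carrier → Carrier
    -_      : Carrier → Carrier
    0# 1#   : Carrier
    isCommutativeRing : IsCommutativeRing _≡_ _+_ _*_ -_ 0# 1#

  _-_ : Carrier → Carrier → Carrier
  x - y = x + - y

  commutativeRing : CommutativeRing 0ℓ 0ℓ
  commutativeRing = record { isCommutativeRing = isCommutativeRing }

-- Scalars in a commutative ring and the ring solver

module Arithmetic (R : Ring≡) where

  open Ring≡ R public
  open CommutativeRing commutativeRing public
    using (+-assoc; +-comm; +-identityˡ; +-identityʳ; -‿inverseʳ
          ; *-assoc; *-comm; *-identityˡ; *-identityʳ; distribˡ; distribʳ; zeroˡ; zeroʳ)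

  -- The separate clause for one makes `ι 1` reduce to `1#`; the coefficient map of the solver then
  -- preserves zero and one by `refl`.
  ι : ℕ → Carrier
  ι zero          = 0#
  ι (suc zero)    = 1#
  ι (suc (suc n)) = ι (suc n) + 1#

  private
    acr : AlmostCommutativeRing 0ℓ 0ℓ
    acr = fromCommutativeRing commutativeRing
    module M = SemiringMult (CommutativeRing.semiring commutativeRing)
    open RingProperties (CommutativeRing.ring commutativeRing)

    ι≡× : ∀ n → ι n ≡ n M.× 1#
    ι≡× zero          = refl
    ι≡× (suc zero)    = refl
    ι≡× (suc (suc n)) = cong (_+ 1#) (ι≡× (suc n))

  ι-suc : ∀ n → ι (suc n) ≡ ι n + 1#
  ι-suc zero    = sym (+-identityˡ 1#)
  ι-suc (suc n) = refl

  ι-+ : ∀ m n → ι (m ℕ.+ n) ≡ ι m + ι n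
  ι-+ m n = trans (ι≡× (m ℕ.+ n))
    (trans (M.×-homo-+ 1# m n) (sym (cong₂ _+_ (ι≡× m) (ι≡× n))))

  ι-* : ∀ m n → ι (m ℕ.* n) ≡ ι m * ι n
  ι-* m n = trans (ι≡× (m ℕ.* n))
    (trans (M.×1-homo-* m n) (sym (cong₂ _*_ (ι≡× m) (ι≡× n))))

  ⟦_⟧ : ℤ → Carrier
  ⟦ pos n ⟧    = ι n
  ⟦ -[1+ n ] ⟧ = - ι (suc n)

  private
    ⊖-homo : ∀ m n → ⟦ m ℤ.⊖ n ⟧ ≡ ι m - ι n
    ⊖-homo zero    zero    = sym (-‿inverseʳ 0#)
    ⊖-homo zero    (suc n) = sym (+-identityˡ _)
    ⊖-homo (suc m) zero    = sym (trans (cong (ι (suc m) +_) -0#≈0#) (+-identityʳ _))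
    ⊖-homo (suc m) (suc n) = begin
      ⟦ suc m ℤ.⊖ suc n ⟧           ≡⟨ cong ⟦_⟧ (ℤₚ.[1+m]⊖[1+n]≡m⊖n m n) ⟩
      ⟦ m ℤ.⊖ n ⟧                   ≡⟨ ⊖-homo m n ⟩
      ι m - ι n                     ≡⟨ cong (_- ι n) (sym (+-identityʳ _)) ⟩
      ι m + 0# - ι n                ≡⟨ cong (λ t → ι m + t - ι n) (sym (-‿inverseʳ 1#)) ⟩
      ι m + (1# - 1#) - ι n         ≡⟨ cong (_- ι n) (sym (+-assoc _ _ _)) ⟩
      ι m + 1# - 1# - ι n           ≡⟨ +-assoc _ _ _ ⟩
      ι m + 1# + (- 1# - ι n)       ≡⟨ cong (ι m + 1# +_) (-‿+-comm 1# (ι n)) ⟩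
      ι m + 1# - (1# + ι n)         ≡⟨ cong₂ (λ s t → s - t) (sym (ι-suc m))
                                         (trans (+-comm 1# (ι n)) (sym (ι-suc n))) ⟩
      ι (suc m) - ι (suc n)         ∎
      where open ≡-Reasoning

    +-homo : ∀ x y → ⟦ x ℤ.+ y ⟧ ≡ ⟦ x ⟧ + ⟦ y ⟧
    +-homo (pos m)  (pos n)  = ι-+ m n
    +-homo (pos m)  -[1+ n ] = ⊖-homo m (suc n)
    +-homo -[1+ m ] (pos n)  = trans (⊖-homo n (suc m)) (+-comm _ _)
    +-homo -[1+ m ] -[1+ n ] = trans
      (cong (λ t → - t) (trans (cong (λ t → ι (suc t)) (sym (ℕₚ.+-suc m n))) (ι-+ (suc m) (suc n))))
      (sym (-‿+-comm _ _))

    -‿homo : ∀ x → ⟦ ℤ.- x ⟧ ≡ - ⟦ x ⟧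
    -‿homo (pos zero)    = sym -0#≈0#
    -‿homo (pos (suc n)) = refl
    -‿homo -[1+ n ]      = sym (-‿involutive _)

    *-homo⁺ : ∀ m y → ⟦ pos m ℤ.* y ⟧ ≡ ι m * ⟦ y ⟧
    *-homo⁺ m (pos n)  = trans (cong ⟦_⟧ (sym (ℤₚ.pos-* m n))) (ι-* m n)
    *-homo⁺ m -[1+ n ] = begin
      ⟦ pos m ℤ.* ℤ.- (pos (suc n)) ⟧ ≡⟨ cong ⟦_⟧ (sym (ℤₚ.neg-distribʳ-* (pos m) (pos (suc n)))) ⟩
      ⟦ ℤ.- (pos m ℤ.* pos (suc n)) ⟧ ≡⟨ -‿homo (pos m ℤ.* pos (suc n)) ⟩
      - ⟦ pos m ℤ.* pos (suc n) ⟧     ≡⟨ cong (λ t → - t) (*-homo⁺ m (pos (suc n))) ⟩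
      - (ι m * ι (suc n))             ≡⟨ -‿distribʳ-* _ _ ⟩
      ι m * - ι (suc n)               ∎
      where open ≡-Reasoning

    *-homo : ∀ x y → ⟦ x ℤ.* y ⟧ ≡ ⟦ x ⟧ * ⟦ y ⟧
    *-homo (pos m)  y = *-homo⁺ m y
    *-homo -[1+ m ] y = begin
      ⟦ ℤ.- (pos (suc m)) ℤ.* y ⟧ ≡⟨ cong ⟦_⟧ (sym (ℤₚ.neg-distribˡ-* (pos (suc m)) y)) ⟩
      ⟦ ℤ.- (pos (suc m) ℤ.* y) ⟧ ≡⟨ -‿homo (pos (suc m) ℤ.* y) ⟩
      - ⟦ pos (suc m) ℤ.* y ⟧     ≡⟨ cong (λ t → - t) (*-homo⁺ (suc m) y) ⟩
      - (ι (suc m) * ⟦ y ⟧)       ≡⟨ -‿distribˡ-* _ _ ⟩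
      - ι (suc m) * ⟦ y ⟧         ∎
      where open ≡-Reasoning

    ℤ⟶R : ℤ.+-*-rawRing -Raw-AlmostCommutative⟶ acr
    ℤ⟶R = record
      { ⟦_⟧ = ⟦_⟧ ; +-homo = +-homo ; *-homo = *-homo ; -‿homo = -‿homo ; 0-homo = refl ; 1-homo = refl }

    -- Coefficients are compared as integers, so no decision procedure on `Carrier` is required; a
    -- failed comparison only forgoes a simplification.
    coeff≟ : ∀ x y → Maybe (⟦ x ⟧ ≡ ⟦ y ⟧)
    coeff≟ x y with x ℤₚ.≟ y
    ... | yes x≡y = just (cong ⟦_⟧ x≡y)
    ... | no  _   = nothing

  open RingSolver ℤ.+-*-rawRing acr ℤ⟶R coeff≟ public
    using (solve; _:=_; _:+_; _:*_; _:-_; :-_; con; Polynomial)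

  κ : ∀ {n} → ℕ → Polynomial n
  κ m = con (pos m)

record ℚ-Algebra : Set₁ where
  field
    ring : Ring≡
  open Arithmetic ring public
  field
    inv         : ℕ → Carrier
    inv-inverse : ∀ n → ι (suc n) * inv (suc n) ≡ 1#

-- Finite sums and linear combinations of equations

module Sums (R : Ring≡) where

  open Arithmetic R

  -- To prove x ≡ y from l ≡ r it suffices to exhibit x - y as the multiple c * (l - r);
  -- the hypothesis is stated without subtraction so that it is a ring identity.
  lin₁ : ∀ {x y l r} c → l ≡ r → x + c * r ≡ y + c * l → x ≡ y
  lin₁ {x} {y} {l} c refl p = begin
    x                     ≡⟨ solve 2 (λ x t → x := x :+ t :- t) refl x (c * l) ⟩
    x + c * l - c * l     ≡⟨ cong (_- c * l) p ⟩
    y + c * l - c * l     ≡⟨ solve 2 (λ x t → x :+ t :- t := x) refl y (c * l) ⟩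
    y                     ∎
    where open ≡-Reasoning

  lin₂ : ∀ {x y l₁ r₁ l₂ r₂} c₁ → l₁ ≡ r₁ → ∀ c₂ → l₂ ≡ r₂ →
         x + c₁ * r₁ + c₂ * r₂ ≡ y + c₁ * l₁ + c₂ * l₂ → x ≡ y
  lin₂ c₁ p₁ c₂ p₂ q = lin₁ c₁ p₁ (lin₁ c₂ p₂ q)

  lin₃ : ∀ {x y l₁ r₁ l₂ r₂ l₃ r₃} c₁ → l₁ ≡ r₁ → ∀ c₂ → l₂ ≡ r₂ → ∀ c₃ → l₃ ≡ r₃ →
         x + c₁ * r₁ + c₂ * r₂ + c₃ * r₃ ≡ y + c₁ * l₁ + c₂ * l₂ + c₃ * l₃ → x ≡ y
  lin₃ c₁ p₁ c₂ p₂ c₃ p₃ q = lin₁ c₁ p₁ (lin₁ c₂ p₂ (lin₁ c₃ p₃ q))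

  cancel : ∀ {u v x y} → u * v ≡ 1# → u * x ≡ u * y → x ≡ y
  cancel {u} {v} {x} {y} uv ux≡uy = lin₃ (- x) uv v ux≡uy y uv
    (solve 4 (λ u v x y → x :+ (:- x) :* κ 1 :+ v :* (u :* y) :+ y :* κ 1
                       := y :+ (:- x) :* (u :* v) :+ v :* (u :* x) :+ y :* (u :* v)) refl u v x y)

  ∑ : ℕ → (ℕ → Carrier) → Carrier
  ∑ zero    f = 0#
  ∑ (suc n) f = ∑ n f + f n

  ∑-cong : ∀ n {f g} → (∀ k → k ℕ.< n → f k ≡ g k) → ∑ n f ≡ ∑ n g
  ∑-cong zero    f≡g = refl
  ∑-cong (suc n) f≡g = cong₂ _+_ (∑-cong n (λ k k<n → f≡g k (ℕₚ.m<n⇒m<1+n k<n))) (f≡g n (ℕₚ.n<1+n n))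

  ∑-cong′ : ∀ n {f g} → (∀ k → f k ≡ g k) → ∑ n f ≡ ∑ n g
  ∑-cong′ n f≡g = ∑-cong n (λ k _ → f≡g k)

  ∑-+ : ∀ n f g → ∑ n (λ k → f k + g k) ≡ ∑ n f + ∑ n g
  ∑-+ zero    f g = sym (+-identityˡ 0#)
  ∑-+ (suc n) f g = trans (cong (λ t → t + (f n + g n)) (∑-+ n f g))
    (solve 4 (λ s t x y → s :+ t :+ (x :+ y) := s :+ x :+ (t :+ y)) refl (∑ n f) (∑ n g) (f n) (g n))

  ∑-* : ∀ n c f → ∑ n (λ k → c * f k) ≡ c * ∑ n f
  ∑-* zero    c f = sym (zeroʳ c)
  ∑-* (suc n) c f = trans (cong (λ t → t + c * f n) (∑-* n c f)) (sym (distribˡ c (∑ n f) (f n)))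

  ∑-0 : ∀ n {f} → (∀ k → k ℕ.< n → f k ≡ 0#) → ∑ n f ≡ 0#
  ∑-0 zero    f≡0 = refl
  ∑-0 (suc n) f≡0 = trans
    (cong₂ _+_ (∑-0 n (λ k k<n → f≡0 k (ℕₚ.m<n⇒m<1+n k<n))) (f≡0 n (ℕₚ.n<1+n n))) (+-identityˡ 0#)

  ∑-telescope : ∀ n (f : ℕ → Carrier) → ∑ n (λ k → f (suc k) - f k) ≡ f n - f 0
  ∑-telescope zero    f = sym (-‿inverseʳ (f 0))
  ∑-telescope (suc n) f = trans (cong (λ t → t + (f (suc n) - f n)) (∑-telescope n f))
    (solve 3 (λ x y z → y :- z :+ (x :- y) := x :- z) refl (f (suc n)) (f n) (f 0))

  ∑-head : ∀ n f → ∑ (suc n) f ≡ f 0 + ∑ n (λ k → f (suc k))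
  ∑-head zero    f = trans (+-identityˡ (f 0)) (sym (+-identityʳ (f 0)))
  ∑-head (suc n) f = trans (cong (λ t → t + f (suc n)) (∑-head n f)) (+-assoc _ _ _)

  ∑-reverse : ∀ n f → ∑ (suc n) (λ k → f (n ℕ.∸ k)) ≡ ∑ (suc n) f
  ∑-reverse zero    f = refl
  ∑-reverse (suc n) f = trans (∑-head (suc n) (λ k → f (suc n ℕ.∸ k)))
    (trans (cong (f (suc n) +_) (∑-reverse n f)) (+-comm _ _))

  ∑-swap : ∀ m n (f : ℕ → ℕ → Carrier) → ∑ m (λ i → ∑ n (f i)) ≡ ∑ n (λ j → ∑ m (λ i → f i j))
  ∑-swap zero    n f = sym (∑-0 n (λ _ _ → refl))
  ∑-swap (suc m) n f = trans (cong (λ t → t + ∑ n (f m)) (∑-swap m n f)) (sym (∑-+ n _ _))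

  sgn : ℕ → Carrier
  sgn zero    = 1#
  sgn (suc n) = - sgn n

  infixr 8 _^_
  _^_ : Carrier → ℕ → Carrier
  x ^ zero  = 1#
  x ^ suc n = x * x ^ n

-- The products `w` and `π` at neighbouring arguments

module Products (R : ℚ-Algebra) where

  open ℚ-Algebra R
  open Sums ring public

  -- 1/(2j); the value e 0 is unconstrained.
  e : ℕ → Carrier
  e j = inv (2 ℕ.* j)

  e-inverse : ∀ k → ι 2 * (ι k + 1#) * e (suc k) ≡ 1#
  e-inverse k = begin
    ι 2 * (ι k + 1#) * e (suc k)   ≡⟨ cong (λ t → ι 2 * t * e (suc k)) (sym (ι-suc k)) ⟩
    ι 2 * ι (suc k) * e (suc k)    ≡⟨ cong (_* e (suc k)) (sym (ι-* 2 (suc k))) ⟩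
    ι (2 ℕ.* suc k) * e (suc k)    ≡⟨ inv-inverse _ ⟩
    1#                             ∎
    where open ≡-Reasoning

  -- C(2k,k)/4ᵏ, see central-binomial.
  a : ℕ → Carrier
  a zero    = 1#
  a (suc k) = a k * (ι 2 * ι k + 1#) * e (suc k)

  -- w k (2n+1) = (-1)ᵏ C(n,k) C(n+k,k) and w k 0 = (a k)².
  w : ℕ → Carrier → Carrier
  w zero    y = 1#
  w (suc k) y = w k y * ((ι 2 * ι k + 1#) * (ι 2 * ι k + 1#) - y * y) * (e (suc k) * e (suc k))

  -- π k (2x) = ∏_{j≤k} (1 - x²/j²).
  π : ℕ → Carrier → Carrier
  π zero    z = 1#
  π (suc k) z = π k z * (ι 2 * (ι k + 1#) * (ι 2 * (ι k + 1#)) - z * z) * (e (suc k) * e (suc k))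

  w-even : ∀ k y → w k (- y) ≡ w k y
  w-even zero    y = refl
  w-even (suc k) y = trans
    (cong (λ t → t * ((ι 2 * ι k + 1#) * (ι 2 * ι k + 1#) - - y * - y) * (e (suc k) * e (suc k))) (w-even k y))
    (solve 4 (λ W K E y → W :* ((κ 2 :* K :+ κ 1) :* (κ 2 :* K :+ κ 1) :- (:- y) :* (:- y)) :* (E :* E)
                       := W :* ((κ 2 :* K :+ κ 1) :* (κ 2 :* K :+ κ 1) :- y :* y) :* (E :* E)) refl
       (w k y) (ι k) (e (suc k)) y)

  π-even : ∀ k z → π k (- z) ≡ π k z
  π-even zero    z = refl
  π-even (suc k) z = trans
    (cong (λ t → t * (ι 2 * (ι k + 1#) * (ι 2 * (ι k + 1#)) - - z * - z) * (e (suc k) * e (suc k))) (π-even k z))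
    (solve 4 (λ W K E y → W :* (κ 2 :* (K :+ κ 1) :* (κ 2 :* (K :+ κ 1)) :- (:- y) :* (:- y)) :* (E :* E)
                       := W :* (κ 2 :* (K :+ κ 1) :* (κ 2 :* (K :+ κ 1)) :- y :* y) :* (E :* E)) refl
       (π k z) (ι k) (e (suc k)) z)

  -- The numerators of the factors are `(2j+2-z)(2j+2+z)` for `π` and `(2j-z)(2j+2+z)` for `w` at
  -- `z + 1`. One half agrees and the other is shifted by one index, so the quotient of the products
  -- telescopes.
  π-w : ∀ k z → z * π k z ≡ (z - ι 2 * ι k) * w k (z + 1#)
  π-w zero    z = solve 1 (λ z → z :* κ 1 := (z :- κ 2 :* κ 0) :* κ 1) refl z
  π-w (suc k) z rewrite ι-suc k = lin₁ _ (π-w k z)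
    (solve 5 (λ P W K E z →
       let F = κ 2 :* (K :+ κ 1) :* (κ 2 :* (K :+ κ 1)) :- z :* z in
         z :* (P :* F :* (E :* E)) :+ F :* (E :* E) :* ((z :- κ 2 :* K) :* W)
      := (z :- κ 2 :* (K :+ κ 1)) :* (W :* ((κ 2 :* K :+ κ 1) :* (κ 2 :* K :+ κ 1) :- (z :+ κ 1) :* (z :+ κ 1)) :* (E :* E))
         :+ F :* (E :* E) :* (z :* P)) refl
       (π k z) (w k (z + 1#)) (ι k) (e (suc k)) z)

  -- The last factor of `w (suc k) (z + 1#)` contains `2k - z`, which is up to sign the multiplier
  -- in `π-w`; absorbing it leaves a polynomial multiple of `π k z`.
  w-π : ∀ k z → ι 2 * (ι k + 1#) * (ι 2 * (ι k + 1#)) * w (suc k) (z + 1#)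
                ≡ - z * (ι 2 * (ι k + 1#) + z) * π k z
  w-π k z = lin₂ _ (π-w k z) _ (e-inverse k)
    (solve 5 (λ P W K E z →
       let D = κ 2 :* (K :+ κ 1)
           F = (κ 2 :* K :+ κ 1) :* (κ 2 :* K :+ κ 1) :- (z :+ κ 1) :* (z :+ κ 1)
           C = W :* F :* (D :* E :+ κ 1)
           C₁ = :- (D :+ z) in
         D :* D :* (W :* F :* (E :* E)) :+ (:- C₁) :* ((z :- κ 2 :* K) :* W) :+ C :* κ 1
      := (:- z) :* (D :+ z) :* P :+ (:- C₁) :* (z :* P) :+ C :* (D :* E)) refl
       (π k z) (w k (z + 1#)) (ι k) (e (suc k)) z)

  w-π⁻ : ∀ k z → ι 2 * (ι k + 1#) * (ι 2 * (ι k + 1#)) * w (suc k) (z - 1#)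
                ≡ z * (ι 2 * (ι k + 1#) - z) * π k z
  w-π⁻ k z = begin
    D * w (suc k) (z - 1#)        ≡⟨ cong (λ t → D * w (suc k) t) (solve 1 (λ z → z :- κ 1 := :- (:- z :+ κ 1)) refl z) ⟩
    D * w (suc k) (- (- z + 1#))  ≡⟨ cong (D *_) (w-even (suc k) (- z + 1#)) ⟩
    D * w (suc k) (- z + 1#)      ≡⟨ w-π k (- z) ⟩
    - - z * (ι 2 * (ι k + 1#) + - z) * π k (- z)  ≡⟨ cong (- - z * (ι 2 * (ι k + 1#) + - z) *_) (π-even k z) ⟩
    - - z * (ι 2 * (ι k + 1#) + - z) * π k z      ≡⟨ solve 3 (λ z K P → (:- (:- z)) :* (κ 2 :* (K :+ κ 1) :+ :- z) :* P
                                                          := z :* (κ 2 :* (K :+ κ 1) :- z) :* P) refl z (ι k) (π k z) ⟩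
    z * (ι 2 * (ι k + 1#) - z) * π k z ∎
    where
    open ≡-Reasoning
    D = ι 2 * (ι k + 1#) * (ι 2 * (ι k + 1#))

-- Shifts of `w` and the recurrence of the convolution square `s`

module Recurrences (R : ℚ-Algebra) where

  open ℚ-Algebra R
  open Products R public

  odd : ℕ → Carrier
  odd n = ι 2 * ι n + 1#

  odd-suc : ∀ n → odd (suc n) ≡ odd n + ι 2
  odd-suc n = trans (cong (λ t → ι 2 * t + 1#) (ι-suc n))
    (solve 1 (λ N → κ 2 :* (N :+ κ 1) :+ κ 1 := κ 2 :* N :+ κ 1 :+ κ 2) refl (ι n))

  π-w⁻ : ∀ k z → z * π k z ≡ (z + ι 2 * ι k) * w k (z - 1#)
  π-w⁻ zero    z = solve 1 (λ z → z :* κ 1 := (z :+ κ 2 :* κ 0) :* κ 1) refl z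
  π-w⁻ (suc k) z rewrite ι-suc k = lin₁ _ (π-w⁻ k z)
    (solve 5 (λ P W K E z →
       let F = κ 2 :* (K :+ κ 1) :* (κ 2 :* (K :+ κ 1)) :- z :* z in
         z :* (P :* F :* (E :* E)) :+ F :* (E :* E) :* ((z :+ κ 2 :* K) :* W)
      := (z :+ κ 2 :* (K :+ κ 1)) :* (W :* ((κ 2 :* K :+ κ 1) :* (κ 2 :* K :+ κ 1) :- (z :- κ 1) :* (z :- κ 1)) :* (E :* E))
         :+ F :* (E :* E) :* (z :* P)) refl
       (π k z) (w k (z - 1#)) (ι k) (e (suc k)) z)

  -- In the sum of `w-π` and `w-π⁻` the parts linear in `z` cancel. What remains is
  -- `-2z² π N z / (2N+2)²`, twice the increment from `π N z` to `π (suc N) z`.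
  ∑w : ∀ N z → ∑ (suc N) (λ k → w k (z + 1#) + w k (z - 1#)) ≡ ι 2 * π N z
  ∑w zero    z = solve 0 (κ 0 :+ (κ 1 :+ κ 1) := κ 2 :* κ 1) refl
  ∑w (suc N) z = trans (cong (λ t → t + (w (suc N) (z + 1#) + w (suc N) (z - 1#))) (∑w N z))
    (lin₃ _ (w-π N z) _ (w-π⁻ N z) _ (e-inverse N)
      (solve 6 (λ X Y P K E z →
         let D = κ 2 :* (K :+ κ 1)
             C = :- ((D :* E :+ κ 1) :* (X :+ Y :+ κ 2 :* P)) in
           κ 2 :* P :+ (X :+ Y) :+ E :* E :* ((:- z) :* (D :+ z) :* P)
             :+ E :* E :* (z :* (D :- z) :* P) :+ C :* κ 1
        := κ 2 :* (P :* (D :* D :- z :* z) :* (E :* E)) :+ E :* E :* (D :* D :* X)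
             :+ E :* E :* (D :* D :* Y) :+ C :* (D :* E)) refl
         (w (suc N) (z + 1#)) (w (suc N) (z - 1#)) (π N z) (ι N) (e (suc N)) z))

  -- The product `π k (y + 1#)` is a neighbour of both arguments `y` and `y + 2`. Lowering the index
  -- by one makes the shifted values polynomial multiples of `w k y`, up to the inverses `e`, as
  -- telescoping in `k` requires.
  w-shift : ∀ k y → w (suc k) (y + ι 2) ≡
    - ((y + 1# + ι 2 * (ι k + 1#)) * (y - 1# + ι 2 * (ι k + 1#)) * w k y * (e (suc k) * e (suc k)))
  w-shift k y = lin₃ _ w≡π _ π≡w _ (e-inverse k)
    (solve 6 (λ X W P K E y →
       let D = κ 2 :* (K :+ κ 1)
           C = :- (X :* (D :* E :+ κ 1))
           C₂ = :- (E :* E :* (D :+ (y :+ κ 1))) in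
         X :+ E :* E :* ((:- (y :+ κ 1)) :* (D :+ (y :+ κ 1)) :* P)
           :+ C₂ :* ((y :+ κ 1 :+ κ 2 :* K) :* W) :+ C :* κ 1
      := :- ((y :+ κ 1 :+ D) :* (y :- κ 1 :+ D) :* W :* (E :* E)) :+ E :* E :* (D :* D :* X)
           :+ C₂ :* ((y :+ κ 1) :* P) :+ C :* (D :* E)) refl
       (w (suc k) (y + ι 2)) (w k y) (π k (y + 1#)) (ι k) (e (suc k)) y)
    where
    w≡π : ι 2 * (ι k + 1#) * (ι 2 * (ι k + 1#)) * w (suc k) (y + ι 2)
          ≡ - (y + 1#) * (ι 2 * (ι k + 1#) + (y + 1#)) * π k (y + 1#)
    w≡π = trans (cong (λ t → ι 2 * (ι k + 1#) * (ι 2 * (ι k + 1#)) * w (suc k) t)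
      (solve 1 (λ y → y :+ κ 2 := y :+ κ 1 :+ κ 1) refl y)) (w-π k (y + 1#))
    π≡w : (y + 1#) * π k (y + 1#) ≡ (y + 1# + ι 2 * ι k) * w k y
    π≡w = trans (π-w⁻ k (y + 1#)) (cong (λ t → (y + 1# + ι 2 * ι k) * w k t)
      (solve 1 (λ y → y :+ κ 1 :- κ 1 := y) refl y))

  w-shift⁻ : ∀ k y → w (suc k) (y - ι 2) ≡
    - ((y - 1# - ι 2 * (ι k + 1#)) * (y + 1# - ι 2 * (ι k + 1#)) * w k y * (e (suc k) * e (suc k)))
  w-shift⁻ k y = begin
    w (suc k) (y - ι 2)         ≡⟨ cong (w (suc k)) (solve 1 (λ y → y :- κ 2 := :- (:- y :+ κ 2)) refl y) ⟩
    w (suc k) (- (- y + ι 2))   ≡⟨ w-even (suc k) (- y + ι 2) ⟩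
    w (suc k) (- y + ι 2)       ≡⟨ w-shift k (- y) ⟩
    - ((- y + 1# + D) * (- y - 1# + D) * w k (- y) * E)
      ≡⟨ cong (λ t → - ((- y + 1# + D) * (- y - 1# + D) * t * E)) (w-even k y) ⟩
    - ((- y + 1# + D) * (- y - 1# + D) * w k y * E)
      ≡⟨ solve 4 (λ y D W E → :- ((:- y :+ κ 1 :+ D) :* (:- y :- κ 1 :+ D) :* W :* E)
                            := :- ((y :- κ 1 :- D) :* (y :+ κ 1 :- D) :* W :* E)) refl y D (w k y) E ⟩
    - ((y - 1# - D) * (y + 1# - D) * w k y * E) ∎
    where
    open ≡-Reasoning
    D = ι 2 * (ι k + 1#)
    E = e (suc k) * e (suc k)

  w-vanish : ∀ m n → w (m ℕ.+ suc n) (odd n) ≡ 0#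
  w-vanish zero    n = solve 3 (λ W N E →
      W :* ((κ 2 :* N :+ κ 1) :* (κ 2 :* N :+ κ 1) :- (κ 2 :* N :+ κ 1) :* (κ 2 :* N :+ κ 1)) :* E := κ 0)
    refl (w n (odd n)) (ι n) (e (suc n) * e (suc n))
  w-vanish (suc m) n = trans (cong (λ t → t * F * E) (w-vanish m n))
    (solve 2 (λ F E → κ 0 :* F :* E := κ 0) refl F E)
    where
    K = ι (m ℕ.+ suc n)
    F = (ι 2 * K + 1#) * (ι 2 * K + 1#) - odd n * odd n
    E = e (suc (m ℕ.+ suc n)) * e (suc (m ℕ.+ suc n))

  w-vanish′ : ∀ {k n} → n ℕ.< k → w k (odd n) ≡ 0#
  w-vanish′ {k} {n} n<k = subst (λ t → w t (odd n) ≡ 0#) (ℕₚ.m∸n+n≡m n<k) (w-vanish (k ℕ.∸ suc n) n)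

  b : ℕ → Carrier
  b k = a k * a k

  -- Coefficient form of the third-order differential equation that is the symmetric square of the
  -- hypergeometric equation for `∑ b k xᵏ`.
  IsRecurrent : (ℕ → Carrier) → ℕ → Set
  IsRecurrent f n =
    ι 2 * (ι n + ι 2) * (ι n + ι 2) * (ι n + ι 2) * f (suc (suc n))
    + ι 2 * (ι n + 1#) * (ι n + 1#) * (ι n + 1#) * f n
    ≡ (ι 2 * ι n + ι 3) * (ι 2 * ι n * ι n + ι 6 * ι n + ι 5) * f (suc n)

  -- The bound `B` is there for the expansions cut off at a fixed number of terms: their recurrence
  -- is available only while the boundary term of the telescoping sum vanishes. The leading
  -- coefficient `2(n+2)³` is a unit.
  recurrent-unique : ∀ B {f g} → f 0 ≡ g 0 → f 1 ≡ g 1 →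
    (∀ n → suc n ℕ.< B → IsRecurrent f n) → (∀ n → suc n ℕ.< B → IsRecurrent g n) →
    ∀ n → n ℕ.< B → f n ≡ g n × f (suc n) ≡ g (suc n)
  recurrent-unique B         f0 f1 rf rg zero    n<B = f0 , f1
  recurrent-unique B {f} {g} f0 f1 rf rg (suc n) n<B = proj₂ ih , cancel unit eq
    where
    ih = recurrent-unique B f0 f1 rf rg n (ℕₚ.<-trans (ℕₚ.n<1+n n) n<B)
    N = ι n
    i = inv (suc (suc n))
    Ni : (N + ι 2) * i ≡ 1#
    Ni = trans (cong (_* i) (trans (solve 1 (λ N → N :+ κ 2 := N :+ κ 1 :+ κ 1) refl N) (cong (λ t → t + 1#) (sym (ι-suc n)))))
           (inv-inverse (suc n))
    unit : ι 2 * (N + ι 2) * (N + ι 2) * (N + ι 2) * (inv 2 * i * i * i) ≡ 1#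
    unit = lin₂ (X * X * X) (inv-inverse 1) (X * X + X + 1#) Ni
      (solve 3 (λ N H I → let Y = (N :+ κ 2) :* I in
          κ 2 :* (N :+ κ 2) :* (N :+ κ 2) :* (N :+ κ 2) :* (H :* I :* I :* I) :+ Y :* Y :* Y :* κ 1 :+ (Y :* Y :+ Y :+ κ 1) :* κ 1
       := κ 1 :+ Y :* Y :* Y :* (κ 2 :* H) :+ (Y :* Y :+ Y :+ κ 1) :* Y) refl N (inv 2) i)
      where X = (N + ι 2) * i
    D = ι 2 * (N + ι 2) * (N + ι 2) * (N + ι 2)
    C = ι 2 * (N + 1#) * (N + 1#) * (N + 1#)
    M = (ι 2 * N + ι 3) * (ι 2 * N * N + ι 6 * N + ι 5)
    eq : D * f (suc (suc n)) ≡ D * g (suc (suc n))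
    eq = begin
      D * f (suc (suc n))                    ≡⟨ solve 2 (λ x y → x := x :+ y :- y) refl _ _ ⟩
      D * f (suc (suc n)) + C * f n - C * f n ≡⟨ cong (_- C * f n) (rf n n<B) ⟩
      M * f (suc n) - C * f n                ≡⟨ cong₂ (λ s t → M * s - C * t) (proj₂ ih) (proj₁ ih) ⟩
      M * g (suc n) - C * g n                ≡⟨ cong (_- C * g n) (sym (rg n n<B)) ⟩
      D * g (suc (suc n)) + C * g n - C * g n ≡⟨ solve 2 (λ x y → x :+ y :- y := x) refl _ _ ⟩
      D * g (suc (suc n))                    ∎
      where open ≡-Reasoning

  conv : (ℕ → Carrier) → (ℕ → Carrier) → ℕ → Carrier
  conv f g n = ∑ (suc n) (λ k → f k * g (n ℕ.∸ k))

  conv-comm : ∀ f g n → conv f g n ≡ conv g f n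
  conv-comm f g n = trans (sym (∑-reverse n (λ k → f k * g (n ℕ.∸ k))))
    (∑-cong (suc n) λ { k (s≤s k≤n) → trans (cong (λ t → f (n ℕ.∸ k) * g t) (ℕₚ.m∸[m∸n]≡n k≤n)) (*-comm _ _) })

  -- The operator `x d/dx` on generating functions; with `conv` as product it is a derivation.
  θ : (ℕ → Carrier) → ℕ → Carrier
  θ f k = ι k * f k

  conv-leibniz : ∀ f g n → ι n * conv f g n ≡ conv (θ f) g n + conv f (θ g) n
  conv-leibniz f g n = trans (sym (∑-* (suc n) (ι n) _)) (trans
    (∑-cong (suc n) λ { k (s≤s k≤n) → trans
      (cong (λ t → t * (f k * g (n ℕ.∸ k))) (trans (cong ι (sym (ℕₚ.m+[n∸m]≡n k≤n))) (ι-+ k (n ℕ.∸ k))))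
      (solve 4 (λ k l x y → (k :+ l) :* (x :* y) := k :* x :* y :+ x :* (l :* y)) refl (ι k) (ι (n ℕ.∸ k)) (f k) (g (n ℕ.∸ k))) })
    (∑-+ (suc n) _ _))

  b-suc : ∀ k → ι 2 * (ι k + 1#) * (ι 2 * (ι k + 1#)) * b (suc k) ≡ odd k * odd k * b k
  b-suc k = lin₁ _ (e-inverse k)
    (solve 3 (λ A K E →
       let D = κ 2 :* (K :+ κ 1)
           O = κ 2 :* K :+ κ 1
           C = O :* O :* A :* A :* (D :* E :+ κ 1) in
         D :* D :* (A :* O :* E :* (A :* O :* E)) :+ C :* κ 1
      := O :* O :* (A :* A) :+ C :* (D :* E)) refl (a k) (ι k) (e (suc k)))

  -- The hypergeometric equation `4θ²B = x(2θ+1)²B` for `B = ∑ b k xᵏ`, multiplied by the generating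
  -- function of `g`.
  conv-θθb-suc : ∀ g n → ι 4 * conv (θ (θ b)) g (suc n)
    ≡ ι 4 * conv (θ (θ b)) g n + ι 4 * conv (θ b) g n + conv b g n
  conv-θθb-suc g n = begin
    ι 4 * conv (θ (θ b)) g (suc n)
      ≡⟨ cong (ι 4 *_) (∑-head (suc n) _) ⟩
    ι 4 * (0# * (0# * b 0) * g (suc n) + ∑ (suc n) (λ k → θ (θ b) (suc k) * g (n ℕ.∸ k)))
      ≡⟨ solve 3 (λ x y z → κ 4 :* (κ 0 :* (κ 0 :* x) :* y :+ z) := κ 4 :* z) refl (b 0) (g (suc n)) _ ⟩
    ι 4 * ∑ (suc n) (λ k → θ (θ b) (suc k) * g (n ℕ.∸ k))
      ≡⟨ sym (∑-* (suc n) (ι 4) _) ⟩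
    ∑ (suc n) (λ k → ι 4 * (θ (θ b) (suc k) * g (n ℕ.∸ k)))
      ≡⟨ ∑-cong′ (suc n) (λ k → term k (g (n ℕ.∸ k))) ⟩
    ∑ (suc n) (λ k → ι 4 * (θ (θ b) k * g (n ℕ.∸ k)) + ι 4 * (θ b k * g (n ℕ.∸ k)) + b k * g (n ℕ.∸ k))
      ≡⟨ trans (∑-+ (suc n) _ _) (cong (_+ conv b g n) (∑-+ (suc n) _ _)) ⟩
    ∑ (suc n) (λ k → ι 4 * (θ (θ b) k * g (n ℕ.∸ k))) + ∑ (suc n) (λ k → ι 4 * (θ b k * g (n ℕ.∸ k))) + conv b g n
      ≡⟨ cong₂ (λ s t → s + t + conv b g n) (∑-* (suc n) (ι 4) _) (∑-* (suc n) (ι 4) _) ⟩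
    ι 4 * conv (θ (θ b)) g n + ι 4 * conv (θ b) g n + conv b g n ∎
    where
    open ≡-Reasoning
    term : ∀ k x → ι 4 * (θ (θ b) (suc k) * x) ≡ ι 4 * (θ (θ b) k * x) + ι 4 * (θ b k * x) + b k * x
    term k x rewrite ι-suc k = lin₁ x (b-suc k)
      (solve 4 (λ K B B′ x → let O = κ 2 :* K :+ κ 1 in
           κ 4 :* ((K :+ κ 1) :* ((K :+ κ 1) :* B′) :* x) :+ x :* (O :* O :* B)
        := κ 4 :* (K :* (K :* B) :* x) :+ κ 4 :* (K :* B :* x) :+ B :* x
           :+ x :* (κ 2 :* (K :+ κ 1) :* (κ 2 :* (K :+ κ 1)) :* B′)) refl (ι k) (b k) (b (suc k)) x)

  -- S n/16ⁿ, see ι-S.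
  s : ℕ → Carrier
  s = conv b b

  private
    -- The quadratic products of `B`, `θB` and `θ²B` that occur when `θ` is applied repeatedly to
    -- `B²`. The products `Y` and `Z` with `θ²B` are to be eliminated, then `v` and `W`.
    v W Y Z : ℕ → Carrier
    v = conv (θ b) b
    W = conv (θ b) (θ b)
    Y = conv (θ (θ b)) b
    Z = conv (θ (θ b)) (θ b)

    s-v : ∀ n → ι n * s n ≡ ι 2 * v n
    s-v n = trans (conv-leibniz b b n) (trans (cong (v n +_) (conv-comm b (θ b) n))
      (solve 1 (λ v → v :+ v := κ 2 :* v) refl (v n)))

    v-Y : ∀ n → ι n * v n ≡ Y n + W n
    v-Y n = conv-leibniz (θ b) b n

    W-Z : ∀ n → ι n * W n ≡ ι 2 * Z n
    W-Z n = trans (conv-leibniz (θ b) (θ b) n) (trans (cong (Z n +_) (conv-comm (θ b) (θ (θ b)) n))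
      (solve 1 (λ v → v :+ v := κ 2 :* v) refl (Z n)))

    -- The hypergeometric equation times `B`: Leibniz gives `v = n s / 2` and `Y = n v - W`, so that
    -- only `W` and `s` are left.
    W-suc : ∀ n → ι 4 * W (suc n) - ι 4 * W n
      ≡ ι 2 * (ι n + 1#) * (ι n + 1#) * s (suc n) - (ι 2 * ι n * (ι n + 1#) + 1#) * s n
    W-suc n = lin₁ (- 1#) (conv-θθb-suc b n) (lin₂ (- ι 4) v-Y′ (ι 4) (v-Y n)
      (lin₂ (- ι 2 * (ι n + 1#)) (sv′) (ι 2 * (ι n + 1#)) (s-v n)
      (solve 9 (λ N s₀ s₁ v₀ v₁ y₀ y₁ w₀ w₁ →
         κ 4 :* w₁ :- κ 4 :* w₀ :+ (:- κ 1) :* (κ 4 :* y₀ :+ κ 4 :* v₀ :+ s₀)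
           :+ (:- κ 4) :* (y₁ :+ w₁) :+ κ 4 :* (y₀ :+ w₀)
           :+ (:- κ 2) :* (N :+ κ 1) :* (κ 2 :* v₁) :+ κ 2 :* (N :+ κ 1) :* (κ 2 :* v₀)
      := κ 2 :* (N :+ κ 1) :* (N :+ κ 1) :* s₁ :- (κ 2 :* N :* (N :+ κ 1) :+ κ 1) :* s₀
           :+ (:- κ 1) :* (κ 4 :* y₁)
           :+ (:- κ 4) :* ((N :+ κ 1) :* v₁) :+ κ 4 :* (N :* v₀)
           :+ (:- κ 2) :* (N :+ κ 1) :* ((N :+ κ 1) :* s₁) :+ κ 2 :* (N :+ κ 1) :* (N :* s₀))
        refl (ι n) (s n) (s (suc n)) (v n) (v (suc n)) (Y n) (Y (suc n)) (W n) (W (suc n)))))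
      where
      v-Y′ : (ι n + 1#) * v (suc n) ≡ Y (suc n) + W (suc n)
      v-Y′ = trans (cong (_* v (suc n)) (sym (ι-suc n))) (v-Y (suc n))
      sv′ : (ι n + 1#) * s (suc n) ≡ ι 2 * v (suc n)
      sv′ = trans (cong (_* s (suc n)) (sym (ι-suc n))) (s-v (suc n))

    -- The hypergeometric equation times `θB`, with `Z = n W / 2`, is a second relation between
    -- `W n` and `W (suc n)`; together with `W-suc` it determines `W n` from two values of `s`.
    W-s : ∀ n → ι 4 * W n + (ι 2 * (ι n + 1#) * (ι n + 1#) * ι n + ι 2 * ι n + 1#) * s n
      ≡ ι 2 * (ι n + 1#) * (ι n + 1#) * (ι n + 1#) * s (suc n)
    W-s n = lin₂ (- ι 2) (trans (conv-θθb-suc (θ b) n) (cong (ι 4 * Z n + ι 4 * W n +_) (conv-comm b (θ b) n)))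
      (ι n + 1#) (W-suc n)
      (lin₃ 1# (s-v n) (ι 4) (W-Z n) (- ι 4) wz′
      (solve 8 (λ N s₀ s₁ w₀ w₁ z₀ z₁ v₀ →
         κ 4 :* w₀ :+ (κ 2 :* (N :+ κ 1) :* (N :+ κ 1) :* N :+ κ 2 :* N :+ κ 1) :* s₀
           :+ (:- κ 2) :* (κ 4 :* z₀ :+ κ 4 :* w₀ :+ v₀)
           :+ (N :+ κ 1) :* (κ 2 :* (N :+ κ 1) :* (N :+ κ 1) :* s₁ :- (κ 2 :* N :* (N :+ κ 1) :+ κ 1) :* s₀)
           :+ κ 1 :* (κ 2 :* v₀) :+ κ 4 :* (κ 2 :* z₀) :+ (:- κ 4) :* (κ 2 :* z₁)
      := κ 2 :* (N :+ κ 1) :* (N :+ κ 1) :* (N :+ κ 1) :* s₁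
           :+ (:- κ 2) :* (κ 4 :* z₁)
           :+ (N :+ κ 1) :* (κ 4 :* w₁ :- κ 4 :* w₀)
           :+ κ 1 :* (N :* s₀) :+ κ 4 :* (N :* w₀) :+ (:- κ 4) :* ((N :+ κ 1) :* w₁))
        refl (ι n) (s n) (s (suc n)) (W n) (W (suc n)) (Z n) (Z (suc n)) (v n)))
      where
      wz′ : (ι n + 1#) * W (suc n) ≡ ι 2 * Z (suc n)
      wz′ = trans (cong (_* W (suc n)) (sym (ι-suc n))) (W-Z (suc n))

  -- `W-s` at `n` and at `suc n` removes `W` from `W-suc`.
  s-recurrent : ∀ n → IsRecurrent s n
  s-recurrent n = lin₃ (- 1#) W-s′ 1# (W-s n) 1# (W-suc n)
    (solve 6 (λ N s₀ s₁ s₂ w₀ w₁ → let M = N :+ κ 1 in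
       κ 2 :* (N :+ κ 2) :* (N :+ κ 2) :* (N :+ κ 2) :* s₂ :+ κ 2 :* (N :+ κ 1) :* (N :+ κ 1) :* (N :+ κ 1) :* s₀
         :+ (:- κ 1) :* (κ 2 :* (M :+ κ 1) :* (M :+ κ 1) :* (M :+ κ 1) :* s₂)
         :+ κ 1 :* (κ 2 :* (N :+ κ 1) :* (N :+ κ 1) :* (N :+ κ 1) :* s₁)
         :+ κ 1 :* (κ 2 :* (N :+ κ 1) :* (N :+ κ 1) :* s₁ :- (κ 2 :* N :* (N :+ κ 1) :+ κ 1) :* s₀)
    := (κ 2 :* N :+ κ 3) :* (κ 2 :* N :* N :+ κ 6 :* N :+ κ 5) :* s₁
         :+ (:- κ 1) :* (κ 4 :* w₁ :+ (κ 2 :* (M :+ κ 1) :* (M :+ κ 1) :* M :+ κ 2 :* M :+ κ 1) :* s₁)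
         :+ κ 1 :* (κ 4 :* w₀ :+ (κ 2 :* (N :+ κ 1) :* (N :+ κ 1) :* N :+ κ 2 :* N :+ κ 1) :* s₀)
         :+ κ 1 :* (κ 4 :* w₁ :- κ 4 :* w₀))
      refl (ι n) (s n) (s (suc n)) (s (suc (suc n))) (W n) (W (suc n)))
    where
    W-s′ : ι 4 * W (suc n) + (ι 2 * (ι n + 1# + 1#) * (ι n + 1# + 1#) * (ι n + 1#) + ι 2 * (ι n + 1#) + 1#) * s (suc n)
      ≡ ι 2 * (ι n + 1# + 1#) * (ι n + 1# + 1#) * (ι n + 1# + 1#) * s (suc (suc n))
    W-s′ = subst (λ N → ι 4 * W (suc n) + (ι 2 * (N + 1#) * (N + 1#) * N + ι 2 * N + 1#) * s (suc n)
      ≡ ι 2 * (N + 1#) * (N + 1#) * (N + 1#) * s (suc (suc n))) (ι-suc n) (W-s (suc n))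

-- Recursive doubling exposes two successors at a time, so that period-two definitions such as `sgn`
-- and the steps of `T` reduce.
dbl : ℕ → ℕ
dbl zero    = zero
dbl (suc n) = suc (suc (dbl n))

-- Two expansions of `s` and the closed forms of both sums

module SumFormulas (R : ℚ-Algebra) where

  open ℚ-Algebra R
  open Recurrences R public

  private
    -- The recurrence of s in terms of y = 2n+3, applied to w, and its Zeilberger certificate H.
    L : Carrier → ℕ → Carrier
    L y k = (y + 1#) * (y + 1#) * (y + 1#) * w k (y + ι 2)
          + (y - 1#) * (y - 1#) * (y - 1#) * w k (y - ι 2)
          - ι 2 * y * (y * y + 1#) * w k y

    H : Carrier → ℕ → Carrier
    H y zero    = 0#
    H y (suc k) = ι 4 * (odd k * odd k) * b k * w k y * y

    -- The telescoping relation for `H` at `suc k` after division by `odd k * odd k * b k * w k y`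
    -- and multiplication by `D⁴`; the term `D + 1` is `odd (suc k)`.
    bracket : ∀ y K → let D = ι 2 * (K + 1#); O = ι 2 * K + 1# in (y + 1#) * (y + 1#) * (y + 1#) * ((y + 1# + D) * (y - 1# + D))
          + (y - 1#) * (y - 1#) * (y - 1#) * ((y - 1# - D) * (y + 1# - D))
          + (ι 2 * y * (y * y + 1#) + ι 4 * ((D + 1#) * (D + 1#)) * y) * (O * O - y * y)
          ≡ ι 4 * y * (D * D * D * D)
    bracket = solve 2 (λ y K → let D = κ 2 :* (K :+ κ 1); O = κ 2 :* K :+ κ 1 in
               (y :+ κ 1) :* (y :+ κ 1) :* (y :+ κ 1) :* ((y :+ κ 1 :+ D) :* (y :- κ 1 :+ D))
                 :+ (y :- κ 1) :* (y :- κ 1) :* (y :- κ 1) :* ((y :- κ 1 :- D) :* (y :+ κ 1 :- D))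
                 :+ (κ 2 :* y :* (y :* y :+ κ 1) :+ κ 4 :* ((D :+ κ 1) :* (D :+ κ 1)) :* y) :* (O :* O :- y :* y)
            := κ 4 :* y :* (D :* D :* D :* D)) refl
  
    L-ring : ∀ y O D E A W c₁ p c₂ q c₃ F → D * E ≡ 1# → c₁ * p + c₂ * q + (c₃ + ι 4 * ((D + 1#) * (D + 1#)) * y) * F ≡ ι 4 * y * (D * D * D * D) → 
      let t = ι 4 * ((D + 1#) * (D + 1#)); B = A * O * E * (A * O * E) in
      B * (c₁ * (- (p * W * (E * E))) + c₂ * (- (q * W * (E * E))) - c₃ * (W * F * (E * E)))
       ≡ t * B * (W * F * (E * E)) * y - ι 4 * (O * O) * (A * A) * W * y
    L-ring y O D E A W c₁ p c₂ q c₃ F DE bracket = lin₂ C₁ bracket C₂ DE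
            (solve 12 (λ y O D E A W c₁ p c₂ q c₃ F →
               let B  = A :* O :* E :* (A :* O :* E)
                   U  = A :* O :* (A :* O) :* W
                   C₁ = :- (U :* (E :* E) :* (E :* E))
                   C₂ = :- (κ 4 :* U :* y :* (D :* E :+ κ 1) :* (D :* E :* (D :* E) :+ κ 1))
                   t  = κ 4 :* ((D :+ κ 1) :* (D :+ κ 1)) in
                 B :* (c₁ :* (:- (p :* W :* (E :* E))) :+ c₂ :* (:- (q :* W :* (E :* E))) :- c₃ :* (W :* F :* (E :* E)))
                   :+ C₁ :* (κ 4 :* y :* (D :* D :* D :* D)) :+ C₂ :* κ 1
              := t :* B :* (W :* F :* (E :* E)) :* y :- κ 4 :* (O :* O) :* (A :* A) :* W :* y
                   :+ C₁ :* (c₁ :* p :+ c₂ :* q :+ (c₃ :+ t :* y) :* F)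
                   :+ C₂ :* (D :* E)) refl y O D E A W c₁ p c₂ q c₃ F)
      where U = A * O * (A * O) * W
            C₁ = - (U * (E * E) * (E * E))
            C₂ = - (ι 4 * U * y * (D * E + 1#) * (D * E * (D * E) + 1#))

    L-telescope : ∀ y k → b k * L y k ≡ H y (suc k) - H y k
    L-telescope y zero = solve 1 (λ y →
        κ 1 :* κ 1 :* ((y :+ κ 1) :* (y :+ κ 1) :* (y :+ κ 1) :* κ 1 :+ (y :- κ 1) :* (y :- κ 1) :* (y :- κ 1) :* κ 1
          :- κ 2 :* y :* (y :* y :+ κ 1) :* κ 1)
     := κ 4 :* ((κ 2 :* κ 0 :+ κ 1) :* (κ 2 :* κ 0 :+ κ 1)) :* (κ 1 :* κ 1) :* κ 1 :* y :- κ 0) refl y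
    L-telescope y (suc k) = begin
      b (suc k) * (c₁ * w (suc k) (y + ι 2) + c₂ * w (suc k) (y - ι 2) - c₃ * w (suc k) y)
        ≡⟨ cong₂ (λ u v → b (suc k) * (c₁ * u + c₂ * v - c₃ * w (suc k) y)) (w-shift k y) (w-shift⁻ k y) ⟩
      _ ≡⟨ L-ring y (odd k) D (e (suc k)) (a k) (w k y) c₁ _ c₂ _ c₃ _ (e-inverse k) (bracket y (ι k)) ⟩
      _ ≡⟨ cong (λ u → ι 4 * (u * u) * b (suc k) * w (suc k) y * y - H y (suc k))
             (cong (λ u → ι 2 * u + 1#) (sym (ι-suc k))) ⟩
      H y (suc (suc k)) - H y (suc k) ∎
      where
      open ≡-Reasoning
      D c₁ c₂ c₃ : Carrier
      D = ι 2 * (ι k + 1#)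
      c₁ = (y + 1#) * (y + 1#) * (y + 1#)
      c₂ = (y - 1#) * (y - 1#) * (y - 1#)
      c₃ = ι 2 * y * (y * y + 1#)

  s-w : ℕ → ℕ → Carrier
  s-w N n = ∑ N (λ k → b k * w k (odd n))

  private
    -- Of the telescoped sum only the upper boundary term is not zero by definition. It contains
    -- `w N (odd (suc n))`, which vanishes because `suc n < N`.
    s-w-eq : ∀ N n → suc (suc n) ℕ.≤ N → let y = odd (suc n) in
        (y + 1#) * (y + 1#) * (y + 1#) * s-w (suc N) (suc (suc n))
      + (y - 1#) * (y - 1#) * (y - 1#) * s-w (suc N) n
      - ι 2 * y * (y * y + 1#) * s-w (suc N) (suc n) ≡ 0#
    s-w-eq N n n<N = begin
      c₁ * s-w (suc N) (suc (suc n)) + c₂ * s-w (suc N) n - c₃ * s-w (suc N) (suc n)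
        ≡⟨ cong₂ (λ u v → c₁ * u + c₂ * v - c₃ * s-w (suc N) (suc n))
             (∑-cong′ (suc N) (λ k → cong (λ t → b k * w k t) (odd-suc (suc n))))
             (∑-cong′ (suc N) (λ k → cong (λ t → b k * w k t) odd-pred)) ⟩
      c₁ * ∑ (suc N) f₁ + c₂ * ∑ (suc N) f₂ - c₃ * ∑ (suc N) f₃
        ≡⟨ linear (suc N) c₁ c₂ c₃ f₁ f₂ f₃ ⟩
      ∑ (suc N) (λ k → c₁ * f₁ k + c₂ * f₂ k - c₃ * f₃ k)
        ≡⟨ ∑-cong′ (suc N) (λ k → trans (solve 7 (λ b x y z c₁ c₂ c₃ →
             c₁ :* (b :* x) :+ c₂ :* (b :* y) :- c₃ :* (b :* z) := b :* (c₁ :* x :+ c₂ :* y :- c₃ :* z)) refl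
               (b k) (w k (y + ι 2)) (w k (y - ι 2)) (w k y) c₁ c₂ c₃) (L-telescope y k)) ⟩
      ∑ (suc N) (λ k → H y (suc k) - H y k)
        ≡⟨ ∑-telescope (suc N) (H y) ⟩
      ι 4 * (odd N * odd N) * b N * w N y * y - 0#
        ≡⟨ cong (λ t → ι 4 * (odd N * odd N) * b N * t * y - 0#) (w-vanish′ n<N) ⟩
      ι 4 * (odd N * odd N) * b N * 0# * y - 0#
        ≡⟨ solve 2 (λ x y → x :* κ 0 :* y :- κ 0 := κ 0) refl (ι 4 * (odd N * odd N) * b N) y ⟩
      0# ∎
      where
      open ≡-Reasoning
      y c₁ c₂ c₃ : Carrier
      y = odd (suc n)
      c₁ = (y + 1#) * (y + 1#) * (y + 1#)
      c₂ = (y - 1#) * (y - 1#) * (y - 1#)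
      c₃ = ι 2 * y * (y * y + 1#)
      f₁ f₂ f₃ : ℕ → Carrier
      f₁ k = b k * w k (y + ι 2)
      f₂ k = b k * w k (y - ι 2)
      f₃ k = b k * w k y
      odd-pred : odd n ≡ y - ι 2
      odd-pred = trans (solve 1 (λ x → x := x :+ κ 2 :- κ 2) refl (odd n)) (cong (_- ι 2) (sym (odd-suc n)))
      linear : ∀ M c₁ c₂ c₃ f₁ f₂ f₃ → c₁ * ∑ M f₁ + c₂ * ∑ M f₂ - c₃ * ∑ M f₃
        ≡ ∑ M (λ k → c₁ * f₁ k + c₂ * f₂ k - c₃ * f₃ k)
      linear zero    c₁ c₂ c₃ f₁ f₂ f₃ = solve 3 (λ x y z → x :* κ 0 :+ y :* κ 0 :- z :* κ 0 := κ 0) refl c₁ c₂ c₃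
      linear (suc M) c₁ c₂ c₃ f₁ f₂ f₃ = trans
        (solve 9 (λ c₁ c₂ c₃ x y z s t u → c₁ :* (s :+ x) :+ c₂ :* (t :+ y) :- c₃ :* (u :+ z)
           := (c₁ :* s :+ c₂ :* t :- c₃ :* u) :+ (c₁ :* x :+ c₂ :* y :- c₃ :* z)) refl
           c₁ c₂ c₃ (f₁ M) (f₂ M) (f₃ M) (∑ M f₁) (∑ M f₂) (∑ M f₃))
        (cong (_+ (c₁ * f₁ M + c₂ * f₂ M - c₃ * f₃ M)) (linear M c₁ c₂ c₃ f₁ f₂ f₃))

    -- For `y = 2n+3` the coefficients `(y+1)³`, `(y-1)³` and `2y(y²+1)` are four times those of
    -- `IsRecurrent`, hence the common factor `ι 4`.
    recurrence-in-y : ∀ N y s₀ s₁ s₂ → y ≡ ι 2 * N + 1# + ι 2 →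
      (y + 1#) * (y + 1#) * (y + 1#) * s₂ + (y - 1#) * (y - 1#) * (y - 1#) * s₀ - ι 2 * y * (y * y + 1#) * s₁ ≡ 0# →
      ι 4 * (ι 2 * (N + ι 2) * (N + ι 2) * (N + ι 2) * s₂ + ι 2 * (N + 1#) * (N + 1#) * (N + 1#) * s₀)
      ≡ ι 4 * ((ι 2 * N + ι 3) * (ι 2 * N * N + ι 6 * N + ι 5) * s₁)
    recurrence-in-y N y s₀ s₁ s₂ refl eq = lin₁ 1# eq
      (solve 4 (λ N s₀ s₁ s₂ → let y = κ 2 :* N :+ κ 1 :+ κ 2 in
           κ 4 :* (κ 2 :* (N :+ κ 2) :* (N :+ κ 2) :* (N :+ κ 2) :* s₂ :+ κ 2 :* (N :+ κ 1) :* (N :+ κ 1) :* (N :+ κ 1) :* s₀)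
             :+ κ 1 :* κ 0
        := κ 4 :* ((κ 2 :* N :+ κ 3) :* (κ 2 :* N :* N :+ κ 6 :* N :+ κ 5) :* s₁)
             :+ κ 1 :* ((y :+ κ 1) :* (y :+ κ 1) :* (y :+ κ 1) :* s₂ :+ (y :- κ 1) :* (y :- κ 1) :* (y :- κ 1) :* s₀
                          :- κ 2 :* y :* (y :* y :+ κ 1) :* s₁)) refl N s₀ s₁ s₂)

  s-w-recurrent : ∀ N n → suc n ℕ.< N → IsRecurrent (s-w (suc N)) n
  s-w-recurrent N n n<N = cancel (inv-inverse 3)
    (recurrence-in-y (ι n) (odd (suc n)) (s-w (suc N) n) (s-w (suc N) (suc n)) (s-w (suc N) (suc (suc n)))
      (odd-suc n) (s-w-eq N n n<N))

  s≡s-w : ∀ N n → n ℕ.≤ N → s n ≡ s-w (suc N) n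
  s≡s-w N zero    _ = begin
    0# + 1# * 1# * (1# * 1#)
      ≡⟨ solve 0 (κ 0 :+ κ 1 :* κ 1 :* (κ 1 :* κ 1) := κ 1 :* κ 1 :* κ 1 :+ κ 0) refl ⟩
    b 0 * w 0 (odd 0) + 0#
      ≡⟨ cong (b 0 * w 0 (odd 0) +_) (sym (∑-0 N (λ k _ →
           trans (cong (b (suc k) *_) (w-vanish′ {suc k} {0} (s≤s z≤n))) (zeroʳ _)))) ⟩
    b 0 * w 0 (odd 0) + ∑ N (λ k → b (suc k) * w (suc k) (odd 0))
      ≡⟨ sym (∑-head N (λ k → b k * w k (odd 0))) ⟩
    s-w (suc N) 0 ∎
    where open ≡-Reasoning
  s≡s-w (suc N) (suc n) n≤N = proj₂ (recurrent-unique (suc N) (s≡s-w (suc N) 0 z≤n) s₁ (λ m _ → s-recurrent m)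
      (s-w-recurrent (suc N)) n n≤N)
    where
    open ≡-Reasoning
    f : ℕ → Carrier
    f k = b k * w k (odd 1)
    s₁ : s 1 ≡ s-w (suc (suc N)) 1
    s₁ = begin
      0# + 1# * 1# * b 1 + b 1 * (1# * 1#)
        -- Both sides are one half: `2 * b 1 = 2/4`, and `1 + b 1 * w 1 3 = 1 - 2/4`.
        ≡⟨ lin₁ _ (e-inverse 0) (solve 1 (λ E →
             let A = κ 1 :* (κ 2 :* κ 0 :+ κ 1) :* E
                 y = κ 2 :* κ 1 :+ κ 1
                 G = κ 2 :* κ 0 :+ κ 1
                 D = κ 2 :* (κ 0 :+ κ 1) in
               κ 0 :+ κ 1 :* κ 1 :* (A :* A) :+ A :* A :* (κ 1 :* κ 1)
                 :+ (κ 4 :* E :* E :* E :+ κ 2 :* E :* E :+ κ 2 :* E :+ κ 1) :* κ 1 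
            := κ 1 :* κ 1 :* κ 1 :+ (A :* A :* (κ 1 :* (G :* G :- y :* y) :* (E :* E)) :+ κ 0)
                 :+ (κ 4 :* E :* E :* E :+ κ 2 :* E :* E :+ κ 2 :* E :+ κ 1) :* (D :* E)) refl (e 1)) ⟩
      f 0 + (f 1 + 0#)
        ≡⟨ cong (λ t → f 0 + (f 1 + t)) (sym (∑-0 N (λ k _ →
             trans (cong (b (suc (suc k)) *_) (w-vanish′ {suc (suc k)} {1} (s≤s (s≤s z≤n)))) (zeroʳ _)))) ⟩
      f 0 + (f 1 + ∑ N (λ k → f (suc (suc k))))
        ≡⟨ cong (f 0 +_) (sym (∑-head N (λ k → f (suc k)))) ⟩
      f 0 + ∑ (suc N) (λ k → f (suc k))
        ≡⟨ sym (∑-head (suc N) f) ⟩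
      s-w (suc (suc N)) 1 ∎

  -- T k n = (a k)³ (-1/4)ᵏ [xⁿ⁻²ᵏ] (1-x)^(-1/2-k), which vanishes for n < 2k.
  T : ℕ → ℕ → Carrier
  T zero    n             = a n
  T (suc k) zero          = 0#
  T (suc k) (suc zero)    = 0#
  T (suc k) (suc (suc m)) =
    - (odd k * odd k * (ι 2 * ι m + 1# - ι 2 * ι k) * (e (suc k) * e (suc k) * e (suc k)) * inv 4 * T k m)

  T-vanish : ∀ k n → n ℕ.< dbl k → T k n ≡ 0#
  T-vanish (suc k) zero          _                 = refl
  T-vanish (suc k) (suc zero)    _                 = refl
  T-vanish (suc k) (suc (suc m)) (s≤s (s≤s m<2k)) =
    trans (cong (λ t → - (c * t)) (T-vanish k m m<2k)) (solve 1 (λ c → :- (c :* κ 0) := κ 0) refl c)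
    where c = odd k * odd k * (ι 2 * ι m + 1# - ι 2 * ι k) * (e (suc k) * e (suc k) * e (suc k)) * inv 4

  ι-suc² : ∀ n → ι (suc (suc n)) ≡ ι n + ι 2
  ι-suc² n = trans (cong (_+ 1#) (ι-suc n)) (+-assoc _ _ _)

  private
    -- Covers the lower edge of the support of `T`: the value `T k 0` is zero except at `k = 0`.
    ιk*Tk0 : ∀ k → ι k * T k 0 ≡ 0#
    ιk*Tk0 zero    = zeroˡ _
    ιk*Tk0 (suc k) = zeroʳ _

    T-step-identity : ∀ K N c t₀ t₁ →
      ι 2 * (N + 1# - ι 2 * K) * t₁ ≡ (ι 2 * N + 1# - ι 2 * K) * t₀ →
      ι 2 * (N + ι 2 + 1# - ι 2 * (K + 1#)) * (- (c * (ι 2 * (N + 1#) + 1# - ι 2 * K) * t₁))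
      ≡ (ι 2 * (N + ι 2) + 1# - ι 2 * (K + 1#)) * (- (c * (ι 2 * N + 1# - ι 2 * K) * t₀))
    T-step-identity K N c t₀ t₁ h = lin₁ (- (c * (ι 2 * (N + 1#) + 1# - ι 2 * K))) h
      (solve 5 (λ K N c t₀ t₁ → let C = :- (c :* (κ 2 :* (N :+ κ 1) :+ κ 1 :- κ 2 :* K)) in
          κ 2 :* (N :+ κ 2 :+ κ 1 :- κ 2 :* (K :+ κ 1)) :* (:- (c :* (κ 2 :* (N :+ κ 1) :+ κ 1 :- κ 2 :* K) :* t₁))
            :+ C :* ((κ 2 :* N :+ κ 1 :- κ 2 :* K) :* t₀)
       := (κ 2 :* (N :+ κ 2) :+ κ 1 :- κ 2 :* (K :+ κ 1)) :* (:- (c :* (κ 2 :* N :+ κ 1 :- κ 2 :* K) :* t₀))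
            :+ C :* (κ 2 :* (N :+ κ 1 :- κ 2 :* K) :* t₁)) refl K N c t₀ t₁)

    -- From `k` to `suc k` the cube `(a k)³` gains `(odd k)³ (e (suc k))³`, while the coefficient of
    -- `x^(m-2k)` gains `(2m+1-2k)/odd k` as the exponent falls by one. This is why only two factors
    -- `odd k` remain.
    coeff : ℕ → Carrier
    coeff k = odd k * odd k * (e (suc k) * e (suc k) * e (suc k)) * inv 4

    T-suc : ∀ k m → T (suc k) (suc (suc m)) ≡ - (coeff k * (ι 2 * ι m + 1# - ι 2 * ι k) * T k m)
    T-suc k m = solve 5 (λ O X E q t → :- (O :* X :* E :* q :* t) := :- (O :* E :* q :* X :* t)) refl
      (odd k * odd k) (ι 2 * ι m + 1# - ι 2 * ι k) (e (suc k) * e (suc k) * e (suc k)) (inv 4) (T k m)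

  -- The ratio of consecutive coefficients of `(1-x)^(-1/2-k)`. Without denominators it also holds
  -- at the edge `n + 1 = 2k`, where the left factor is zero and `T k n` vanishes.
  T-step : ∀ k n → ι 2 * (ι n + 1# - ι 2 * ι k) * T k (suc n) ≡ (ι 2 * ι n + 1# - ι 2 * ι k) * T k n
  T-step zero n = lin₁ (a n * odd n) (e-inverse n)
    (solve 3 (λ N E A → κ 2 :* (N :+ κ 1 :- κ 2 :* κ 0) :* (A :* (κ 2 :* N :+ κ 1) :* E) :+ A :* (κ 2 :* N :+ κ 1) :* κ 1
       := (κ 2 :* N :+ κ 1 :- κ 2 :* κ 0) :* A :+ A :* (κ 2 :* N :+ κ 1) :* (κ 2 :* (N :+ κ 1) :* E)) refl (ι n) (e (suc n)) (a n))
  T-step (suc k) zero = trans (zeroʳ _) (sym (zeroʳ _))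
  T-step (suc k) (suc zero) rewrite ι-suc k = lin₁ (ι 4 * C) (ιk*Tk0 k)
    (solve 3 (λ K C t → let X = κ 2 :* κ 0 :+ κ 1 :- κ 2 :* K in
         κ 2 :* (κ 1 :+ κ 1 :- κ 2 :* (K :+ κ 1)) :* (:- (C :* t)) :+ κ 4 :* C :* κ 0
      := (κ 2 :* κ 1 :+ κ 1 :- κ 2 :* (K :+ κ 1)) :* κ 0 :+ κ 4 :* C :* (K :* t)) refl (ι k) C (T k 0))
    where C = odd k * odd k * (ι 2 * ι 0 + 1# - ι 2 * ι k) * (e (suc k) * e (suc k) * e (suc k)) * inv 4
  T-step (suc k) (suc (suc m)) = begin
    ι 2 * (ι (suc (suc m)) + 1# - ι 2 * ι (suc k)) * T (suc k) (suc (suc (suc m)))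
      ≡⟨ cong₂ (λ u v → ι 2 * (u + 1# - ι 2 * ι (suc k)) * v) (ι-suc² m) (trans (T-suc k (suc m))
           (cong (λ u → - (coeff k * (ι 2 * u + 1# - ι 2 * ι k) * T k (suc m))) (ι-suc m))) ⟩
    ι 2 * (ι m + ι 2 + 1# - ι 2 * ι (suc k)) * (- (coeff k * (ι 2 * (ι m + 1#) + 1# - ι 2 * ι k) * T k (suc m)))
      ≡⟨ cong (λ u → ι 2 * (ι m + ι 2 + 1# - ι 2 * u) * (- (coeff k * (ι 2 * (ι m + 1#) + 1# - ι 2 * ι k) * T k (suc m)))) (ι-suc k) ⟩
    ι 2 * (ι m + ι 2 + 1# - ι 2 * (ι k + 1#)) * (- (coeff k * (ι 2 * (ι m + 1#) + 1# - ι 2 * ι k) * T k (suc m)))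
      ≡⟨ T-step-identity (ι k) (ι m) (coeff k) (T k m) (T k (suc m)) (T-step k m) ⟩
    (ι 2 * (ι m + ι 2) + 1# - ι 2 * (ι k + 1#)) * (- (coeff k * (ι 2 * ι m + 1# - ι 2 * ι k) * T k m))
      ≡⟨ cong₂ (λ u v → (ι 2 * u + 1# - ι 2 * v) * (- (coeff k * (ι 2 * ι m + 1# - ι 2 * ι k) * T k m)))
           (sym (ι-suc² m)) (sym (ι-suc k)) ⟩
    (ι 2 * ι (suc (suc m)) + 1# - ι 2 * ι (suc k)) * (- (coeff k * (ι 2 * ι m + 1# - ι 2 * ι k) * T k m))
      ≡⟨ cong ((ι 2 * ι (suc (suc m)) + 1# - ι 2 * ι (suc k)) *_) (sym (T-suc k m)) ⟩
    (ι 2 * ι (suc (suc m)) + 1# - ι 2 * ι (suc k)) * T (suc k) (suc (suc m)) ∎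
    where open ≡-Reasoning

  T-suc-cleared : ∀ k m → let D = ι 2 * (ι k + 1#) in
    ι 4 * (D * D * D) * T (suc k) (suc (suc m)) ≡ - (odd k * odd k * (ι 2 * ι m + 1# - ι 2 * ι k) * T k m)
  T-suc-cleared k m = identity (odd k) (ι 2 * ι m + 1# - ι 2 * ι k) (ι 2 * (ι k + 1#)) (e (suc k)) (inv 4) (T k m)
    (e-inverse k) (inv-inverse 3)
    where
    identity : ∀ O X D E q t → D * E ≡ 1# → ι 4 * q ≡ 1# →
      ι 4 * (D * D * D) * (- (O * O * X * (E * E * E) * q * t)) ≡ - (O * O * X * t)
    identity O X D E q t DE 4q = lin₂ (- (O * O * X * t * (D * E * (D * E) * (D * E)))) 4q
      (- (O * O * X * t * (D * E * (D * E) + D * E + 1#))) DE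
      (solve 6 (λ O X D E q t → let Y = D :* E; Z = O :* O :* X :* t in
          κ 4 :* (D :* D :* D) :* (:- (O :* O :* X :* (E :* E :* E) :* q :* t))
            :+ (:- (Z :* (Y :* Y :* Y))) :* κ 1 :+ (:- (Z :* (Y :* Y :+ Y :+ κ 1))) :* κ 1
       := :- (O :* O :* X :* t)
            :+ (:- (Z :* (Y :* Y :* Y))) :* (κ 4 :* q) :+ (:- (Z :* (Y :* Y :+ Y :+ κ 1))) :* Y) refl O X D E q t)

  -- Zeilberger certificate of the second expansion. The factor `(2k)³` makes it vanish at `k = 0`
  -- and clears the cube of `e k` contained in `T k`.
  G : ℕ → ℕ → Carrier
  G m k = ι 2 * ((ι 2 * ι k) * (ι 2 * ι k) * (ι 2 * ι k)) * (ι 2 * T k (suc (suc m)) - T k (suc m))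

  -- Expresses the certificate at `suc k` through `T k`, so that the telescoping relation involves a
  -- single `k` and can be settled by `T-step` alone.
  G-suc : ∀ m k → G m (suc k) ≡ - (odd k * odd k * (ι m + 1#) * T k m)
  G-suc m k = trans (cong (λ u → ι 2 * ((ι 2 * u) * (ι 2 * u) * (ι 2 * u)) * X) (ι-suc k)) (lemma m)
    where
    X = ι 2 * T (suc k) (suc (suc m)) - T (suc k) (suc m)
    D = ι 2 * (ι k + 1#)
    lemma : ∀ m → ι 2 * (D * D * D) * (ι 2 * T (suc k) (suc (suc m)) - T (suc k) (suc m))
      ≡ - (odd k * odd k * (ι m + 1#) * T k m)
    lemma zero = lin₂ 1# (T-suc-cleared k zero) (ι 2 * (odd k * odd k)) (ιk*Tk0 k)
      (solve 5 (λ K O D t t′ →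
          κ 2 :* (D :* D :* D) :* (κ 2 :* t′ :- κ 0) :+ κ 1 :* (:- (O :* O :* (κ 2 :* κ 0 :+ κ 1 :- κ 2 :* K) :* t))
            :+ κ 2 :* (O :* O) :* κ 0
       := :- (O :* O :* (κ 0 :+ κ 1) :* t) :+ κ 1 :* (κ 4 :* (D :* D :* D) :* t′)
            :+ κ 2 :* (O :* O) :* (K :* t)) refl (ι k) (odd k) D (T k 0) (T (suc k) 2))
    lemma (suc m) = cancel (inv-inverse 1) (identity (ι k) (ι m) (ι (suc m)) (odd k) (D * D * D) (T k m) (T k (suc m))
      (T (suc k) (suc (suc m))) (T (suc k) (suc (suc (suc m)))) (ι-suc m) (T-suc-cleared k m) (T-suc-cleared k (suc m)) (T-step k m))
      where
      identity : ∀ K M M′ O D t₀ t₁ u₀ u₁ → M′ ≡ M + 1# →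
        ι 4 * D * u₀ ≡ - (O * O * (ι 2 * M + 1# - ι 2 * K) * t₀) →
        ι 4 * D * u₁ ≡ - (O * O * (ι 2 * M′ + 1# - ι 2 * K) * t₁) →
        ι 2 * (M + 1# - ι 2 * K) * t₁ ≡ (ι 2 * M + 1# - ι 2 * K) * t₀ →
        ι 2 * (ι 2 * D * (ι 2 * u₁ - u₀)) ≡ ι 2 * (- (O * O * (M′ + 1#) * t₁))
      identity K M M′ O D t₀ t₁ u₀ u₁ refl p₀ p₁ q = lin₃ (- 1#) p₀ (ι 2) p₁ (- (O * O)) q
        (solve 8 (λ K M O D t₀ t₁ u₀ u₁ →
            κ 2 :* (κ 2 :* D :* (κ 2 :* u₁ :- u₀)) :+ (:- κ 1) :* (:- (O :* O :* (κ 2 :* M :+ κ 1 :- κ 2 :* K) :* t₀))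
              :+ κ 2 :* (:- (O :* O :* (κ 2 :* (M :+ κ 1) :+ κ 1 :- κ 2 :* K) :* t₁))
              :+ (:- (O :* O)) :* ((κ 2 :* M :+ κ 1 :- κ 2 :* K) :* t₀)
         := κ 2 :* (:- (O :* O :* (M :+ κ 1 :+ κ 1) :* t₁)) :+ (:- κ 1) :* (κ 4 :* D :* u₀)
              :+ κ 2 :* (κ 4 :* D :* u₁) :+ (:- (O :* O)) :* (κ 2 :* (M :+ κ 1 :- κ 2 :* K) :* t₁))
          refl K M O D t₀ t₁ u₀ u₁)

  G-telescope : ∀ m k →
    ι 2 * (ι 2 * (ι m + ι 2) * (ι m + ι 2) * (ι m + ι 2)) * T k (suc (suc m))
    + ι 2 * (ι 2 * (ι m + 1#) * (ι m + 1#) * (ι m + 1#)) * T k m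
    - ι 2 * ((ι 2 * ι m + ι 3) * (ι 2 * ι m * ι m + ι 6 * ι m + ι 5)) * T k (suc m)
    ≡ - (G m (suc k) - G m k)
  G-telescope m k = identity (ι k) (ι m) (T k m) (T k (suc m)) (T k (suc (suc m))) (G m (suc k)) (G-suc m k) (T-step k m)
    (subst (λ M → ι 2 * (M + 1# - ι 2 * ι k) * T k (suc (suc m)) ≡ (ι 2 * M + 1# - ι 2 * ι k) * T k (suc m))
      (ι-suc m) (T-step k (suc m)))
    where
    identity : ∀ K M t₀ t₁ t₂ g → g ≡ - ((ι 2 * K + 1#) * (ι 2 * K + 1#) * (M + 1#) * t₀) →
      ι 2 * (M + 1# - ι 2 * K) * t₁ ≡ (ι 2 * M + 1# - ι 2 * K) * t₀ →
      ι 2 * (M + 1# + 1# - ι 2 * K) * t₂ ≡ (ι 2 * (M + 1#) + 1# - ι 2 * K) * t₁ →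
      ι 2 * (ι 2 * (M + ι 2) * (M + ι 2) * (M + ι 2)) * t₂
      + ι 2 * (ι 2 * (M + 1#) * (M + 1#) * (M + 1#)) * t₀
      - ι 2 * ((ι 2 * M + ι 3) * (ι 2 * M * M + ι 6 * M + ι 5)) * t₁
      ≡ - (g - ι 2 * ((ι 2 * K) * (ι 2 * K) * (ι 2 * K)) * (ι 2 * t₂ - t₁))
    -- Collected on one side, `t₀` has the coefficient `(M+1)((2M+2)² - (2K+1)²)` and `t₂` has
    -- `4((M+2)³ - (2K)³)`. Each difference of powers contains the factor that `p` or `q` converts
    -- into a multiple of `t₁`; the multipliers are the cofactors.
    identity K M t₀ t₁ t₂ g refl p q = lin₂ (- ((M + 1#) * (ι 2 * M + ι 3 + ι 2 * K))) p
      (ι 2 * ((M + ι 2) * (M + ι 2) + ι 2 * K * (M + ι 2) + ι 4 * K * K)) q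
      (solve 5 (λ K M t₀ t₁ t₂ →
         let C₁ = :- ((M :+ κ 1) :* (κ 2 :* M :+ κ 3 :+ κ 2 :* K))
             C₂ = κ 2 :* ((M :+ κ 2) :* (M :+ κ 2) :+ κ 2 :* K :* (M :+ κ 2) :+ κ 4 :* K :* K) in
         κ 2 :* (κ 2 :* (M :+ κ 2) :* (M :+ κ 2) :* (M :+ κ 2)) :* t₂
           :+ κ 2 :* (κ 2 :* (M :+ κ 1) :* (M :+ κ 1) :* (M :+ κ 1)) :* t₀
           :- κ 2 :* ((κ 2 :* M :+ κ 3) :* (κ 2 :* M :* M :+ κ 6 :* M :+ κ 5)) :* t₁
           :+ C₁ :* ((κ 2 :* M :+ κ 1 :- κ 2 :* K) :* t₀)
           :+ C₂ :* ((κ 2 :* (M :+ κ 1) :+ κ 1 :- κ 2 :* K) :* t₁)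
      := :- (:- ((κ 2 :* K :+ κ 1) :* (κ 2 :* K :+ κ 1) :* (M :+ κ 1) :* t₀)
             :- κ 2 :* ((κ 2 :* K) :* (κ 2 :* K) :* (κ 2 :* K)) :* (κ 2 :* t₂ :- t₁))
           :+ C₁ :* (κ 2 :* (M :+ κ 1 :- κ 2 :* K) :* t₁)
           :+ C₂ :* (κ 2 :* (M :+ κ 1 :+ κ 1 :- κ 2 :* K) :* t₂)) refl K M t₀ t₁ t₂)

  s-T : ℕ → ℕ → Carrier
  s-T N n = ∑ N (λ k → T k n)

  s-T-recurrent : ∀ N m → suc (suc m) ℕ.< dbl N → IsRecurrent (s-T N) m
  s-T-recurrent N m m<N = cancel (inv-inverse 1) (lin₁ 1# eq
    (solve 4 (λ a b c M → κ 2 :* (a :+ b) :+ κ 1 :* κ 0 := κ 2 :* (M :* c) :+ κ 1 :* (κ 2 :* a :+ κ 2 :* b :- κ 2 :* M :* c)) refl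
      (c₂ * s-T N (suc (suc m))) (c₀ * s-T N m) (s-T N (suc m)) M))
    where
    open ≡-Reasoning
    c₂ c₀ M : Carrier
    c₂ = ι 2 * (ι m + ι 2) * (ι m + ι 2) * (ι m + ι 2)
    c₀ = ι 2 * (ι m + 1#) * (ι m + 1#) * (ι m + 1#)
    M = (ι 2 * ι m + ι 3) * (ι 2 * ι m * ι m + ι 6 * ι m + ι 5)
    linear : ∀ N → ι 2 * (c₂ * s-T N (suc (suc m))) + ι 2 * (c₀ * s-T N m) - ι 2 * M * s-T N (suc m)
      ≡ ∑ N (λ k → ι 2 * c₂ * T k (suc (suc m)) + ι 2 * c₀ * T k m - ι 2 * M * T k (suc m))
    linear zero    = solve 3 (λ a b c → κ 2 :* (a :* κ 0) :+ κ 2 :* (b :* κ 0) :- κ 2 :* c :* κ 0 := κ 0) refl c₂ c₀ M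
    linear (suc N) = trans
      (solve 9 (λ a b c s t u x y z →
          κ 2 :* (a :* (s :+ x)) :+ κ 2 :* (b :* (t :+ y)) :- κ 2 :* c :* (u :+ z)
       := κ 2 :* (a :* s) :+ κ 2 :* (b :* t) :- κ 2 :* c :* u :+ (κ 2 :* a :* x :+ κ 2 :* b :* y :- κ 2 :* c :* z)) refl
        c₂ c₀ M (s-T N (suc (suc m))) (s-T N m) (s-T N (suc m)) (T N (suc (suc m))) (T N m) (T N (suc m)))
      (cong (_+ (ι 2 * c₂ * T N (suc (suc m)) + ι 2 * c₀ * T N m - ι 2 * M * T N (suc m))) (linear N))
    eq : ι 2 * (c₂ * s-T N (suc (suc m))) + ι 2 * (c₀ * s-T N m) - ι 2 * M * s-T N (suc m) ≡ 0#
    eq = begin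
      _ ≡⟨ linear N ⟩
      ∑ N (λ k → ι 2 * c₂ * T k (suc (suc m)) + ι 2 * c₀ * T k m - ι 2 * M * T k (suc m))
        ≡⟨ ∑-cong′ N (G-telescope m) ⟩
      ∑ N (λ k → - (G m (suc k) - G m k))
        ≡⟨ ∑-cong′ N (λ k → solve 2 (λ x y → :- (x :- y) := (:- x) :- (:- y)) refl (G m (suc k)) (G m k)) ⟩
      ∑ N (λ k → - G m (suc k) - - G m k)
        ≡⟨ ∑-telescope N (λ k → - G m k) ⟩
      - G m N - - G m 0
        ≡⟨ cong₂ (λ x y → - (ι 2 * (ι 2 * ι N * (ι 2 * ι N) * (ι 2 * ι N)) * (ι 2 * x - y)) - - G m 0)
             (T-vanish N (suc (suc m)) m<N) (T-vanish N (suc m) (ℕₚ.<-trans (ℕₚ.n<1+n _) m<N)) ⟩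
      - (ι 2 * (ι 2 * ι N * (ι 2 * ι N) * (ι 2 * ι N)) * (ι 2 * 0# - 0#)) - - G m 0
        ≡⟨ solve 2 (λ x y → :- (x :* (κ 2 :* κ 0 :- κ 0)) :- (:- (κ 2 :* ((κ 2 :* κ 0) :* (κ 2 :* κ 0) :* (κ 2 :* κ 0)) :* y)) := κ 0) refl
             (ι 2 * (ι 2 * ι N * (ι 2 * ι N) * (ι 2 * ι N))) (ι 2 * T 0 (suc (suc m)) - T 0 (suc m)) ⟩
      0# ∎

  -- Terms with `k > h` start only at `n = 2h+2`, so `suc h` terms suffice in this range.
  s≡s-T : ∀ h n → n ℕ.≤ suc (dbl h) → s n ≡ s-T (suc h) n
  s≡s-T h n n≤ = agree n n≤
    where
    open ≡-Reasoning
    s-T₀ : ∀ n → n ℕ.< 2 → s-T (suc h) n ≡ a n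
    s-T₀ n n<2 = trans (∑-head h (λ k → T k n)) (trans (cong (a n +_) (∑-0 h (λ k _ → T-vanish (suc k) n (ℕₚ.≤-trans n<2 (s≤s (s≤s z≤n))))))
      (+-identityʳ _))
    s₀ : s 0 ≡ s-T (suc h) 0
    s₀ = trans (solve 0 (κ 0 :+ κ 1 :* κ 1 :* (κ 1 :* κ 1) := κ 1) refl) (sym (s-T₀ 0 (s≤s z≤n)))
    s₁ : s 1 ≡ s-T (suc h) 1
    s₁ = trans (lin₁ _ (e-inverse 0) (solve 1 (λ E →
             let A = κ 1 :* (κ 2 :* κ 0 :+ κ 1) :* E in
               κ 0 :+ κ 1 :* κ 1 :* (A :* A) :+ A :* A :* (κ 1 :* κ 1) :+ E :* κ 1
            := A :+ E :* (κ 2 :* (κ 0 :+ κ 1) :* E)) refl (e 1))) (sym (s-T₀ 1 (s≤s (s≤s z≤n))))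
    pairs : ∀ n → n ℕ.< suc (dbl h) → s n ≡ s-T (suc h) n × s (suc n) ≡ s-T (suc h) (suc n)
    pairs = recurrent-unique (suc (dbl h)) s₀ s₁ (λ m _ → s-recurrent m) (λ m m< → s-T-recurrent (suc h) m (s≤s m<))
    agree : ∀ n → n ℕ.≤ suc (dbl h) → s n ≡ s-T (suc h) n
    agree zero    _   = s₀
    agree (suc n) n≤ = proj₂ (pairs n n≤)

  -- The value `w k (2N+1)` is a neighbour of `π k` at `2N` and at `2N+2`. Adding the two relations
  -- cancels `k` and gives `2N π k (2N) + (2N+2) π k (2N+2) = 2(2N+1) w k (2N+1)`.
  ∑w-odd : ∀ N k → ∑ N (λ n → odd n * sgn n * w k (odd n)) ≡ - (sgn N * ι N * π k (ι 2 * ι N))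
  ∑w-odd zero    k = solve 1 (λ x → κ 0 := :- (κ 1 :* κ 0 :* x)) refl (π k (ι 2 * ι 0))
  ∑w-odd (suc N) k = trans (cong (_+ odd N * sgn N * w k (odd N)) (∑w-odd N k))
    (trans (cancel (inv-inverse 1) (identity (ι N) (ι k) (sgn N) (π k (ι 2 * ι N)) (π k (ι 2 * (ι N + 1#))) (w k (odd N))
      (π-w k (ι 2 * ι N))
      (trans (π-w⁻ k (ι 2 * (ι N + 1#))) (cong (λ t → (ι 2 * (ι N + 1#) + ι 2 * ι k) * w k t)
        (solve 1 (λ N → κ 2 :* (N :+ κ 1) :- κ 1 := κ 2 :* N :+ κ 1) refl (ι N))))))
      (cong (λ t → - (- sgn N * t * π k (ι 2 * t))) (sym (ι-suc N))))
    where
    identity : ∀ N K σ p q w → ι 2 * N * p ≡ (ι 2 * N - ι 2 * K) * w →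
      ι 2 * (N + 1#) * q ≡ (ι 2 * (N + 1#) + ι 2 * K) * w →
      ι 2 * (- (σ * N * p) + (ι 2 * N + 1#) * σ * w) ≡ ι 2 * (- (- σ * (N + 1#) * q))
    identity N K σ p q w h₁ h₂ = lin₂ (- σ) h₁ (- σ) h₂
      (solve 6 (λ N K σ p q w → κ 2 :* (:- (σ :* N :* p) :+ (κ 2 :* N :+ κ 1) :* σ :* w)
           :+ (:- σ) :* ((κ 2 :* N :- κ 2 :* K) :* w) :+ (:- σ) :* ((κ 2 :* (N :+ κ 1) :+ κ 2 :* K) :* w)
        := κ 2 :* (:- ((:- σ) :* (N :+ κ 1) :* q))
           :+ (:- σ) :* (κ 2 :* N :* p) :+ (:- σ) :* (κ 2 :* (N :+ κ 1) :* q)) refl N K σ p q w)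

  alternating-sum : ∀ N → ∑ (suc N) (λ n → odd n * sgn n * s n)
    ≡ sgn N * ι (suc N) * ∑ (suc N) (λ k → b k * π k (ι 2 * ι (suc N)))
  alternating-sum N = begin
    ∑ (suc N) (λ n → odd n * sgn n * s n)
      ≡⟨ ∑-cong (suc N) (λ { n (s≤s n≤N) → trans (cong (odd n * sgn n *_) (s≡s-w N n n≤N)) (sym (∑-* (suc N) (odd n * sgn n) _)) }) ⟩
    ∑ (suc N) (λ n → ∑ (suc N) (λ k → odd n * sgn n * (b k * w k (odd n))))
      ≡⟨ ∑-swap (suc N) (suc N) _ ⟩
    ∑ (suc N) (λ k → ∑ (suc N) (λ n → odd n * sgn n * (b k * w k (odd n))))
      ≡⟨ ∑-cong′ (suc N) inner ⟩
    ∑ (suc N) (λ k → sgn N * ι (suc N) * (b k * π k (ι 2 * ι (suc N))))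
      ≡⟨ ∑-* (suc N) (sgn N * ι (suc N)) _ ⟩
    sgn N * ι (suc N) * ∑ (suc N) (λ k → b k * π k (ι 2 * ι (suc N))) ∎
    where
    open ≡-Reasoning
    inner : ∀ k → ∑ (suc N) (λ n → odd n * sgn n * (b k * w k (odd n))) ≡ sgn N * ι (suc N) * (b k * π k (ι 2 * ι (suc N)))
    inner k = trans (∑-cong′ (suc N) (λ n → solve 4 (λ o σ b w → o :* σ :* (b :* w) := b :* (o :* σ :* w)) refl
        (odd n) (sgn n) (b k) (w k (odd n))))
      (trans (∑-* (suc N) (b k) _) (trans (cong (b k *_) (∑w-odd (suc N) k))
        (solve 4 (λ b σ N p → b :* (:- ((:- σ) :* N :* p)) := σ :* N :* (b :* p)) refl (b k) (sgn N) (ι (suc N)) (π k (ι 2 * ι (suc N))))))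

  -- By `T-step` the increment of the right-hand side is `2^N ((2N+1-2k) - (N-2k)) T k N`; the
  -- parameter `k` drops out and the weight `N+1` remains.
  ∑T : ∀ N k → ∑ N (λ n → (ι n + 1#) * ι 2 ^ n * T k n) ≡ ι 2 ^ N * (ι N - ι 2 * ι k) * T k N
  ∑T zero    zero    = solve 0 (κ 0 := κ 1 :* (κ 0 :- κ 2 :* κ 0) :* κ 1) refl
  ∑T zero    (suc k) = sym (zeroʳ _)
  ∑T (suc N) k = trans (cong (_+ (ι N + 1#) * ι 2 ^ N * T k N) (∑T N k))
    (trans (identity (ι N) (ι k) (ι 2 ^ N) (T k N) (T k (suc N)) (T-step k N))
      (cong (λ t → ι 2 * ι 2 ^ N * (t - ι 2 * ι k) * T k (suc N)) (sym (ι-suc N))))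
    where
    identity : ∀ N K P t₀ t₁ → ι 2 * (N + 1# - ι 2 * K) * t₁ ≡ (ι 2 * N + 1# - ι 2 * K) * t₀ →
      P * (N - ι 2 * K) * t₀ + (N + 1#) * P * t₀ ≡ ι 2 * P * (N + 1# - ι 2 * K) * t₁
    identity N K P t₀ t₁ h = lin₁ (- P) h (solve 5 (λ N K P t₀ t₁ →
         P :* (N :- κ 2 :* K) :* t₀ :+ (N :+ κ 1) :* P :* t₀ :+ (:- P) :* ((κ 2 :* N :+ κ 1 :- κ 2 :* K) :* t₀)
      := κ 2 :* P :* (N :+ κ 1 :- κ 2 :* K) :* t₁ :+ (:- P) :* (κ 2 :* (N :+ κ 1 :- κ 2 :* K) :* t₁)) refl N K P t₀ t₁)

  -- o r = 1/(2r+1) and α r = 1/(a r).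
  o α : ℕ → Carrier
  o r = inv (suc (2 ℕ.* r))
  α zero    = 1#
  α (suc r) = α r * (ι 2 * (ι r + 1#)) * o r

  o-inverse : ∀ r → odd r * o r ≡ 1#
  o-inverse r = trans (cong (_* o r) (sym (trans (ι-suc (2 ℕ.* r)) (cong (_+ 1#) (ι-* 2 r))))) (inv-inverse (2 ℕ.* r))

  ι-dbl : ∀ n → ι (dbl n) ≡ ι 2 * ι n
  ι-dbl zero    = sym (zeroʳ _)
  ι-dbl (suc n) = trans (ι-suc² (dbl n)) (trans (cong (_+ ι 2) (ι-dbl n)) (trans
    (solve 1 (λ N → κ 2 :* N :+ κ 2 := κ 2 :* (N :+ κ 1)) refl (ι n)) (cong (ι 2 *_) (sym (ι-suc n)))))

  ι-odd : ∀ n → ι (suc (dbl n)) ≡ odd n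
  ι-odd n = trans (ι-suc (dbl n)) (cong (_+ 1#) (ι-dbl n))

  private
    a³ : ℕ → Carrier
    a³ k = a k * a k * a k

    -- Here the linear coefficient `k + 1/2` of `(1-x)^(-1/2-k)` occurs, and the power of two
    -- cancels both its denominator and `4ᵏ`.
    T-diagonal : ∀ k → ι 2 ^ suc (dbl k) * T k (suc (dbl k)) ≡ odd k * sgn k * a³ k
    T-diagonal zero = lin₁ 1# (e-inverse 0) (solve 1 (λ E →
         κ 2 :* κ 1 :* (κ 1 :* (κ 2 :* κ 0 :+ κ 1) :* E) :+ κ 1 :* κ 1
      := (κ 2 :* κ 0 :+ κ 1) :* κ 1 :* (κ 1 :* κ 1 :* κ 1) :+ κ 1 :* (κ 2 :* (κ 0 :+ κ 1) :* E)) refl (e 1))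
    T-diagonal (suc k) = trans (cong (λ t → ι 2 * (ι 2 * ι 2 ^ suc (dbl k)) * (- (odd k * odd k * (ι 2 * t + 1# - ι 2 * ι k)
          * (e (suc k) * e (suc k) * e (suc k)) * inv 4 * T k (suc (dbl k))))) (ι-odd k))
      (trans (identity (ι k) (e (suc k)) (inv 4) (ι 2 ^ suc (dbl k)) (T k (suc (dbl k))) (sgn k) (a k) (T-diagonal k) (inv-inverse 3))
        (cong (λ t → t * - sgn k * a³ (suc k)) (sym (odd-suc k))))
      where
      identity : ∀ K E q P t σ A → P * t ≡ (ι 2 * K + 1#) * σ * (A * A * A) → ι 4 * q ≡ 1# → let O = ι 2 * K + 1# in
        ι 2 * (ι 2 * P) * (- (O * O * (ι 2 * O + 1# - ι 2 * K) * (E * E * E) * q * t))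
        ≡ (O + ι 2) * - σ * (A * O * E * (A * O * E) * (A * O * E))
      identity K E q P t σ A h 4q = lin₂ (- (ι 4 * q * O * O * (ι 2 * K + ι 3) * (E * E * E))) h
        (- ((O + ι 2) * σ * (A * O * E * (A * O * E) * (A * O * E)))) 4q
        (solve 7 (λ K E q P t σ A → let O = κ 2 :* K :+ κ 1; X = (O :+ κ 2) :* σ :* (A :* O :* E :* (A :* O :* E) :* (A :* O :* E))
                                        Y = :- (κ 4 :* q :* O :* O :* (κ 2 :* K :+ κ 3) :* (E :* E :* E)) in
            κ 2 :* (κ 2 :* P) :* (:- (O :* O :* (κ 2 :* O :+ κ 1 :- κ 2 :* K) :* (E :* E :* E) :* q :* t))
              :+ Y :* (O :* σ :* (A :* A :* A)) :+ (:- X) :* κ 1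
         := (O :+ κ 2) :* (:- σ) :* (A :* O :* E :* (A :* O :* E) :* (A :* O :* E))
              :+ Y :* (P :* t) :+ (:- X) :* (κ 4 :* q)) refl K E q P t σ A)
        where O = ι 2 * K + 1#

    T-closed-step₁ : ∀ K R O D P T₀ T₁ U σα³ A A′ → let M = ι 2 * (K + R) + 1#; p = M + ι 2 in
      ι 4 * (D * D * D) * U ≡ - (O * O * (ι 2 * M + 1# - ι 2 * K) * T₀) →
      ι 2 * (M + 1# - ι 2 * K) * T₁ ≡ (ι 2 * M + 1# - ι 2 * K) * T₀ →
      P * U * (ι 2 * R + 1#) ≡ p * σα³ * (A′ * A′ * A′) →
      A′ * A′ * A′ * (D * D * D) ≡ A * A * A * (O * O * O) →
      ι 4 * O * O * (- (P * (R + 1#) * (ι 2 * R + 1#) * T₁)) ≡ ι 4 * O * O * (p * σα³ * (A * A * A) * O)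
    T-closed-step₁ K R O D P T₀ T₁ U Σ A A′ h₁ h₂ h₃ h₄ =
      lin₂ (- (P * (ι 2 * R + 1#))) h₁ (- (P * (ι 2 * R + 1#) * O * O)) h₂
      (lin₂ (ι 4 * (D * D * D)) h₃ (ι 4 * (ι 2 * (K + R) + 1# + ι 2) * Σ) h₄
      (solve 11 (λ K R O D P T₀ T₁ U Σ A A′ →
         let M = κ 2 :* (K :+ R) :+ κ 1
             p = M :+ κ 2
             X = κ 2 :* M :+ κ 1 :- κ 2 :* K
             Y = P :* (κ 2 :* R :+ κ 1)
             D³ = D :* D :* D
             C₁ = :- Y
             C₂ = :- (Y :* O :* O) in
         κ 4 :* O :* O :* (:- (P :* (R :+ κ 1) :* (κ 2 :* R :+ κ 1) :* T₁))
           :+ C₁ :* (:- (O :* O :* X :* T₀)) :+ C₂ :* (X :* T₀)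
           :+ κ 4 :* D³ :* (p :* Σ :* (A′ :* A′ :* A′)) :+ κ 4 :* p :* Σ :* (A :* A :* A :* (O :* O :* O))
      := κ 4 :* O :* O :* (p :* Σ :* (A :* A :* A) :* O)
           :+ C₁ :* (κ 4 :* D³ :* U) :+ C₂ :* (κ 2 :* (M :+ κ 1 :- κ 2 :* K) :* T₁)
           :+ κ 4 :* D³ :* (P :* U :* (κ 2 :* R :+ κ 1)) :+ κ 4 :* p :* Σ :* (A′ :* A′ :* A′ :* D³))
        refl K R O D P T₀ T₁ U Σ A A′))

    -- The new factor of `π` is `(2R+2)² - p² = -(2K+1)(2K+4R+5)`: the second factor comes from the
    -- step from `T₁` to `T₂`, the first is supplied by the preceding step.
    T-closed-step₂ : ∀ K R E o P T₁ T₂ σA³ α π → let M = ι 2 * (K + R) + 1#; p = M + ι 2 in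
      ι 2 * (R + 1#) * E ≡ 1# → (ι 2 * R + 1#) * o ≡ 1# →
      ι 2 * (M + 1# + 1# - ι 2 * K) * T₂ ≡ (ι 2 * (M + 1#) + 1# - ι 2 * K) * T₁ →
      - (P * (R + 1#) * (ι 2 * R + 1#) * T₁) ≡ p * σA³ * α * π * (ι 2 * K + 1#) →
      ι 2 * (P * T₂ * (ι 2 * (R + 1#) + 1#))
      ≡ ι 2 * (p * σA³ * (α * (ι 2 * (R + 1#)) * o) * (π * (ι 2 * (R + 1#) * (ι 2 * (R + 1#)) - p * p) * (E * E)))
    T-closed-step₂ K R E o P T₁ T₂ S α π h₁ h₂ h₃ h₄ =
      lin₂ (- (Q * P * T₁ * (D * E + 1#))) h₁ (- (Q * P * T₁ * (D * E * (D * E)))) h₂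
      (lin₂ P h₃ (- (ι 4 * (R + 1#) * o * (E * E) * Q)) h₄
      (solve 10 (λ K R E o P T₁ T₂ S α π →
         let M = κ 2 :* (K :+ R) :+ κ 1
             p = M :+ κ 2
             Q = κ 2 :* K :+ κ 4 :* R :+ κ 5
             D = κ 2 :* (R :+ κ 1)
             C₁ = :- (Q :* P :* T₁ :* (D :* E :+ κ 1))
             C₂ = :- (Q :* P :* T₁ :* (D :* E :* (D :* E)))
             C₄ = :- (κ 4 :* (R :+ κ 1) :* o :* (E :* E) :* Q) in
         κ 2 :* (P :* T₂ :* (D :+ κ 1)) :+ C₁ :* κ 1 :+ C₂ :* κ 1
           :+ P :* ((κ 2 :* (M :+ κ 1) :+ κ 1 :- κ 2 :* K) :* T₁) :+ C₄ :* (p :* S :* α :* π :* (κ 2 :* K :+ κ 1))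
      := κ 2 :* (p :* S :* (α :* D :* o) :* (π :* (D :* D :- p :* p) :* (E :* E)))
           :+ C₁ :* (D :* E) :+ C₂ :* ((κ 2 :* R :+ κ 1) :* o)
           :+ P :* (κ 2 :* (M :+ κ 1 :+ κ 1 :- κ 2 :* K) :* T₂) :+ C₄ :* (:- (P :* (R :+ κ 1) :* (κ 2 :* R :+ κ 1) :* T₁)))
        refl K R E o P T₁ T₂ S α π))
      where
      Q D : Carrier
      Q = ι 2 * K + ι 4 * R + ι 5
      D = ι 2 * (R + 1#)

  -- Induction on `r` at fixed `h`. With `p = 2h+1`, the recursion of `T` leads from `T (suc k) p`
  -- down to `T k (p-2)`, and two applications of `T-step` lead up again to `T k p`.
  T-closed : ∀ r k h → k ℕ.+ r ≡ h →
    ι 2 ^ suc (dbl h) * T k (suc (dbl h)) * odd r ≡ odd h * (sgn h * (a k * a k * a k)) * α r * π r (odd h)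
  T-closed zero k h k+0≡h with refl ← trans (sym (ℕₚ.+-identityʳ k)) k+0≡h = trans
    (cong (_* odd 0) (T-diagonal k))
    (solve 3 (λ p σ x → p :* σ :* x :* (κ 2 :* κ 0 :+ κ 1) := p :* (σ :* x) :* κ 1 :* κ 1) refl (odd k) (sgn k) (a³ k))
  T-closed (suc r) k (suc h) k+r≡h with refl ← ℕₚ.suc-injective (trans (sym (ℕₚ.+-suc k r)) k+r≡h) = begin
    P * T₂ * odd (suc r)
      ≡⟨ cong (P * T₂ *_) (cong (λ t → ι 2 * t + 1#) (ι-suc r)) ⟩
    P * T₂ * (ι 2 * (ι r + 1#) + 1#)
      ≡⟨ cancel (inv-inverse 1) (T-closed-step₂ (ι k) (ι r) (e (suc r)) (o r) P T₁ T₂ (σ * a³ k) (α r) (π r p)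
           (e-inverse r) (o-inverse r) step₂ step₁) ⟩
    p′ * (σ * a³ k) * α (suc r) * (π r p * (ι 2 * (ι r + 1#) * (ι 2 * (ι r + 1#)) - p′ * p′) * (e (suc r) * e (suc r)))
      ≡⟨ cong (λ t → t * (σ * a³ k) * α (suc r) * (π r p * (ι 2 * (ι r + 1#) * (ι 2 * (ι r + 1#)) - t * t) * (e (suc r) * e (suc r)))) (sym p≡) ⟩
    p * (σ * a³ k) * α (suc r) * π (suc r) p ∎
    where
    open ≡-Reasoning
    m : ℕ
    m = suc (dbl (k ℕ.+ r))
    P T₁ T₂ p σ M p′ : Carrier
    P = ι 2 ^ suc (suc m)
    T₁ = T k (suc m)
    T₂ = T k (suc (suc m))
    p = odd (suc (k ℕ.+ r))
    σ = sgn (suc (k ℕ.+ r))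
    M = ι 2 * (ι k + ι r) + 1#
    p′ = M + ι 2
    ιm≡M : ι m ≡ M
    ιm≡M = trans (ι-odd (k ℕ.+ r)) (cong (λ t → ι 2 * t + 1#) (ι-+ k r))
    p≡ : p ≡ p′
    p≡ = trans (odd-suc (k ℕ.+ r)) (cong (λ t → ι 2 * t + 1# + ι 2) (ι-+ k r))
    ih : P * T (suc k) (suc (suc m)) * odd r ≡ p′ * (σ * α r * π r p) * (a (suc k) * a (suc k) * a (suc k))
    ih = trans (T-closed r (suc k) (suc (k ℕ.+ r)) refl) (trans (cong (λ t → t * (σ * a³ (suc k)) * α r * π r p) p≡)
      (solve 5 (λ p σ x α π → p :* (σ :* x) :* α :* π := p :* (σ :* α :* π) :* x) refl p′ σ (a³ (suc k)) (α r) (π r p)))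
    D O : Carrier
    D = ι 2 * (ι k + 1#)
    O = odd k
    a³-suc : a (suc k) * a (suc k) * a (suc k) * (D * D * D) ≡ a k * a k * a k * (O * O * O)
    a³-suc = trans
      (solve 4 (λ A O E D → A :* O :* E :* (A :* O :* E) :* (A :* O :* E) :* (D :* D :* D)
        := A :* A :* A :* (O :* O :* O) :* (D :* E :* (D :* E) :* (D :* E))) refl (a k) O (e (suc k)) D)
      (trans (cong (λ t → a k * a k * a k * (O * O * O) * (t * t * t)) (e-inverse k))
        (solve 1 (λ x → x :* (κ 1 :* κ 1 :* κ 1) := x) refl (a k * a k * a k * (O * O * O))))
    U≡ : ι 4 * (D * D * D) * T (suc k) (suc (suc m)) ≡ - (O * O * (ι 2 * M + 1# - ι 2 * ι k) * T k m)
    U≡ = trans (T-suc-cleared k m) (cong (λ t → - (O * O * (ι 2 * t + 1# - ι 2 * ι k) * T k m)) ιm≡M)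
    step₀ : ι 2 * (M + 1# - ι 2 * ι k) * T₁ ≡ (ι 2 * M + 1# - ι 2 * ι k) * T k m
    step₀ = subst (λ t → ι 2 * (t + 1# - ι 2 * ι k) * T₁ ≡ (ι 2 * t + 1# - ι 2 * ι k) * T k m) ιm≡M (T-step k m)
    step₂ : ι 2 * (M + 1# + 1# - ι 2 * ι k) * T₂ ≡ (ι 2 * (M + 1#) + 1# - ι 2 * ι k) * T₁
    step₂ = subst (λ t → ι 2 * (t + 1# - ι 2 * ι k) * T₂ ≡ (ι 2 * t + 1# - ι 2 * ι k) * T₁)
      (trans (ι-suc m) (cong (_+ 1#) ιm≡M)) (T-step k (suc m))
    unit : ι 4 * O * O * (inv 4 * o k * o k) ≡ 1#
    unit = trans (solve 4 (λ f O q o → f :* O :* O :* (q :* o :* o) := f :* q :* (O :* o) :* (O :* o)) refl (ι 4) O (inv 4) (o k))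
      (trans (cong₂ (λ s t → s * t * t) (inv-inverse 3) (o-inverse k)) (solve 0 (κ 1 :* κ 1 :* κ 1 := κ 1) refl))
    step₁ : - (P * (ι r + 1#) * (ι 2 * ι r + 1#) * T₁) ≡ p′ * (σ * a³ k) * α r * π r p * (ι 2 * ι k + 1#)
    step₁ = trans (cancel unit (T-closed-step₁ (ι k) (ι r) O D P (T k m) T₁ (T (suc k) (suc (suc m))) (σ * α r * π r p)
        (a k) (a (suc k)) U≡ step₀ ih a³-suc))
      (solve 6 (λ p σ x α π O → p :* (σ :* α :* π) :* x :* O := p :* (σ :* x) :* α :* π :* O) refl p′ σ (a³ k) (α r) (π r p) O)
  T-closed (suc r) k zero k+r≡h with () ← trans (sym (ℕₚ.+-suc k r)) k+r≡h

  weighted-sum : ∀ h → ∑ (suc (dbl h)) (λ n → (ι n + 1#) * ι 2 ^ n * s n)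
    ≡ odd h * (sgn h * ∑ (suc h) (λ r → a (h ℕ.∸ r) * a (h ℕ.∸ r) * a (h ℕ.∸ r) * α r * π r (odd h)))
  weighted-sum h = begin
    ∑ p (λ n → (ι n + 1#) * ι 2 ^ n * s n)
      ≡⟨ ∑-cong p (λ n n<p → trans (cong ((ι n + 1#) * ι 2 ^ n *_) (s≡s-T h n (ℕₚ.<⇒≤ n<p))) (sym (∑-* (suc h) _ _))) ⟩
    ∑ p (λ n → ∑ (suc h) (λ k → (ι n + 1#) * ι 2 ^ n * T k n))
      ≡⟨ ∑-swap p (suc h) _ ⟩
    ∑ (suc h) (λ k → ∑ p (λ n → (ι n + 1#) * ι 2 ^ n * T k n))
      ≡⟨ ∑-cong′ (suc h) (∑T p) ⟩
    ∑ (suc h) f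
      -- Under `k = h - r` the factor `p - 2k` becomes `2r+1`, the one carried by the left-hand side
      -- of `T-closed`.
      ≡⟨ sym (∑-reverse h f) ⟩
    ∑ (suc h) (λ r → f (h ℕ.∸ r))
      ≡⟨ ∑-cong (suc h) (λ { r (s≤s r≤h) → term r (h ℕ.∸ r) (ℕₚ.m∸n+n≡m r≤h) }) ⟩
    ∑ (suc h) (λ r → odd h * sgn h * (a (h ℕ.∸ r) * a (h ℕ.∸ r) * a (h ℕ.∸ r) * α r * π r (odd h)))
      ≡⟨ ∑-* (suc h) (odd h * sgn h) _ ⟩
    odd h * sgn h * ∑ (suc h) (λ r → a (h ℕ.∸ r) * a (h ℕ.∸ r) * a (h ℕ.∸ r) * α r * π r (odd h))
      ≡⟨ *-assoc _ _ _ ⟩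
    odd h * (sgn h * ∑ (suc h) (λ r → a (h ℕ.∸ r) * a (h ℕ.∸ r) * a (h ℕ.∸ r) * α r * π r (odd h))) ∎
    where
    open ≡-Reasoning
    p : ℕ
    p = suc (dbl h)
    f : ℕ → Carrier
    f k = ι 2 ^ p * (ι p - ι 2 * ι k) * T k p
    term : ∀ r k → k ℕ.+ r ≡ h → f k ≡ odd h * sgn h * (a k * a k * a k * α r * π r (odd h))
    term r k refl = begin
      ι 2 ^ p * (ι p - ι 2 * ι k) * T k p
        ≡⟨ cong (λ t → ι 2 ^ p * (t - ι 2 * ι k) * T k p) (trans (ι-odd (k ℕ.+ r)) (cong (λ t → ι 2 * t + 1#) (ι-+ k r))) ⟩
      ι 2 ^ p * (ι 2 * (ι k + ι r) + 1# - ι 2 * ι k) * T k p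
        ≡⟨ solve 4 (λ P K R t → P :* (κ 2 :* (K :+ R) :+ κ 1 :- κ 2 :* K) :* t := P :* t :* (κ 2 :* R :+ κ 1)) refl
             (ι 2 ^ p) (ι k) (ι r) (T k p) ⟩
      ι 2 ^ p * T k p * odd r
        ≡⟨ T-closed r k h refl ⟩
      odd h * (sgn h * (a k * a k * a k)) * α r * π r (odd h)
        ≡⟨ solve 5 (λ p σ x α π → p :* (σ :* x) :* α :* π := p :* σ :* (x :* α :* π)) refl (odd h) (sgn h) (a³ k) (α r) (π r (odd h)) ⟩
      odd h * sgn h * (a k * a k * a k * α r * π r (odd h)) ∎

-- Integrality at `p` and congruences modulo powers of `p`

record LocalSubring (R : ℚ-Algebra) (p : ℕ) : Set₁ where
  open ℚ-Algebra R
  field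
    Integral     : Carrier → Set
    1-integral   : Integral 1#
    +-integral   : ∀ {x y} → Integral x → Integral y → Integral (x + y)
    *-integral   : ∀ {x y} → Integral x → Integral y → Integral (x * y)
    -‿integral   : ∀ {x} → Integral x → Integral (- x)
    inv-integral : ∀ n → ¬ (p ∣ n) → Integral (inv n)

module Congruences (R : ℚ-Algebra) (p : ℕ) (L : LocalSubring R p) where

  open ℚ-Algebra R
  open LocalSubring L public
  open Sums ring

  P : Carrier
  P = ι p

  0-integral : Integral 0#
  0-integral = subst Integral (-‿inverseʳ 1#) (+-integral 1-integral (-‿integral 1-integral))

  ι-integral : ∀ n → Integral (ι n)
  ι-integral zero          = 0-integral
  ι-integral (suc zero)    = 1-integral
  ι-integral (suc (suc n)) = +-integral (ι-integral (suc n)) 1-integral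

  ∑-integral : ∀ n {f} → (∀ k → k ℕ.< n → Integral (f k)) → Integral (∑ n f)
  ∑-integral zero    f-int = 0-integral
  ∑-integral (suc n) f-int =
    +-integral (∑-integral n (λ k k<n → f-int k (ℕₚ.m<n⇒m<1+n k<n))) (f-int n (ℕₚ.n<1+n n))

  ^-integral : ∀ {x} n → Integral x → Integral (x ^ n)
  ^-integral zero    x-int = 1-integral
  ^-integral (suc n) x-int = *-integral x-int (^-integral n x-int)

  sgn-integral : ∀ n → Integral (sgn n)
  sgn-integral zero    = 1-integral
  sgn-integral (suc n) = -‿integral (sgn-integral n)

  infix 4 _≈_mod^_
  -- The quotient is kept as a witness: it enters the ring identities as a variable, and nothing has
  -- to be divided by `P`.
  record _≈_mod^_ (x y : Carrier) (j : ℕ) : Set where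
    constructor quot
    field
      {quotient} : Carrier
      integral   : Integral quotient
      equation   : x ≡ y + P ^ j * quotient

  ≡⇒≈ : ∀ {x y j} → x ≡ y → x ≈ y mod^ j
  ≡⇒≈ {x} {j = j} refl = quot 0-integral (solve 2 (λ x q → x := x :+ q :* κ 0) refl x (P ^ j))

  ≈-refl : ∀ {x j} → x ≈ x mod^ j
  ≈-refl = ≡⇒≈ refl

  ≈-sym : ∀ {x y j} → x ≈ y mod^ j → y ≈ x mod^ j
  ≈-sym {y = y} {j} (quot {r} i refl) = quot (-‿integral i)
    (solve 3 (λ y q r → y := y :+ q :* r :+ q :* (:- r)) refl y (P ^ j) r)

  ≈-trans : ∀ {x y z j} → x ≈ y mod^ j → y ≈ z mod^ j → x ≈ z mod^ j
  ≈-trans {z = z} {j} (quot {r} i refl) (quot {t} i′ refl) = quot (+-integral i′ i)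
    (solve 4 (λ z q r t → z :+ q :* t :+ q :* r := z :+ q :* (t :+ r)) refl z (P ^ j) r t)

  ≈-+ : ∀ {x y x′ y′ j} → x ≈ x′ mod^ j → y ≈ y′ mod^ j → x + y ≈ x′ + y′ mod^ j
  ≈-+ {x′ = x′} {y′} {j} (quot {r} i refl) (quot {t} i′ refl) = quot (+-integral i i′)
    (solve 5 (λ x y q r t → x :+ q :* r :+ (y :+ q :* t) := x :+ y :+ q :* (r :+ t)) refl x′ y′ (P ^ j) r t)

  ≈-neg : ∀ {x x′ j} → x ≈ x′ mod^ j → - x ≈ - x′ mod^ j
  ≈-neg {x′ = x′} {j} (quot {r} i refl) = quot (-‿integral i)
    (solve 3 (λ x q r → :- (x :+ q :* r) := :- x :+ q :* (:- r)) refl x′ (P ^ j) r)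

  ≈-- : ∀ {x y x′ y′ j} → x ≈ x′ mod^ j → y ≈ y′ mod^ j → x - y ≈ x′ - y′ mod^ j
  ≈-- p q = ≈-+ p (≈-neg q)

  ≈-*ˡ : ∀ {c x x′ j} → Integral c → x ≈ x′ mod^ j → c * x ≈ c * x′ mod^ j
  ≈-*ˡ {c} {x′ = x′} {j} ic (quot {r} i refl) = quot (*-integral ic i)
    (solve 4 (λ c x q r → c :* (x :+ q :* r) := c :* x :+ q :* (c :* r)) refl c x′ (P ^ j) r)

  ≈-*ʳ : ∀ {c x x′ j} → Integral c → x ≈ x′ mod^ j → x * c ≈ x′ * c mod^ j
  ≈-*ʳ {c} {x} {x′} ic x≈x′ = ≈-trans (≡⇒≈ (*-comm x c)) (≈-trans (≈-*ˡ ic x≈x′) (≡⇒≈ (*-comm c x′)))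

  ≈-* : ∀ {x y x′ y′ j} → Integral x′ → Integral y → x ≈ x′ mod^ j → y ≈ y′ mod^ j → x * y ≈ x′ * y′ mod^ j
  ≈-* ix′ iy p q = ≈-trans (≈-*ʳ iy p) (≈-*ˡ ix′ q)

  ≈-∑ : ∀ n {f g j} → (∀ k → k ℕ.< n → f k ≈ g k mod^ j) → ∑ n f ≈ ∑ n g mod^ j
  ≈-∑ zero    f≈g = ≈-refl
  ≈-∑ (suc n) f≈g = ≈-+ (≈-∑ n (λ k k<n → f≈g k (ℕₚ.m<n⇒m<1+n k<n))) (f≈g n (ℕₚ.n<1+n n))

  P-integral : Integral P
  P-integral = ι-integral p

  weaken : ∀ {x y j} → x ≈ y mod^ suc j → x ≈ y mod^ j
  weaken {y = y} {j} (quot {r} i refl) = quot (*-integral P-integral i)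
    (solve 4 (λ y p q r → y :+ p :* q :* r := y :+ q :* (p :* r)) refl y P (P ^ j) r)

  ≈-P* : ∀ {x y j} → x ≈ y mod^ j → P * x ≈ P * y mod^ suc j
  ≈-P* {y = y} {j} (quot {r} i refl) = quot i
    (solve 4 (λ y p q r → p :* (y :+ q :* r) := p :* y :+ p :* q :* r) refl y P (P ^ j) r)

  ≈-P²* : ∀ {x y} → x ≈ y mod^ 1 → P * P * x ≈ P * P * y mod^ 3
  ≈-P²* x≈y = ≈-trans (≡⇒≈ (*-assoc _ _ _)) (≈-trans (≈-P* (≈-P* x≈y)) (≡⇒≈ (sym (*-assoc _ _ _))))

  ≈-cancel : ∀ {u v x y j} → u * v ≡ 1# → Integral v → u * x ≈ u * y mod^ j → x ≈ y mod^ j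
  ≈-cancel {u} {v} {x} {y} uv iv ux≈uy = ≈-trans (≡⇒≈ (v[ux] x)) (≈-trans (≈-*ˡ iv ux≈uy) (≡⇒≈ (sym (v[ux] y))))
    where
    v[ux] : ∀ x → x ≡ v * (u * x)
    v[ux] x = lin₁ (- x) uv (solve 3 (λ u v x → x :+ (:- x) :* κ 1 := v :* (u :* x) :+ (:- x) :* (u :* v)) refl u v x)

  mod-P : ∀ {x y} r → Integral r → x ≡ y + P * r → x ≈ y mod^ 1
  mod-P {x} {y} r i eq = quot i (trans eq (solve 3 (λ y p r → y :+ p :* r := y :+ p :* κ 1 :* r) refl y P r))

  mod-P³ : ∀ {x y} r → Integral r → x ≡ y + P * P * P * r → x ≈ y mod^ 3
  mod-P³ {x} {y} r i eq = quot i (trans eq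
    (solve 3 (λ y p r → y :+ p :* p :* p :* r := y :+ p :* (p :* (p :* κ 1)) :* r) refl y P r))

-- Exact evaluations: `∑ a k a (n-k)`, sums of `w`, and their harmonic weights

module HarmonicSums (R : ℚ-Algebra) where

  open ℚ-Algebra R
  open SumFormulas R public

  -- Gs k = ¼ ∑_{j≤k} 1/j².
  Gs Os Ās : ℕ → Carrier
  Gs k = ∑ k (λ j → e (suc j) * e (suc j))
  Os k = ∑ k (λ j → o j * o j)
  Ās k = ∑ k (λ j → sgn (suc j) * (e (suc j) * e (suc j)))

  sgn² : ∀ n → sgn n * sgn n ≡ 1#
  sgn² zero    = *-identityˡ 1#
  sgn² (suc n) = trans (solve 1 (λ s → (:- s) :* (:- s) := s :* s) refl (sgn n)) (sgn² n)

  sgn-dbl : ∀ n → sgn (dbl n) ≡ 1#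
  sgn-dbl zero    = refl
  sgn-dbl (suc n) = trans (solve 1 (λ s → :- (:- s) := s) refl (sgn (dbl n))) (sgn-dbl n)

  -- The generating function of `a` is `(1-x)^(-1/2)`, with square `1/(1-x)`. In coefficients,
  -- Leibniz and `2(k+1) a (k+1) = (2k+1) a k` show that consecutive values agree.
  vandermonde : ∀ n → conv a a n ≡ 1#
  vandermonde zero    = solve 0 (κ 0 :+ κ 1 :* κ 1 := κ 1) refl
  vandermonde (suc n) = trans (cancel (trans (cong (_* inv (suc n)) (sym (ι-suc n))) (inv-inverse n)) eq) (vandermonde n)
    where
    open ≡-Reasoning
    leibniz : ∀ n → ι n * conv a a n ≡ ι 2 * conv (θ a) a n
    leibniz n = trans (conv-leibniz a a n) (trans (cong (conv (θ a) a n +_) (conv-comm a (θ a) n))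
      (solve 1 (λ v → v :+ v := κ 2 :* v) refl (conv (θ a) a n)))
    term : ∀ k x → ι 2 * (θ a (suc k) * x) ≡ ι 2 * (θ a k * x) + a k * x
    term k x rewrite ι-suc k = lin₁ (x * odd k * a k) (e-inverse k)
      (solve 4 (λ K A E x → let O = κ 2 :* K :+ κ 1 in
         κ 2 :* ((K :+ κ 1) :* (A :* O :* E) :* x) :+ x :* O :* A :* κ 1
      := κ 2 :* (K :* A :* x) :+ A :* x :+ x :* O :* A :* (κ 2 :* (K :+ κ 1) :* E)) refl (ι k) (a k) (e (suc k)) x)
    eq : (ι n + 1#) * conv a a (suc n) ≡ (ι n + 1#) * conv a a n
    eq = begin
      (ι n + 1#) * conv a a (suc n)
        ≡⟨ cong (_* conv a a (suc n)) (sym (ι-suc n)) ⟩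
      ι (suc n) * conv a a (suc n)
        ≡⟨ leibniz (suc n) ⟩
      ι 2 * conv (θ a) a (suc n)
        ≡⟨ cong (ι 2 *_) (∑-head (suc n) _) ⟩
      ι 2 * (0# * a 0 * a (suc n) + ∑ (suc n) (λ k → θ a (suc k) * a (n ℕ.∸ k)))
        ≡⟨ solve 3 (λ x y z → κ 2 :* (κ 0 :* x :* y :+ z) := κ 2 :* z) refl (a 0) (a (suc n)) _ ⟩
      ι 2 * ∑ (suc n) (λ k → θ a (suc k) * a (n ℕ.∸ k))
        ≡⟨ sym (∑-* (suc n) (ι 2) _) ⟩
      ∑ (suc n) (λ k → ι 2 * (θ a (suc k) * a (n ℕ.∸ k)))
        ≡⟨ ∑-cong′ (suc n) (λ k → term k (a (n ℕ.∸ k))) ⟩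
      ∑ (suc n) (λ k → ι 2 * (θ a k * a (n ℕ.∸ k)) + a k * a (n ℕ.∸ k))
        ≡⟨ trans (∑-+ (suc n) _ _) (cong (_+ conv a a n) (∑-* (suc n) (ι 2) _)) ⟩
      ι 2 * conv (θ a) a n + conv a a n
        ≡⟨ cong (_+ conv a a n) (sym (leibniz n)) ⟩
      ι n * conv a a n + conv a a n
        ≡⟨ solve 2 (λ N c → N :* c :+ c := (N :+ κ 1) :* c) refl (ι n) (conv a a n) ⟩
      (ι n + 1#) * conv a a n ∎

  π-vanish : ∀ n → π (suc n) (ι 2 * (ι n + 1#)) ≡ 0#
  π-vanish n = solve 3 (λ P N E → P :* (κ 2 :* (N :+ κ 1) :* (κ 2 :* (N :+ κ 1)) :- κ 2 :* (N :+ κ 1) :* (κ 2 :* (N :+ κ 1))) :* E := κ 0)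
    refl (π n (ι 2 * (ι n + 1#))) (ι n) (e (suc n) * e (suc n))

  private
    neighbours⁺ : ∀ n → ι 2 * (ι n + 1#) + 1# ≡ odd (suc n)
    neighbours⁺ n = cong (λ t → ι 2 * t + 1#) (sym (ι-suc n))
    neighbours⁻ : ∀ n → ι 2 * (ι n + 1#) - 1# ≡ odd n
    neighbours⁻ n = solve 1 (λ N → κ 2 :* (N :+ κ 1) :- κ 1 := κ 2 :* N :+ κ 1) refl (ι n)

    negate : ∀ {x y} → x + y ≡ 0# → x ≡ - y
    negate {x} {y} eq = lin₁ 1# eq (solve 2 (λ x y → x :+ κ 1 :* κ 0 := :- y :+ κ 1 :* (x :+ y)) refl x y)

  -- The value of the Legendre polynomial of degree `n` at -1. In `∑w` at `z = 2n+2` the product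
  -- `π (suc n) z` vanishes, so neighbouring sums are opposite.
  ∑w-sgn : ∀ n → ∑ (suc n) (λ k → w k (odd n)) ≡ sgn n
  ∑w-sgn zero    = +-identityˡ 1#
  ∑w-sgn (suc n) = trans (negate eq) (cong (λ t → - t) (∑w-sgn n))
    where
    open ≡-Reasoning
    z : Carrier
    z = ι 2 * (ι n + 1#)
    eq : ∑ (suc (suc n)) (λ k → w k (odd (suc n))) + ∑ (suc n) (λ k → w k (odd n)) ≡ 0#
    eq = begin
      ∑ (suc (suc n)) (λ k → w k (odd (suc n))) + ∑ (suc n) (λ k → w k (odd n))
        ≡⟨ cong (∑ (suc (suc n)) (λ k → w k (odd (suc n))) +_) (trans (sym (+-identityʳ _))
             (cong (∑ (suc n) (λ k → w k (odd n)) +_) (sym (w-vanish′ {suc n} {n} (ℕₚ.n<1+n n))))) ⟩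
      ∑ (suc (suc n)) (λ k → w k (odd (suc n))) + ∑ (suc (suc n)) (λ k → w k (odd n))
        ≡⟨ sym (∑-+ (suc (suc n)) _ _) ⟩
      ∑ (suc (suc n)) (λ k → w k (odd (suc n)) + w k (odd n))
        ≡⟨ ∑-cong′ (suc (suc n)) (λ k → sym (cong₂ (λ s t → w k s + w k t) (neighbours⁺ n) (neighbours⁻ n))) ⟩
      ∑ (suc (suc n)) (λ k → w k (z + 1#) + w k (z - 1#))
        ≡⟨ ∑w (suc n) z ⟩
      ι 2 * π (suc n) z
        ≡⟨ cong (ι 2 *_) (π-vanish n) ⟩
      ι 2 * 0#
        ≡⟨ zeroʳ _ ⟩
      0# ∎

  -- Abel summation of ∑w against Gs.
  ∑wG-neighbours : ∀ N z → z * z * ∑ (suc N) (λ k → (w k (z + 1#) + w k (z - 1#)) * Gs k)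
    ≡ ι 2 * (z * z) * π N z * Gs N + ι 2 * π N z - ι 2
  ∑wG-neighbours zero    z = solve 1 (λ z → z :* z :* (κ 0 :+ (κ 1 :+ κ 1) :* κ 0) := κ 2 :* (z :* z) :* κ 1 :* κ 0 :+ κ 2 :* κ 1 :- κ 2) refl z
  ∑wG-neighbours (suc N) z = identity z (π N z) (Gs N) (ι 2 * (ι N + 1#)) (e (suc N)) f
      (∑ (suc N) (λ k → (w k (z + 1#) + w k (z - 1#)) * Gs k)) (∑ (suc N) (λ k → w k (z + 1#) + w k (z - 1#)))
      (e-inverse N) (∑wG-neighbours N z) (∑w N z) (∑w (suc N) z)
    where
    f : Carrier
    f = w (suc N) (z + 1#) + w (suc N) (z - 1#)
    identity : ∀ z p G D E f S₁ S₀ → D * E ≡ 1# →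
      z * z * S₁ ≡ ι 2 * (z * z) * p * G + ι 2 * p - ι 2 → S₀ ≡ ι 2 * p → let p′ = p * (D * D - z * z) * (E * E) in
      S₀ + f ≡ ι 2 * p′ →
      z * z * (S₁ + f * (G + E * E)) ≡ ι 2 * (z * z) * p′ * (G + E * E) + ι 2 * p′ - ι 2
    identity z p G D E f S₁ _ DE h₁ refl h₂ = lin₃ (ι 2 * p * (D * E + 1#) * (- 1#)) DE 1# h₁ (z * z * (G + E * E)) h₂
      (solve 7 (λ z p G D E f S₁ →
         let p′ = p :* (D :* D :- z :* z) :* (E :* E)
             C  = κ 2 :* p :* (D :* E :+ κ 1) :* (:- κ 1) in
           z :* z :* (S₁ :+ f :* (G :+ E :* E)) :+ C :* κ 1
             :+ κ 1 :* (κ 2 :* (z :* z) :* p :* G :+ κ 2 :* p :- κ 2) :+ z :* z :* (G :+ E :* E) :* (κ 2 :* p′)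
        := κ 2 :* (z :* z) :* p′ :* (G :+ E :* E) :+ κ 2 :* p′ :- κ 2 :+ C :* (D :* E)
             :+ κ 1 :* (z :* z :* S₁) :+ z :* z :* (G :+ E :* E) :* (κ 2 :* p :+ f)) refl z p G D E f S₁)

  -- At `z = 2n+2` every term with `π` drops out of `∑wG-neighbours`, so that neighbouring sums add
  -- up to `-2/z²`; unrolling gives the alternating sum of the `1/(2j)²`.
  ∑wG : ∀ n → ∑ (suc n) (λ k → w k (odd n) * Gs k) ≡ - (ι 2 * (sgn n * Ās n))
  ∑wG zero    = solve 0 (κ 0 :+ κ 1 :* κ 0 := :- (κ 2 :* (κ 1 :* κ 0))) refl
  ∑wG (suc n) = identity (e (suc n)) (ι 2 * (ι n + 1#)) _ _ (sgn n) (Ās n) (e-inverse n) (sgn² n) eq (∑wG n)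
    where
    open ≡-Reasoning
    z : Carrier
    z = ι 2 * (ι n + 1#)
    identity : ∀ E D X Y σ A → D * E ≡ 1# → σ * σ ≡ 1# → D * D * (X + Y) ≡ - ι 2 → Y ≡ - (ι 2 * (σ * A)) →
      X ≡ - (ι 2 * (- σ * (A + - σ * (E * E))))
    identity E D X _ σ A DE σσ h refl = lin₃ (- ((X - ι 2 * (σ * A)) * (D * E + 1#))) DE (ι 2 * (E * E)) σσ (E * E) h
      (solve 5 (λ E D X σ A → let Y = :- (κ 2 :* (σ :* A)); C = :- ((X :- κ 2 :* (σ :* A)) :* (D :* E :+ κ 1)) in
           X :+ C :* κ 1 :+ κ 2 :* (E :* E) :* κ 1 :+ E :* E :* (:- κ 2)
        := :- (κ 2 :* ((:- σ) :* (A :+ (:- σ) :* (E :* E)))) :+ C :* (D :* E) :+ κ 2 :* (E :* E) :* (σ :* σ)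
             :+ E :* E :* (D :* D :* (X :+ Y))) refl E D X σ A)
    eq : z * z * (∑ (suc (suc n)) (λ k → w k (odd (suc n)) * Gs k) + ∑ (suc n) (λ k → w k (odd n) * Gs k)) ≡ - ι 2
    eq = begin
      z * z * (∑ (suc (suc n)) (λ k → w k (odd (suc n)) * Gs k) + ∑ (suc n) (λ k → w k (odd n) * Gs k))
        ≡⟨ cong (λ t → z * z * (∑ (suc (suc n)) (λ k → w k (odd (suc n)) * Gs k) + t)) (trans (sym (+-identityʳ _))
             (cong (∑ (suc n) (λ k → w k (odd n) * Gs k) +_) (sym (trans (cong (_* Gs (suc n)) (w-vanish′ {suc n} {n} (ℕₚ.n<1+n n))) (zeroˡ _))))) ⟩
      z * z * (∑ (suc (suc n)) (λ k → w k (odd (suc n)) * Gs k) + ∑ (suc (suc n)) (λ k → w k (odd n) * Gs k))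
        ≡⟨ cong (z * z *_) (sym (∑-+ (suc (suc n)) _ _)) ⟩
      z * z * ∑ (suc (suc n)) (λ k → w k (odd (suc n)) * Gs k + w k (odd n) * Gs k)
        ≡⟨ cong (z * z *_) (∑-cong′ (suc (suc n)) (λ k → trans (sym (distribʳ (Gs k) _ _))
             (sym (cong₂ (λ s t → (w k s + w k t) * Gs k) (neighbours⁺ n) (neighbours⁻ n))))) ⟩
      z * z * ∑ (suc (suc n)) (λ k → (w k (z + 1#) + w k (z - 1#)) * Gs k)
        ≡⟨ ∑wG-neighbours (suc n) z ⟩
      ι 2 * (z * z) * π (suc n) z * Gs (suc n) + ι 2 * π (suc n) z - ι 2
        ≡⟨ cong (λ t → ι 2 * (z * z) * t * Gs (suc n) + ι 2 * t - ι 2) (π-vanish n) ⟩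
      ι 2 * (z * z) * 0# * Gs (suc n) + ι 2 * 0# - ι 2
        ≡⟨ solve 2 (λ x y → x :* κ 0 :* y :+ κ 2 :* κ 0 :- κ 2 := :- κ 2) refl (ι 2 * (z * z)) (Gs (suc n)) ⟩
      - ι 2 ∎

  -- Both products are tied to their common neighbour `w N (z - 1#)`.
  π-step : ∀ N z → (z - ι 2 - ι 2 * ι N) * z * π N z ≡ (z + ι 2 * ι N) * (z - ι 2) * π N (z - ι 2)
  π-step N z = identity z (ι N) (π N z) (π N (z - ι 2)) (w N (z - 1#)) (π-w⁻ N z)
    (trans (π-w N (z - ι 2)) (cong (λ t → (z - ι 2 - ι 2 * ι N) * w N t) (solve 1 (λ z → z :- κ 2 :+ κ 1 := z :- κ 1) refl z)))
    where
    identity : ∀ z N p q w → z * p ≡ (z + ι 2 * N) * w → (z - ι 2) * q ≡ (z - ι 2 - ι 2 * N) * w →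
      (z - ι 2 - ι 2 * N) * z * p ≡ (z + ι 2 * N) * (z - ι 2) * q
    identity z N p q w h₁ h₂ = lin₂ (z - ι 2 - ι 2 * N) h₁ (- (z + ι 2 * N)) h₂
      (solve 5 (λ z N p q w → let X = z :- κ 2 :- κ 2 :* N; Y = z :+ κ 2 :* N in
         X :* z :* p :+ X :* (Y :* w) :+ (:- Y) :* (X :* w) := Y :* (z :- κ 2) :* q :+ X :* (z :* p) :+ (:- Y) :* ((z :- κ 2) :* q))
        refl z N p q w)

-- Evaluation modulo p³ for a prime `p = 2h+1`

dbl≡2* : ∀ n → dbl n ≡ 2 ℕ.* n
dbl≡2* zero    = refl
dbl≡2* (suc n) = cong suc (trans (cong suc (dbl≡2* n)) (sym (ℕₚ.+-suc n (n ℕ.+ 0))))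

module OddPrime (R : ℚ-Algebra) (h : ℕ) (L : LocalSubring R (suc (dbl h)))
  (p-prime : Prime (suc (dbl h))) (3<p : 3 ℕ.< suc (dbl h)) where

  p : ℕ
  p = suc (dbl h)

  open ℚ-Algebra R
  open HarmonicSums R public
  open Congruences R p L public

  P≡ : P ≡ odd h
  P≡ = ι-odd h

  h≤2h : h ℕ.≤ dbl h
  h≤2h = subst (h ℕ.≤_) (sym (dbl≡2* h)) (ℕₚ.m≤m+n h (h ℕ.+ 0))

  private
    p∤ : ∀ {n} → suc n ℕ.< p → p ∤ suc n
    p∤ n<p p∣n = ℕₚ.<⇒≱ n<p (∣⇒≤ p∣n)

    odd<p : ∀ {k} → k ℕ.< h → suc (2 ℕ.* k) ℕ.< p
    odd<p {k} k<h = s≤s (subst (suc (2 ℕ.* k) ℕ.≤_) (sym (dbl≡2* h)) (ℕₚ.*-monoʳ-< 2 k<h))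

  e-integral : ∀ {k} → k ℕ.< dbl h → Integral (e (suc k))
  e-integral {k} k<2h = inv-integral (2 ℕ.* suc k) λ p∣2k → case (euclidsLemma 2 (suc k) p-prime p∣2k)
    where
    case : _ → _
    case (inj₁ p∣2) = p∤ (ℕₚ.<-trans (ℕₚ.n<1+n 2) 3<p) p∣2
    case (inj₂ p∣k) = p∤ (s≤s k<2h) p∣k

  e-integral′ : ∀ {k} → k ℕ.< h → Integral (e (suc k))
  e-integral′ k<h = e-integral (ℕₚ.≤-trans k<h h≤2h)

  o-integral : ∀ {k} → k ℕ.< h → Integral (o k)
  o-integral {k} k<h = inv-integral (suc (2 ℕ.* k)) (p∤ (odd<p k<h))

  o-shift-integral : ∀ {k} → k ℕ.< h → Integral (o (p ℕ.+ k))
  o-shift-integral {k} k<h = inv-integral _ λ p∣ → p∤ (odd<p k<h)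
    (∣m+n∣m⇒∣n (subst (p ∣_) (trans (cong suc (ℕₚ.*-distribˡ-+ 2 p k)) (sym (ℕₚ.+-suc (2 ℕ.* p) (2 ℕ.* k)))) p∣) (n∣m*n 2))

  inv2-integral : Integral (inv 2)
  inv2-integral = inv-integral 2 (p∤ (ℕₚ.<-trans (ℕₚ.n<1+n 2) 3<p))

  -- This is what excludes `p = 3`: it permits the division by six that makes `Gs h` vanish modulo
  -- `P`.
  inv3-integral : Integral (inv 3)
  inv3-integral = inv-integral 3 (p∤ 3<p)

  odd-integral : ∀ k → Integral (odd k)
  odd-integral k = +-integral (*-integral (ι-integral 2) (ι-integral k)) 1-integral

  a-integral : ∀ k → k ℕ.≤ dbl h → Integral (a k)
  a-integral zero    _     = 1-integral
  a-integral (suc k) k<2h = *-integral (*-integral (a-integral k (ℕₚ.<⇒≤ k<2h)) (odd-integral k)) (e-integral k<2h)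

  b-integral : ∀ k → k ℕ.≤ dbl h → Integral (b k)
  b-integral k k≤ = *-integral (a-integral k k≤) (a-integral k k≤)

  w-integral : ∀ {y} → Integral y → ∀ k → k ℕ.≤ dbl h → Integral (w k y)
  w-integral iy zero    _    = 1-integral
  w-integral iy (suc k) k<2h = *-integral (*-integral (w-integral iy k (ℕₚ.<⇒≤ k<2h))
    (+-integral (*-integral (odd-integral k) (odd-integral k)) (-‿integral (*-integral iy iy))))
    (*-integral (e-integral k<2h) (e-integral k<2h))

  α-integral : ∀ r → r ℕ.≤ h → Integral (α r)
  α-integral zero    _   = 1-integral
  α-integral (suc r) r<h = *-integral (*-integral (α-integral r (ℕₚ.<⇒≤ r<h))
    (*-integral (ι-integral 2) (+-integral (ι-integral r) 1-integral))) (o-integral r<h)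

  Gs-integral : ∀ k → k ℕ.≤ dbl h → Integral (Gs k)
  Gs-integral k k≤ = ∑-integral k (λ j j<k → let i = e-integral (ℕₚ.≤-trans j<k k≤) in *-integral i i)

  Os-integral : ∀ k → k ℕ.≤ h → Integral (Os k)
  Os-integral k k≤h = ∑-integral k (λ j j<k → let i = o-integral (ℕₚ.≤-trans j<k k≤h) in *-integral i i)

  -- Beyond the term in `z²` the product contributes multiples of `z⁴`, hence of P⁴. The factor `c`
  -- serves the arguments `P`, `- P` and `2P`.
  π-≈ : ∀ {z c} → Integral c → z ≡ c * P → ∀ k → k ℕ.≤ dbl h → π k z ≈ 1# - z * z * Gs k mod^ 3
  π-≈ {z} ic z≡ zero    _    = ≡⇒≈ (solve 1 (λ z → κ 1 := κ 1 :- z :* z :* κ 0) refl z)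
  π-≈ {z} {c} ic refl (suc k) k<2h with π-≈ ic refl k (ℕₚ.<⇒≤ k<2h)
  ... | quot {r} ir eq = mod-P³
    (r * (1# - z * z * (E * E)) + c * c * c * c * P * Gs k * (E * E))
    (+-integral (*-integral ir (+-integral 1-integral (-‿integral (*-integral (*-integral iz iz) iE²))))
      (*-integral (*-integral (*-integral (*-integral (*-integral (*-integral ic ic) ic) ic) P-integral)
        (Gs-integral k (ℕₚ.<⇒≤ k<2h))) iE²))
    (identity c P (π k z) (Gs k) (ι 2 * (ι k + 1#)) E r (e-inverse k) eq)
    where
    E : Carrier
    E = e (suc k)
    iE² : Integral (E * E)
    iE² = *-integral (e-integral k<2h) (e-integral k<2h)
    iz : Integral z
    iz = *-integral ic P-integral
    identity : ∀ c P p G D E r → let z = c * P in D * E ≡ 1# → p ≡ 1# - z * z * G + P ^ 3 * r →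
      p * (D * D - z * z) * (E * E) ≡ 1# - z * z * (G + E * E)
        + P * P * P * (r * (1# - z * z * (E * E)) + c * c * c * c * P * G * (E * E))
    identity c P p G D E r DE refl = lin₁ (X * (D * E + 1#)) DE
      (solve 6 (λ c P G D E r →
         let z = c :* P
             X = κ 1 :- z :* z :* G :+ P :* (P :* (P :* κ 1)) :* r
             C = X :* (D :* E :+ κ 1) in
           X :* (D :* D :- z :* z) :* (E :* E) :+ C :* κ 1
        := κ 1 :- z :* z :* (G :+ E :* E) :+ P :* P :* P :* (r :* (κ 1 :- z :* z :* (E :* E))
             :+ c :* c :* c :* c :* P :* G :* (E :* E)) :+ C :* (D :* E)) refl c P G D E r)
      where
      X : Carrier
      X = 1# - c * P * (c * P) * G + P ^ 3 * r

  -- Each factor is that of `b k` times `1 - P²/(2j+1)²`. The range ends at `h` because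
  -- `1/odd h = 1/P` is the first inverse that is not integral.
  w-≈ : ∀ k → k ℕ.≤ h → w k P ≈ b k * (1# - P * P * Os k) mod^ 3
  w-≈ zero    _   = ≡⇒≈ (solve 1 (λ P → κ 1 := κ 1 :* κ 1 :* (κ 1 :- P :* P :* κ 0)) refl P)
  w-≈ (suc k) k<h with w-≈ k (ℕₚ.<⇒≤ k<h)
  ... | quot {r} ir eq = mod-P³
    (r * (odd k * odd k - P * P) * (E * E) + P * b k * (E * E) * Os k)
    (+-integral (*-integral (*-integral ir (+-integral (*-integral (odd-integral k) (odd-integral k))
      (-‿integral (*-integral P-integral P-integral)))) iE²)
      (*-integral (*-integral (*-integral P-integral (b-integral k (ℕₚ.≤-trans (ℕₚ.<⇒≤ k<h) h≤2h))) iE²)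
        (Os-integral k (ℕₚ.<⇒≤ k<h))))
    (identity P (w k P) (a k) (odd k) E (Os k) (o k) r (o-inverse k) eq)
    where
    E : Carrier
    E = e (suc k)
    iE² : Integral (E * E)
    iE² = *-integral (e-integral′ k<h) (e-integral′ k<h)
    identity : ∀ P w a O E S o r → O * o ≡ 1# → w ≡ a * a * (1# - P * P * S) + P ^ 3 * r →
      w * (O * O - P * P) * (E * E) ≡ a * O * E * (a * O * E) * (1# - P * P * (S + o * o))
        + P * P * P * (r * (O * O - P * P) * (E * E) + P * (a * a) * (E * E) * S)
    identity P w a O E S o r Oo refl = lin₁ (P * P * a * a * (E * E) * (O * o + 1#)) Oo
      (solve 7 (λ P a O E S o r →
         let C = P :* P :* a :* a :* (E :* E) :* (O :* o :+ κ 1) in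
           (a :* a :* (κ 1 :- P :* P :* S) :+ P :* (P :* (P :* κ 1)) :* r) :* (O :* O :- P :* P) :* (E :* E) :+ C :* κ 1
        := a :* O :* E :* (a :* O :* E) :* (κ 1 :- P :* P :* (S :+ o :* o))
             :+ P :* P :* P :* (r :* (O :* O :- P :* P) :* (E :* E) :+ P :* (a :* a) :* (E :* E) :* S)
             :+ C :* (O :* o)) refl P a O E S o r)

  w-≈b : ∀ k → k ℕ.≤ h → w k P ≈ b k mod^ 1
  w-≈b k k≤h = ≈-trans (weaken (weaken (w-≈ k k≤h)))
    (mod-P (- (P * b k * Os k)) (-‿integral (*-integral (*-integral P-integral (b-integral k (ℕₚ.≤-trans k≤h h≤2h))) (Os-integral k k≤h)))
      (solve 3 (λ P b S → b :* (κ 1 :- P :* P :* S) := b :+ P :* (:- (P :* b :* S))) refl P (b k) (Os k)))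

  P-split : ∀ k r → suc (k ℕ.+ r) ≡ h → P ≡ odd k + ι 2 * (ι r + 1#)
  P-split k r refl = trans P≡ (trans (odd-suc (k ℕ.+ r)) (trans (cong (λ t → ι 2 * t + 1# + ι 2) (ι-+ k r))
    (solve 2 (λ K R → κ 2 :* (K :+ R) :+ κ 1 :+ κ 2 := κ 2 :* K :+ κ 1 :+ κ 2 :* (R :+ κ 1)) refl (ι k) (ι r))))

  o-reflect : ∀ k r → suc (k ℕ.+ r) ≡ h → o k ≈ - e (suc r) mod^ 1
  o-reflect k r k+r≡h = mod-P (o k * e (suc r)) (*-integral (o-integral k<h) (e-integral′ r<h))
    (identity (odd k) (ι 2 * (ι r + 1#)) (o k) (e (suc r)) P (o-inverse k) (e-inverse r) (P-split k r k+r≡h))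
    where
    k<h : k ℕ.< h
    k<h = subst (k ℕ.<_) k+r≡h (s≤s (ℕₚ.m≤m+n k r))
    r<h : r ℕ.< h
    r<h = subst (r ℕ.<_) k+r≡h (s≤s (ℕₚ.m≤n+m r k))
    identity : ∀ O D o E P → O * o ≡ 1# → D * E ≡ 1# → P ≡ O + D → o ≡ - E + P * (o * E)
    identity O D o E _ Oo DE refl = lin₂ (- E) Oo (- o) DE
      (solve 4 (λ O D o E → o :+ (:- E) :* κ 1 :+ (:- o) :* κ 1
        := :- E :+ (O :+ D) :* (o :* E) :+ (:- E) :* (O :* o) :+ (:- o) :* (D :* E)) refl O D o E)

  ≈-square : ∀ {x y} → Integral x → Integral y → x ≈ - y mod^ 1 → x * x ≈ y * y mod^ 1
  ≈-square {x} {y} ix iy x≈ = ≈-trans (≈-* (-‿integral iy) ix x≈ x≈)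
    (≡⇒≈ (solve 1 (λ y → (:- y) :* (:- y) := y :* y) refl y))

  -- Under `x ↦ p - x` the odd numbers up to `2k-1` become the even numbers from `2r+2` to `2h`, and
  -- squares do not see the sign.
  Os-Gs : ∀ k r → k ℕ.+ r ≡ h → Os k + Gs r ≈ Gs h mod^ 1
  Os-Gs zero    r refl   = ≡⇒≈ (+-identityˡ _)
  Os-Gs (suc k) r k+r≡h = ≈-trans
    (≈-+ (≈-+ ≈-refl (≈-square (o-integral k<h) (e-integral′ r<h) (o-reflect k r k+r≡h))) ≈-refl)
    (≈-trans (≡⇒≈ (solve 3 (λ x y z → x :+ y :+ z := x :+ (z :+ y)) refl (Os k) (e (suc r) * e (suc r)) (Gs r)))
      (Os-Gs k (suc r) (trans (ℕₚ.+-suc k r) k+r≡h)))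
    where
    k<h : k ℕ.< h
    k<h = subst (k ℕ.<_) k+r≡h (s≤s (ℕₚ.m≤m+n k r))
    r<h : r ℕ.< h
    r<h = subst (r ℕ.<_) k+r≡h (s≤s (ℕₚ.m≤n+m r k))

  -- Stated exactly, since `e-sum≈0` keeps the factor `P` and gains a second one from the products.
  e-reflect-eq : ∀ i j → suc (i ℕ.+ j) ≡ dbl h → e (suc i) + e (suc j) ≡ ι 2 * P * (e (suc i) * e (suc j))
  e-reflect-eq i j i+j≡2h = identity (ι i) (ι j) (e (suc i)) (e (suc j)) P (e-inverse i) (e-inverse j)
    (trans (ι-suc (dbl h)) (cong (_+ 1#) (trans (cong ι (sym i+j≡2h)) (trans (ι-suc (i ℕ.+ j)) (cong (_+ 1#) (ι-+ i j))))))
    where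
    identity : ∀ I J E E′ P → ι 2 * (I + 1#) * E ≡ 1# → ι 2 * (J + 1#) * E′ ≡ 1# → P ≡ I + J + 1# + 1# →
      E + E′ ≡ ι 2 * P * (E * E′)
    identity I J E E′ _ h₁ h₂ refl = lin₂ (- E′) h₁ (- E) h₂
      (solve 4 (λ I J E E′ → E :+ E′ :+ (:- E′) :* κ 1 :+ (:- E) :* κ 1
        := κ 2 :* (I :+ J :+ κ 1 :+ κ 1) :* (E :* E′) :+ (:- E′) :* (κ 2 :* (I :+ κ 1) :* E)
             :+ (:- E) :* (κ 2 :* (J :+ κ 1) :* E′)) refl I J E E′)

  e-reflect : ∀ i j → suc (i ℕ.+ j) ≡ dbl h → e (suc i) ≈ - e (suc j) mod^ 1
  e-reflect i j i+j≡2h = mod-P (ι 2 * (e (suc i) * e (suc j)))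
    (*-integral (ι-integral 2) (*-integral (e-integral (subst (i ℕ.<_) i+j≡2h (s≤s (ℕₚ.m≤m+n i j))))
      (e-integral (subst (j ℕ.<_) i+j≡2h (s≤s (ℕₚ.m≤n+m j i))))))
    (lin₁ 1# (e-reflect-eq i j i+j≡2h) (solve 3 (λ x y p → x :+ κ 1 :* (κ 2 :* p :* (x :* y))
      := :- y :+ p :* (κ 2 :* (x :* y)) :+ κ 1 :* (x :+ y)) refl (e (suc i)) (e (suc j)) P))

  Gs-reflect : ∀ i j → i ℕ.+ j ≡ dbl h → Gs i + Gs j ≈ Gs (dbl h) mod^ 1
  Gs-reflect zero    j refl   = ≡⇒≈ (+-identityˡ _)
  Gs-reflect (suc i) j i+j≡2h = ≈-trans
    (≈-+ (≈-+ ≈-refl (≈-square (e-integral i<) (e-integral j<) (e-reflect i j i+j≡2h))) ≈-refl)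
    (≈-trans (≡⇒≈ (solve 3 (λ x y z → x :+ y :+ z := x :+ (z :+ y)) refl (Gs i) (e (suc j) * e (suc j)) (Gs j)))
      (Gs-reflect i (suc j) (trans (ℕₚ.+-suc i j) i+j≡2h)))
    where
    i< : i ℕ.< dbl h
    i< = subst (i ℕ.<_) i+j≡2h (s≤s (ℕₚ.m≤m+n i j))
    j< : j ℕ.< dbl h
    j< = subst (j ℕ.<_) i+j≡2h (s≤s (ℕₚ.m≤n+m j i))

  -- Splits `∑_{j ≤ 2n} 1/j²` into odd and even `j`.
  Gs-parity : ∀ n → ι 4 * Gs (dbl n) ≡ Os n + Gs n
  Gs-parity zero    = solve 0 (κ 4 :* κ 0 := κ 0 :+ κ 0) refl
  Gs-parity (suc n) = identity (Gs (dbl n)) (Os n) (Gs n) (ι n) (e (suc (dbl n))) (e (suc (suc (dbl n)))) (o n) (e (suc n))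
    (Gs-parity n)
    (trans (cong (λ t → ι 2 * (t + 1#) * e (suc (dbl n))) (sym (ι-dbl n))) (e-inverse (dbl n)))
    (trans (cong (λ t → ι 2 * (t + 1#) * e (suc (suc (dbl n)))) (sym (ι-odd n))) (e-inverse (suc (dbl n))))
    (o-inverse n) (e-inverse n)
    where
    identity : ∀ F S G N x y o e → ι 4 * F ≡ S + G → ι 2 * (ι 2 * N + 1#) * x ≡ 1# → ι 2 * (ι 2 * N + 1# + 1#) * y ≡ 1# →
      (ι 2 * N + 1#) * o ≡ 1# → ι 2 * (N + 1#) * e ≡ 1# →
      ι 4 * (F + x * x + y * y) ≡ S + o * o + (G + e * e)
    identity F S G N x y o e h hx hy ho he = lin₃ 1# h (o + ι 2 * x) 2x≡o (e + ι 2 * y) 2y≡e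
      (solve 7 (λ F S G x y o e → κ 4 :* (F :+ x :* x :+ y :* y) :+ κ 1 :* (S :+ G) :+ (o :+ κ 2 :* x) :* o :+ (e :+ κ 2 :* y) :* e
        := S :+ o :* o :+ (G :+ e :* e) :+ κ 1 :* (κ 4 :* F) :+ (o :+ κ 2 :* x) :* (κ 2 :* x) :+ (e :+ κ 2 :* y) :* (κ 2 :* y))
        refl F S G x y o e)
      where
      2x≡o : ι 2 * x ≡ o
      2x≡o = lin₂ o hx (- (ι 2 * x)) ho (solve 3 (λ N x o → κ 2 :* x :+ o :* κ 1 :+ (:- (κ 2 :* x)) :* κ 1
        := o :+ o :* (κ 2 :* (κ 2 :* N :+ κ 1) :* x) :+ (:- (κ 2 :* x)) :* ((κ 2 :* N :+ κ 1) :* o)) refl N x o)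
      2y≡e : ι 2 * y ≡ e
      2y≡e = lin₂ e hy (- (ι 2 * y)) he (solve 3 (λ N y e → κ 2 :* y :+ e :* κ 1 :+ (:- (κ 2 :* y)) :* κ 1
        := e :+ e :* (κ 2 :* (κ 2 :* N :+ κ 1 :+ κ 1) :* y) :+ (:- (κ 2 :* y)) :* (κ 2 :* (N :+ κ 1) :* e)) refl N y e)

  -- Reflection gives Gs (2h) ≈ 2 Gs h, and splitting by parity gives 4 Gs (2h) ≈ 2 Gs h.
  Gs-h≈0 : Gs h ≈ 0# mod^ 1
  Gs-h≈0 = ≈-cancel 6-inverse (*-integral inv2-integral inv3-integral) (≈-trans (≡⇒≈
    (solve 1 (λ G → κ 2 :* κ 3 :* G := κ 4 :* (G :+ G) :- κ 2 :* G) refl (Gs h)))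
    (≈-trans (≈-- (≈-*ˡ (ι-integral 4) 2G≈F) ≈-refl) (≈-trans (≈-- (≡⇒≈ (Gs-parity h)) ≈-refl)
      (≈-trans (≈-- (≈-+ Oh≈Gh ≈-refl) ≈-refl)
        (≡⇒≈ (solve 1 (λ G → G :+ G :- κ 2 :* G := κ 2 :* κ 3 :* κ 0) refl (Gs h)))))))
    where
    6-inverse : ι 2 * ι 3 * (inv 2 * inv 3) ≡ 1#
    6-inverse = trans (solve 4 (λ a b c d → a :* b :* (c :* d) := a :* c :* (b :* d)) refl (ι 2) (ι 3) (inv 2) (inv 3))
      (trans (cong₂ _*_ (inv-inverse 1) (inv-inverse 2)) (*-identityˡ 1#))
    2G≈F : Gs h + Gs h ≈ Gs (dbl h) mod^ 1
    2G≈F = Gs-reflect h h (sym (trans (dbl≡2* h) (cong (h ℕ.+_) (ℕₚ.+-identityʳ h))))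
    Oh≈Gh : Os h ≈ Gs h mod^ 1
    Oh≈Gh = ≈-trans (≡⇒≈ (sym (+-identityʳ _))) (Os-Gs h 0 (ℕₚ.+-identityʳ h))

  Gs-2h≈0 : Gs (dbl h) ≈ 0# mod^ 1
  Gs-2h≈0 = ≈-trans (≈-sym (Gs-reflect h h (sym (trans (dbl≡2* h) (cong (h ℕ.+_) (ℕₚ.+-identityʳ h))))))
    (≈-trans (≈-+ Gs-h≈0 Gs-h≈0) (≡⇒≈ (+-identityˡ 0#)))

  -- With `p = (2k+1) + (2r+2)`, the ratio `(2k+1)/(2k+2)` of consecutive values is `(2r+2)/(2r+1)`
  -- modulo `p`, the inverse of the ratio at `r`.
  a-reflect : ∀ r k → k ℕ.+ r ≡ h → a k ≈ a h * a r mod^ 1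
  a-reflect zero    k k+0≡h = ≡⇒≈ (trans (cong a (trans (sym (ℕₚ.+-identityʳ k)) k+0≡h)) (sym (*-identityʳ _)))
  a-reflect (suc r) k k+r≡h = ≈-cancel (e-inverse r) (e-integral′ r<h)
    (≈-trans (mod-P (a k - a (suc k))
      (+-integral (a-integral k (ℕₚ.≤-trans (ℕₚ.<⇒≤ k<h) h≤2h)) (-‿integral (a-integral (suc k) (ℕₚ.≤-trans k<h h≤2h)))) step)
    (≈-trans (≈-*ˡ (odd-integral r) (a-reflect r (suc k) (trans (sym (ℕₚ.+-suc k r)) k+r≡h)))
      (≡⇒≈ (identity₂ (ι r) (a h) (a r) (e (suc r)) (e-inverse r)))))
    where
    k<h : k ℕ.< h
    k<h = subst (k ℕ.<_) (trans (sym (ℕₚ.+-suc k r)) k+r≡h) (s≤s (ℕₚ.m≤m+n k r))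
    r<h : r ℕ.< h
    r<h = subst (r ℕ.<_) (trans (sym (ℕₚ.+-suc k r)) k+r≡h) (s≤s (ℕₚ.m≤n+m r k))
    identity₁ : ∀ K R A E P → ι 2 * (K + 1#) * E ≡ 1# → P ≡ ι 2 * K + 1# + ι 2 * (R + 1#) → let A′ = A * (ι 2 * K + 1#) * E in
      ι 2 * (R + 1#) * A ≡ (ι 2 * R + 1#) * A′ + P * (A - A′)
    identity₁ K R A E _ DE refl = lin₁ (A * (ι 2 * K + 1#)) DE (solve 4 (λ K R A E →
         let O = κ 2 :* K :+ κ 1; A′ = A :* O :* E in
         κ 2 :* (R :+ κ 1) :* A :+ A :* O :* κ 1
      := (κ 2 :* R :+ κ 1) :* A′ :+ (O :+ κ 2 :* (R :+ κ 1)) :* (A :- A′) :+ A :* O :* (κ 2 :* (K :+ κ 1) :* E)) refl K R A E)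
    identity₂ : ∀ R Ah A E → ι 2 * (R + 1#) * E ≡ 1# → (ι 2 * R + 1#) * (Ah * A) ≡ ι 2 * (R + 1#) * (Ah * (A * (ι 2 * R + 1#) * E))
    identity₂ R Ah A E DE = lin₁ (- (Ah * A * (ι 2 * R + 1#))) DE (solve 4 (λ R Ah A E → let O = κ 2 :* R :+ κ 1 in
         O :* (Ah :* A) :+ (:- (Ah :* A :* O)) :* κ 1
      := κ 2 :* (R :+ κ 1) :* (Ah :* (A :* O :* E)) :+ (:- (Ah :* A :* O)) :* (κ 2 :* (R :+ κ 1) :* E)) refl R Ah A E)
    step : ι 2 * (ι r + 1#) * a k ≡ odd r * a (suc k) + P * (a k - a (suc k))
    step = identity₁ (ι k) (ι r) (a k) (e (suc k)) P (e-inverse k) (P-split k r (trans (sym (ℕₚ.+-suc k r)) k+r≡h))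

  -- Wolstenholme's theorem: pairing `j` with `p - j` extracts one `P`, and the remaining sum is
  -- congruent to `- Gs (dbl h)`, which vanishes modulo `P`.
  e-sum≈0 : ∑ (dbl h) (λ i → e (suc i)) ≈ 0# mod^ 2
  e-sum≈0 = ≈-cancel (inv-inverse 1) inv2-integral (≈-trans (≡⇒≈ 2S≡) (≈-trans (≈-*ˡ (ι-integral 2) (≈-P* EE≈0))
    (≡⇒≈ (cong (ι 2 *_) (zeroʳ P)))))
    where
    open ≡-Reasoning
    ē : ℕ → Carrier
    ē i = e (suc (dbl h ℕ.∸ suc i))
    reverse : ∀ n (f : ℕ → Carrier) → ∑ n (λ i → f (n ℕ.∸ suc i)) ≡ ∑ n f
    reverse zero    f = refl
    reverse (suc n) f = ∑-reverse n f
    complement : ∀ {i} → i ℕ.< dbl h → suc (i ℕ.+ (dbl h ℕ.∸ suc i)) ≡ dbl h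
    complement i<2h = ℕₚ.m+[n∸m]≡n i<2h
    2S≡ : ι 2 * ∑ (dbl h) (λ i → e (suc i)) ≡ ι 2 * (P * ∑ (dbl h) (λ i → e (suc i) * ē i))
    2S≡ = begin
      ι 2 * ∑ (dbl h) (λ i → e (suc i))
        ≡⟨ solve 1 (λ x → κ 2 :* x := x :+ x) refl (∑ (dbl h) (λ i → e (suc i))) ⟩
      ∑ (dbl h) (λ i → e (suc i)) + ∑ (dbl h) (λ i → e (suc i))
        ≡⟨ cong (∑ (dbl h) (λ i → e (suc i)) +_) (sym (reverse (dbl h) (λ i → e (suc i)))) ⟩
      ∑ (dbl h) (λ i → e (suc i)) + ∑ (dbl h) ē
        ≡⟨ sym (∑-+ (dbl h) _ _) ⟩
      ∑ (dbl h) (λ i → e (suc i) + ē i)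
        ≡⟨ ∑-cong (dbl h) (λ i i<2h → e-reflect-eq i _ (complement i<2h)) ⟩
      ∑ (dbl h) (λ i → ι 2 * P * (e (suc i) * ē i))
        ≡⟨ ∑-* (dbl h) (ι 2 * P) _ ⟩
      ι 2 * P * ∑ (dbl h) (λ i → e (suc i) * ē i)
        ≡⟨ *-assoc _ _ _ ⟩
      ι 2 * (P * ∑ (dbl h) (λ i → e (suc i) * ē i)) ∎
    EE≈0 : ∑ (dbl h) (λ i → e (suc i) * ē i) ≈ 0# mod^ 1
    EE≈0 = ≈-trans (≈-∑ (dbl h) {g = λ i → - 1# * (e (suc i) * e (suc i))} (λ i i<2h → ≈-trans (≡⇒≈ (*-comm _ _))
        (≈-trans (≈-*ʳ (e-integral i<2h) (e-reflect _ i (trans (cong suc (ℕₚ.+-comm (dbl h ℕ.∸ suc i) i)) (complement i<2h))))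
          (≡⇒≈ (solve 1 (λ x → (:- x) :* x := (:- κ 1) :* (x :* x)) refl (e (suc i)))))))
      (≈-trans (≡⇒≈ (∑-* (dbl h) (- 1#) _)) (≈-trans (≈-*ˡ (-‿integral 1-integral) Gs-2h≈0) (≡⇒≈ (zeroʳ _))))

  private
    -- `Y` is the form in which the Euler number of index `p-3` appears: the two agree modulo `P`.
    σ A Y ∑b W : Carrier
    σ = sgn h
    A = a h
    Y = ι 2 * (σ * Ās h)
    ∑b = ∑ (suc h) b
    W = ∑ (suc h) (λ k → b k * Gs k)

    bh : ∀ {k} → k ℕ.≤ h → Integral (b k)
    bh {k} k≤h = b-integral k (ℕₚ.≤-trans k≤h h≤2h)

    ah : ∀ {k} → k ℕ.≤ h → Integral (a k)
    ah {k} k≤h = a-integral k (ℕₚ.≤-trans k≤h h≤2h)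

    Gh : ∀ {k} → k ℕ.≤ h → Integral (Gs k)
    Gh {k} k≤h = Gs-integral k (ℕₚ.≤-trans k≤h h≤2h)

    A-integral : Integral A
    A-integral = ah ℕₚ.≤-refl

    W-integral : Integral W
    W-integral = ∑-integral (suc h) λ { k (s≤s k≤h) → *-integral (bh k≤h) (Gh k≤h) }

  -- Modulo `P` each `b k` may be replaced by `w k (odd h)`, for which the weighted sum is known
  -- exactly.
  W≈-Y : W ≈ - Y mod^ 1
  W≈-Y = ≈-trans (≈-∑ (suc h) λ { k (s≤s k≤h) → ≈-*ʳ (Gh k≤h) (≈-sym (w-≈b k k≤h)) })
    (≡⇒≈ (trans (∑-cong′ (suc h) (λ k → cong (λ t → w k t * Gs k) P≡)) (∑wG h)))

  private
    E₀ : Carrier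
    E₀ = ∑ (suc h) (λ k → b k * Os k)

    -- The sum of `w k P` is exactly `σ` since `P = odd h`; expanding each term modulo P³ isolates
    -- `∑b`.
    ∑b≈ : ∑b ≈ σ + P * P * E₀ mod^ 3
    ∑b≈ = ≈-trans (≡⇒≈ split) (≈-+ (≈-sym ∑w≈) ≈-refl)
      where
      ∑w≈ : σ ≈ ∑b - P * P * E₀ mod^ 3
      ∑w≈ = ≈-trans (≡⇒≈ (trans (sym (∑w-sgn h)) (∑-cong′ (suc h) (λ k → cong (w k) (sym P≡)))))
        (≈-trans (≈-∑ (suc h) λ { k (s≤s k≤h) → w-≈ k k≤h }) (≡⇒≈ (linear (suc h))))
        where
        linear : ∀ n → ∑ n (λ k → b k * (1# - P * P * Os k)) ≡ ∑ n b - P * P * ∑ n (λ k → b k * Os k)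
        linear zero    = solve 1 (λ P → κ 0 := κ 0 :- P :* P :* κ 0) refl P
        linear (suc n) = trans (cong (_+ b n * (1# - P * P * Os n)) (linear n))
          (solve 5 (λ x y b o P → x :- P :* P :* y :+ b :* (κ 1 :- P :* P :* o) := x :+ b :- P :* P :* (y :+ b :* o)) refl
            (∑ n b) (∑ n (λ k → b k * Os k)) (b n) (Os n) P)
      split : ∑b ≡ ∑b - P * P * E₀ + P * P * E₀
      split = solve 2 (λ x y → x := x :- y :+ y) refl ∑b (P * P * E₀)

    ∑b≈σ : ∑b ≈ σ mod^ 1
    ∑b≈σ = ≈-trans (weaken (weaken ∑b≈)) (mod-P (P * E₀) (*-integral P-integral
      (∑-integral (suc h) λ { k (s≤s k≤h) → *-integral (bh k≤h) (Os-integral k k≤h) }))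
      (cong (σ +_) (*-assoc _ _ _)))

    A∑b≈1 : A * ∑b ≈ 1# mod^ 1
    A∑b≈1 = ≈-trans (≡⇒≈ (sym (∑-* (suc h) A b))) (≈-trans
      (≈-∑ (suc h) {g = λ r → a r * a (h ℕ.∸ r)} (λ { r (s≤s r≤h) → ≈-trans
        (≡⇒≈ (solve 2 (λ A x → A :* (x :* x) := x :* (A :* x)) refl A (a r)))
        (≈-*ˡ (ah r≤h) (≈-sym (a-reflect r (h ℕ.∸ r) (ℕₚ.m∸n+n≡m r≤h)))) }))
      (≡⇒≈ (vandermonde h)))

    -- `A * ∑b` is congruent both to `1#`, by reflection and `vandermonde`, and to `A * σ`.
    A≈σ : A ≈ σ mod^ 1
    A≈σ = ≈-trans (≡⇒≈ (lin₁ (- A) (sgn² h) (solve 2 (λ A σ → A :+ (:- A) :* κ 1 := A :* σ :* σ :+ (:- A) :* (σ :* σ)) refl A σ)))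
      (≈-trans (≈-*ʳ (sgn-integral h) (≈-trans (≈-*ˡ A-integral (≈-sym ∑b≈σ)) A∑b≈1)) (≡⇒≈ (*-identityˡ σ)))

    A²≈1 : A * A ≈ 1# mod^ 1
    A²≈1 = ≈-trans (≈-* (sgn-integral h) A-integral A≈σ A≈σ) (≡⇒≈ (sgn² h))

    -- Reversal of the sum: modulo `P`, `b (h-r)` is `A² b r`, that is `b r`, and `Os (h-r)` is
    -- `Gs h - Gs r`, where `Gs h` vanishes.
    E₀≈-W : E₀ ≈ - W mod^ 1
    E₀≈-W = ≈-trans (≡⇒≈ (sym (∑-reverse h (λ k → b k * Os k))))
      (≈-trans (≈-∑ (suc h) {g = λ r → - 1# * (b r * Gs r)} (λ { r (s≤s r≤h) → term r (h ℕ.∸ r) r≤h (ℕₚ.m∸n≤m h r) (ℕₚ.m∸n+n≡m r≤h) }))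
      (≡⇒≈ (trans (∑-* (suc h) (- 1#) _) (solve 1 (λ x → (:- κ 1) :* x := :- x) refl W))))
      where
      Os≈ : ∀ r k → k ℕ.+ r ≡ h → Os k ≈ - Gs r mod^ 1
      Os≈ r k k+r≡h = ≈-trans (≡⇒≈ (solve 2 (λ x y → x := x :+ y :- y) refl (Os k) (Gs r)))
        (≈-trans (≈-- (≈-trans (Os-Gs k r k+r≡h) Gs-h≈0) ≈-refl) (≡⇒≈ (+-identityˡ _)))
      b≈ : ∀ r k → r ℕ.≤ h → k ℕ.≤ h → k ℕ.+ r ≡ h → b k ≈ b r mod^ 1
      b≈ r k r≤h k≤h k+r≡h = ≈-trans (≈-* (*-integral A-integral (ah r≤h)) (ah k≤h) (a-reflect r k k+r≡h) (a-reflect r k k+r≡h))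
        (≈-trans (≡⇒≈ (solve 2 (λ A x → A :* x :* (A :* x) := A :* A :* (x :* x)) refl A (a r)))
          (≈-trans (≈-*ʳ (bh r≤h) A²≈1) (≡⇒≈ (*-identityˡ _))))
      term : ∀ r k → r ℕ.≤ h → k ℕ.≤ h → k ℕ.+ r ≡ h → b k * Os k ≈ - 1# * (b r * Gs r) mod^ 1
      term r k r≤h k≤h k+r≡h = ≈-trans (≈-* (bh r≤h) (Os-integral k k≤h) (b≈ r k r≤h k≤h k+r≡h) (Os≈ r k k+r≡h))
        (≡⇒≈ (solve 2 (λ x y → x :* (:- y) := (:- κ 1) :* (x :* y)) refl (b r) (Gs r)))

    ∑b≈σ-W : ∑b ≈ σ - P * P * W mod^ 3
    ∑b≈σ-W = ≈-trans ∑b≈ (≈-+ ≈-refl (≈-trans (≈-P²* E₀≈-W)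
      (≡⇒≈ (solve 2 (λ P W → P :* P :* (:- W) := :- (P :* P :* W)) refl P W))))

    α-inverse : ∀ r → α r * a r ≡ 1#
    α-inverse zero    = *-identityˡ 1#
    α-inverse (suc r) = identity (α r) (a r) (ι 2 * (ι r + 1#)) (e (suc r)) (odd r) (o r) (α-inverse r) (e-inverse r) (o-inverse r)
      where
      identity : ∀ α a D E O o → α * a ≡ 1# → D * E ≡ 1# → O * o ≡ 1# → α * D * o * (a * O * E) ≡ 1#
      identity α a D E O o h₁ h₂ h₃ = trans
        (solve 6 (λ α a D E O o → α :* D :* o :* (a :* O :* E) := α :* a :* (D :* E) :* (O :* o)) refl α a D E O o)
        (trans (cong₂ _*_ (cong₂ _*_ h₁ h₂) h₃) (solve 0 (κ 1 :* κ 1 :* κ 1 := κ 1) refl))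

    -- a (h ∸ r) - a h * a r is divisible by P, so its cube vanishes mod P³; this turns the cubic sum
    -- into sums of quadratic terms, which are known exactly or mod P³.
    cubic-term : ∀ r → r ℕ.≤ h → let x = a (h ℕ.∸ r) in
      x * x * x * α r ≈ ι 3 * A * (x * x) - ι 3 * A * A * (a r * x) + A * A * A * b r mod^ 3
    cubic-term r r≤h with a-reflect r (h ℕ.∸ r) (ℕₚ.m∸n+n≡m r≤h)
    ... | quot {l} il x≡ = mod-P³ (α r * (l * l * l)) (*-integral (α-integral r r≤h) (*-integral (*-integral il il) il))
      (identity A (a r) (α r) l P _ x≡ (α-inverse r))
      where
      identity : ∀ A a α l P x → x ≡ A * a + P ^ 1 * l → α * a ≡ 1# →
        x * x * x * α ≡ ι 3 * A * (x * x) - ι 3 * A * A * (a * x) + A * A * A * (a * a) + P * P * P * (α * (l * l * l))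
      identity A a α l P x x≡ αa = lin₂ (ι 3 * A * x * x - ι 3 * A * A * a * x + A * A * A * a * a) αa
        0# x≡ (trans (cong (λ x → x * x * x * α + C x * 1# + 0# * (A * a + P ^ 1 * l)) x≡)
          (trans (solve 5 (λ A a α l P → let x = A :* a :+ P :* κ 1 :* l
                                             C = κ 3 :* A :* x :* x :- κ 3 :* A :* A :* a :* x :+ A :* A :* A :* a :* a in
              x :* x :* x :* α :+ C :* κ 1 :+ κ 0 :* x
           := κ 3 :* A :* (x :* x) :- κ 3 :* A :* A :* (a :* x) :+ A :* A :* A :* (a :* a) :+ P :* P :* P :* (α :* (l :* l :* l))
              :+ C :* (α :* a) :+ κ 0 :* x) refl A a α l P)
          (cong (λ x → ι 3 * A * (x * x) - ι 3 * A * A * (a * x) + A * A * A * (a * a) + P * P * P * (α * (l * l * l))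
              + C x * (α * a) + 0# * x) (sym x≡))))
        where
        C : Carrier → Carrier
        C x = ι 3 * A * x * x - ι 3 * A * A * a * x + A * A * A * a * a

    -- The correction from `π` already has the factor P², so its cofactor is needed only modulo `P`,
    -- where the cube times `α r` is `A³ b r`.
    summand : ∀ r → r ℕ.≤ h → let x = a (h ℕ.∸ r) in
      x * x * x * α r * π r (odd h)
      ≈ ι 3 * A * (x * x) - ι 3 * A * A * (a r * x) + A * A * A * b r - P * P * (A * A * A) * (b r * Gs r) mod^ 3
    summand r r≤h = ≈-trans (≈-*ˡ iX (≈-trans (≡⇒≈ (cong (π r) (sym P≡)))
        (π-≈ 1-integral (sym (*-identityˡ P)) r (ℕₚ.≤-trans r≤h h≤2h))))
      (≈-trans (≡⇒≈ (solve 3 (λ X P G → X :* (κ 1 :- P :* P :* G) := X :- P :* P :* (X :* G)) refl X P (Gs r)))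
      (≈-- (cubic-term r r≤h) (≈-trans (≈-P²* (≈-*ʳ (Gh r≤h) X≈)) (≡⇒≈
        (solve 4 (λ P A b G → P :* P :* (A :* b :* G) := P :* P :* A :* (b :* G)) refl P (A * A * A) (b r) (Gs r))))))
      where
      x X : Carrier
      x = a (h ℕ.∸ r)
      X = x * x * x * α r
      ix : Integral x
      ix = ah (ℕₚ.m∸n≤m h r)
      iX : Integral X
      iX = *-integral (*-integral (*-integral ix ix) ix) (α-integral r r≤h)
      x≈ : x ≈ A * a r mod^ 1
      x≈ = a-reflect r (h ℕ.∸ r) (ℕₚ.m∸n+n≡m r≤h)
      iAa : Integral (A * a r)
      iAa = *-integral A-integral (ah r≤h)
      X≈ : X ≈ A * A * A * b r mod^ 1
      X≈ = ≈-trans (≈-*ʳ (α-integral r r≤h) (≈-* (*-integral iAa iAa) ix (≈-* iAa ix x≈ x≈) x≈))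
        (≡⇒≈ (lin₁ (A * A * A * b r) (α-inverse r)
          (solve 3 (λ A a α → A :* a :* (A :* a) :* (A :* a) :* α :+ A :* A :* A :* (a :* a) :* κ 1
            := A :* A :* A :* (a :* a) :+ A :* A :* A :* (a :* a) :* (α :* a)) refl A (a r) (α r))))

    ∑-linear₄ : ∀ n c₁ c₂ c₃ c₄ (f₁ f₂ f₃ f₄ : ℕ → Carrier) →
      ∑ n (λ k → c₁ * f₁ k - c₂ * f₂ k + c₃ * f₃ k - c₄ * f₄ k) ≡ c₁ * ∑ n f₁ - c₂ * ∑ n f₂ + c₃ * ∑ n f₃ - c₄ * ∑ n f₄
    ∑-linear₄ zero c₁ c₂ c₃ c₄ f₁ f₂ f₃ f₄ =
      solve 4 (λ a b c d → κ 0 := a :* κ 0 :- b :* κ 0 :+ c :* κ 0 :- d :* κ 0) refl c₁ c₂ c₃ c₄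
    ∑-linear₄ (suc n) c₁ c₂ c₃ c₄ f₁ f₂ f₃ f₄ = trans
      (cong (_+ (c₁ * f₁ n - c₂ * f₂ n + c₃ * f₃ n - c₄ * f₄ n)) (∑-linear₄ n c₁ c₂ c₃ c₄ f₁ f₂ f₃ f₄))
      (solve 12 (λ a b c d s t u v x y z w → a :* s :- b :* t :+ c :* u :- d :* v :+ (a :* x :- b :* y :+ c :* z :- d :* w)
        := a :* (s :+ x) :- b :* (t :+ y) :+ c :* (u :+ z) :- d :* (v :+ w)) refl
        c₁ c₂ c₃ c₄ (∑ n f₁) (∑ n f₂) (∑ n f₃) (∑ n f₄) (f₁ n) (f₂ n) (f₃ n) (f₄ n))

    ∑-cubic : ∑ (suc h) (λ r → a (h ℕ.∸ r) * a (h ℕ.∸ r) * a (h ℕ.∸ r) * α r * π r (odd h))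
      ≈ ι 3 * A * ∑b - ι 3 * A * A * 1# + A * A * A * ∑b - P * P * (A * A * A) * W mod^ 3
    ∑-cubic = ≈-trans (≈-∑ (suc h) λ { r (s≤s r≤h) → summand r r≤h }) (≡⇒≈
      (trans (∑-linear₄ (suc h) (ι 3 * A) (ι 3 * A * A) (A * A * A) (P * P * (A * A * A)) _ _ _ _)
        (cong₂ (λ x y → ι 3 * A * x - ι 3 * A * A * y + A * A * A * ∑b - P * P * (A * A * A) * W)
          (∑-reverse h b) (vandermonde h))))

    -- The terms in `W` give the constant 5 as `3 + 1 + 1`: modulo `P` the contributions of `3 A S`,
    -- of `A³ S` and of the correction from `π`. The remaining terms form `σ + (A - σ)³`.
    assemble-identity : ∀ σ P W ε A → A ≡ σ + P ^ 1 * ε → σ * σ ≡ 1# → let S = σ - P * P * W in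
      σ * (ι 3 * A * S - ι 3 * A * A * 1# + A * A * A * S - P * P * (A * A * A) * W)
      ≡ σ - P * P * (ι 5 * W) + P * P * P * (ε * ε * ε - W * (ι 9 * σ * ε + ι 6 * P * ε * ε + ι 2 * P * P * ε * ε * ε * σ))
    assemble-identity σ P W ε A refl σσ = lin₁ C σσ
      (solve 4 (λ σ P W ε → let A = σ :+ P :* κ 1 :* ε
                                S = σ :- P :* P :* W
                                C = σ :+ A :* A :* A :- P :* P :* W :* (κ 3 :+ κ 2 :* (σ :* σ :+ κ 1) :+ κ 6 :* σ :* P :* ε :+ κ 6 :* P :* P :* ε :* ε) in
          σ :* (κ 3 :* A :* S :- κ 3 :* A :* A :* κ 1 :+ A :* A :* A :* S :- P :* P :* (A :* A :* A) :* W) :+ C :* κ 1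
       := σ :- P :* P :* (κ 5 :* W) :+ P :* P :* P :* (ε :* ε :* ε :- W :* (κ 9 :* σ :* ε :+ κ 6 :* P :* ε :* ε :+ κ 2 :* P :* P :* ε :* ε :* ε :* σ))
           :+ C :* (σ :* σ)) refl σ P W ε)
      where
      C : Carrier
      C = σ + A * A * A - P * P * W * (ι 3 + ι 2 * (σ * σ + 1#) + ι 6 * σ * P * ε + ι 6 * P * P * ε * ε)

    assemble : σ * (ι 3 * A * ∑b - ι 3 * A * A * 1# + A * A * A * ∑b - P * P * (A * A * A) * W) ≈ σ - P * P * (ι 5 * W) mod^ 3
    assemble = expand A≈σ
      where
      iσ : Integral σ
      iσ = sgn-integral h
      expand : A ≈ σ mod^ 1 → σ * (ι 3 * A * ∑b - ι 3 * A * A * 1# + A * A * A * ∑b - P * P * (A * A * A) * W) ≈ σ - P * P * (ι 5 * W) mod^ 3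
      expand (quot {ε} iε A≡) = ≈-trans (≈-*ˡ iσ (≈-- (≈-+ (≈-- (≈-*ˡ (*-integral (ι-integral 3) A-integral) ∑b≈σ-W) ≈-refl)
          (≈-*ˡ (*-integral (*-integral A-integral A-integral) A-integral) ∑b≈σ-W)) ≈-refl))
        (mod-P³ (ε * ε * ε - W * (ι 9 * σ * ε + ι 6 * P * ε * ε + ι 2 * P * P * ε * ε * ε * σ))
          (+-integral (*-integral (*-integral iε iε) iε) (-‿integral (*-integral W-integral
            (+-integral (+-integral (*-integral (*-integral (ι-integral 9) iσ) iε)
              (*-integral (*-integral (*-integral (ι-integral 6) P-integral) iε) iε))
              (*-integral (*-integral (*-integral (*-integral (*-integral (*-integral (ι-integral 2) P-integral) P-integral) iε) iε) iε) iσ)))))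
          (assemble-identity σ P W ε A A≡ (sgn² h)))

    -W-to-Y : ∀ c → σ - P * P * (ι c * W) ≈ σ + P * P * (ι c * Y) mod^ 3
    -W-to-Y c = ≈-+ ≈-refl (≈-trans (≡⇒≈ (solve 2 (λ Q x → :- (Q :* x) := Q :* (:- x)) refl (P * P) (ι c * W)))
      (≈-P²* (≈-trans (≈-neg (≈-*ˡ (ι-integral c) W≈-Y)) (≡⇒≈ (solve 2 (λ c y → :- (c :* (:- y)) := c :* y) refl (ι c) Y)))))

  weighted-sum-mod : ∑ p (λ n → (ι n + 1#) * ι 2 ^ n * s n) ≈ P * (σ + P * P * (ι 5 * Y)) mod^ 4
  weighted-sum-mod = ≈-trans (≡⇒≈ (trans (weighted-sum h) (cong (_* (σ * ∑ (suc h) (λ r → a (h ℕ.∸ r) * a (h ℕ.∸ r) * a (h ℕ.∸ r) * α r * π r (odd h)))) (sym P≡))))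
    (≈-P* (≈-trans (≈-*ˡ (sgn-integral h) ∑-cubic) (≈-trans assemble (-W-to-Y 5))))

  private
    iσ : Integral σ
    iσ = sgn-integral h

    b-w : ∀ k → b k ≡ w k 0#
    b-w zero    = *-identityˡ 1#
    b-w (suc k) = trans (solve 3 (λ A O E → A :* O :* E :* (A :* O :* E) := A :* A :* (O :* O :- κ 0 :* κ 0) :* (E :* E)) refl
      (a k) (odd k) (e (suc k))) (cong (λ t → t * (odd k * odd k - 0# * 0#) * (e (suc k) * e (suc k))) (b-w k))

    -- `S` runs through the arguments `1 - P, 3 - P, ...` up to `odd h - P = 0`, where `w k` is
    -- `b k`; `Q i` is the product that `∑w` assigns to the midpoint between two consecutive
    -- arguments.
    S Q : ℕ → Carrier
    S i = ∑ p (λ k → w k (odd i - P))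
    Q i = π (dbl h) (ι 2 * ι i - P)

    S-step : ∀ i → S (suc i) ≡ ι 2 * Q (suc i) - S i
    S-step i = lin₁ 1# eq (solve 3 (λ x y z → x :+ κ 1 :* z := z :- y :+ κ 1 :* (x :+ y)) refl (S (suc i)) (S i) (ι 2 * Q (suc i)))
      where
      open ≡-Reasoning
      z : Carrier
      z = ι 2 * ι (suc i) - P
      eq : S (suc i) + S i ≡ ι 2 * Q (suc i)
      eq = begin
        S (suc i) + S i
          ≡⟨ sym (∑-+ p _ _) ⟩
        ∑ p (λ k → w k (odd (suc i) - P) + w k (odd i - P))
          ≡⟨ ∑-cong′ p (λ k → cong₂ (λ s t → w k s + w k t)
               (solve 2 (λ I P → κ 2 :* I :+ κ 1 :- P := κ 2 :* I :- P :+ κ 1) refl (ι (suc i)) P)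
               (trans (solve 2 (λ I P → κ 2 :* I :+ κ 1 :- P := κ 2 :* (I :+ κ 1) :- P :- κ 1) refl (ι i) P)
                 (cong (λ t → ι 2 * t - P - 1#) (sym (ι-suc i))))) ⟩
        ∑ p (λ k → w k (z + 1#) + w k (z - 1#))
          ≡⟨ ∑w (dbl h) z ⟩
        ι 2 * Q (suc i) ∎

    module Step (i r : ℕ) (i+r≡h : suc (i ℕ.+ r) ≡ h) where

      i<h : i ℕ.< h
      i<h = subst (i ℕ.<_) i+r≡h (s≤s (ℕₚ.m≤m+n i r))
      r<h : r ℕ.< h
      r<h = subst (r ℕ.<_) i+r≡h (s≤s (ℕₚ.m≤n+m r i))

      -- `u` is the inverse of `(3P - D)(P - D)`. It is integral because these factors are the odd
      -- numbers `odd (p + r)` and `odd r`, both prime to `p`.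
      D E u : Carrier
      D = ι 2 * (ι i + 1#)
      E = e (suc i)
      u = o r * o (p ℕ.+ r)

      u-integral : Integral u
      u-integral = *-integral (o-integral r<h) (o-shift-integral r<h)

      P-D : P - D ≡ odd r
      P-D = trans (cong (_- D) (P-split r i (trans (cong suc (ℕₚ.+-comm r i)) i+r≡h)))
        (solve 2 (λ x y → x :+ y :- y := x) refl (odd r) D)

      u-inverse : (ι 3 * P - D) * (P - D) * u ≡ 1#
      u-inverse = begin
        (ι 3 * P - D) * (P - D) * u
          ≡⟨ cong (λ t → t * (P - D) * u) (solve 2 (λ P D → κ 3 :* P :- D := κ 2 :* P :+ (P :- D)) refl P D) ⟩
        (ι 2 * P + (P - D)) * (P - D) * u
          ≡⟨ cong (λ t → (ι 2 * P + t) * t * u) P-D ⟩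
        (ι 2 * P + odd r) * odd r * u
          ≡⟨ solve 4 (λ P R o o′ → (κ 2 :* P :+ (κ 2 :* R :+ κ 1)) :* (κ 2 :* R :+ κ 1) :* (o :* o′)
                := (κ 2 :* (P :+ R) :+ κ 1) :* o′ :* ((κ 2 :* R :+ κ 1) :* o)) refl P (ι r) (o r) (o (p ℕ.+ r)) ⟩
        (ι 2 * (P + ι r) + 1#) * o (p ℕ.+ r) * (odd r * o r)
          ≡⟨ cong₂ (λ s t → (ι 2 * s + 1#) * o (p ℕ.+ r) * t) (sym (ι-+ p r)) (o-inverse r) ⟩
        odd (p ℕ.+ r) * o (p ℕ.+ r) * 1#
          ≡⟨ trans (*-identityʳ _) (o-inverse (p ℕ.+ r)) ⟩
        1# ∎
        where open ≡-Reasoning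

      u≈ : u ≈ E * E mod^ 1
      u≈ = mod-P (- (u * (E * E) * (ι 3 * P - ι 4 * D)))
        (-‿integral (*-integral (*-integral u-integral iE²) (+-integral (*-integral (ι-integral 3) P-integral)
          (-‿integral (*-integral (ι-integral 4) (*-integral (ι-integral 2) (+-integral (ι-integral i) 1-integral)))))))
        (identity P D E u u-inverse (e-inverse i))
        where
        iE² : Integral (E * E)
        iE² = *-integral (e-integral′ i<h) (e-integral′ i<h)
        identity : ∀ P D E u → (ι 3 * P - D) * (P - D) * u ≡ 1# → D * E ≡ 1# →
          u ≡ E * E + P * (- (u * (E * E) * (ι 3 * P - ι 4 * D)))
        identity P D E u h₁ h₂ = lin₂ (E * E) h₁ (- (u * (D * E + 1#))) h₂
          (solve 4 (λ P D E u → let C = :- (u :* (D :* E :+ κ 1)) in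
             u :+ E :* E :* κ 1 :+ C :* κ 1
          := E :* E :+ P :* (:- (u :* (E :* E) :* (κ 3 :* P :- κ 4 :* D))) :+ E :* E :* ((κ 3 :* P :- D) :* (P :- D) :* u)
               :+ C :* (D :* E)) refl P D E u)

      -- `π-step` for the top index `N = P - 1` and `z = D - P`: there `z - 2 - 2N` becomes
      -- `D - 3P`, and the factors on the other side become `2i + P` and `2i - P`.
      Q-step : Q (suc i) ≡ - (u * ((P * P - ι 2 * ι i * (ι 2 * ι i)) * Q i))
      Q-step = trans (cong (λ t → π (dbl h) (ι 2 * t - P)) (ι-suc i))
        (identity P (ι i) D (ι (dbl h)) u (π (dbl h) (D - P)) (Q i) refl (ι-suc (dbl h)) u-inverse
          (trans (π-step (dbl h) (D - P)) (cong (λ t → (D - P + ι 2 * ι (dbl h)) * (D - P - ι 2) * π (dbl h) t)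
            (solve 2 (λ I P → κ 2 :* (I :+ κ 1) :- P :- κ 2 := κ 2 :* I :- P) refl (ι i) P))))
        where
        identity : ∀ P I D N u q′ q → D ≡ ι 2 * (I + 1#) → P ≡ N + 1# → (ι 3 * P - D) * (P - D) * u ≡ 1# →
          (D - P - ι 2 - ι 2 * N) * (D - P) * q′ ≡ (D - P + ι 2 * N) * (D - P - ι 2) * q →
          q′ ≡ - (u * ((P * P - ι 2 * I * (ι 2 * I)) * q))
        identity P I D N u q′ q refl refl h₁ h₂ = lin₂ (- q′) h₁ u h₂
          (solve 5 (λ I N u q′ q → let P = N :+ κ 1; D = κ 2 :* (I :+ κ 1) in
             q′ :+ (:- q′) :* κ 1 :+ u :* ((D :- P :+ κ 2 :* N) :* (D :- P :- κ 2) :* q)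
          := :- (u :* ((P :* P :- κ 2 :* I :* (κ 2 :* I)) :* q)) :+ (:- q′) :* ((κ 3 :* P :- D) :* (P :- D) :* u)
               :+ u :* ((D :- P :- κ 2 :- κ 2 :* N) :* (D :- P) :* q′)) refl I N u q′ q)

      Q-suc≈ : (P * P - ι 2 * ι i * (ι 2 * ι i)) * Q i ≈ P * P mod^ 3 → Q (suc i) ≈ - (P * P * (E * E)) mod^ 3
      Q-suc≈ c≈ = ≈-trans (≡⇒≈ Q-step) (≈-neg (≈-trans (≈-*ˡ u-integral c≈) (≈-trans (≡⇒≈ (*-comm u (P * P))) (≈-P²* u≈))))

      Q-suc-scaled≈ : Q (suc i) ≈ - (P * P * (E * E)) mod^ 3 →
        (P * P - ι 2 * ι (suc i) * (ι 2 * ι (suc i))) * Q (suc i) ≈ P * P mod^ 3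
      Q-suc-scaled≈ q≈ = ≈-trans (≈-*ˡ (+-integral (*-integral P-integral P-integral)
          (-‿integral (*-integral iD′ iD′))) q≈)
        (≈-trans (≡⇒≈ (cong (λ t → (P * P - ι 2 * t * (ι 2 * t)) * - (P * P * (E * E))) (ι-suc i)))
        (mod-P³ (- (P * (E * E))) (-‿integral (*-integral P-integral (*-integral (e-integral′ i<h) (e-integral′ i<h))))
          (identity P D E (e-inverse i))))
        where
        iD′ : Integral (ι 2 * ι (suc i))
        iD′ = *-integral (ι-integral 2) (ι-integral (suc i))
        identity : ∀ P D E → D * E ≡ 1# → (P * P - D * D) * - (P * P * (E * E)) ≡ P * P + P * P * P * (- (P * (E * E)))
        identity P D E DE = lin₁ (P * P * (D * E + 1#)) DE (solve 3 (λ P D E → let C = P :* P :* (D :* E :+ κ 1) in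
          (P :* P :- D :* D) :* (:- (P :* P :* (E :* E))) :+ C :* κ 1
            := P :* P :+ P :* P :* P :* (:- (P :* (E :* E))) :+ C :* (D :* E)) refl P D E)

    -- An invariant that bridges two regimes: `Q 0` is a unit congruent to 1, whereas `Q i` for
    -- `i > 0` is `-P²/(2i)²` modulo P³. The multiple of `Q i` required by `Q-step` is the same in
    -- both.
    scaled≈ : ∀ i → i ℕ.≤ h → (P * P - ι 2 * ι i * (ι 2 * ι i)) * Q i ≈ P * P mod^ 3
    scaled≈ zero _ = ≈-trans (≡⇒≈ (solve 2 (λ P q → (P :* P :- κ 2 :* κ 0 :* (κ 2 :* κ 0)) :* q := P :* P :* q) refl P (Q 0)))
      (≈-trans (≈-P²* Q₀≈1) (≡⇒≈ (*-identityʳ _)))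
      where
      z : Carrier
      z = ι 2 * ι 0 - P
      z≡ : z ≡ - 1# * P
      z≡ = solve 1 (λ P → κ 2 :* κ 0 :- P := (:- κ 1) :* P) refl P
      Q₀≈1 : Q 0 ≈ 1# mod^ 1
      Q₀≈1 = ≈-trans (weaken (weaken (π-≈ (-‿integral 1-integral) z≡ (dbl h) ℕₚ.≤-refl)))
        (mod-P (- (P * Gs (dbl h))) (-‿integral (*-integral P-integral (Gs-integral (dbl h) ℕₚ.≤-refl)))
          (solve 2 (λ P G → κ 1 :- (κ 2 :* κ 0 :- P) :* (κ 2 :* κ 0 :- P) :* G := κ 1 :+ P :* (:- (P :* G))) refl P (Gs (dbl h))))
    scaled≈ (suc i) i<h = Step.Q-suc-scaled≈ i r eq (Step.Q-suc≈ i r eq (scaled≈ i (ℕₚ.<⇒≤ i<h)))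
      where
      r : ℕ
      r = h ℕ.∸ suc i
      eq : suc (i ℕ.+ r) ≡ h
      eq = ℕₚ.m+[n∸m]≡n i<h

    Q≈ : ∀ i → i ℕ.< h → Q (suc i) ≈ - (P * P * (e (suc i) * e (suc i))) mod^ 3
    Q≈ i i<h = Step.Q-suc≈ i (h ℕ.∸ suc i) (ℕₚ.m+[n∸m]≡n i<h) (scaled≈ i (ℕₚ.<⇒≤ i<h))

    -- By `w-π` at `z = - P` the terms after the first are `P/(2j) - P²/(2j)²` modulo P³. Their sum
    -- vanishes, since the harmonic sum is zero modulo P² and `Gs (dbl h)` modulo `P`.
    S₀≈1 : S 0 ≈ 1# mod^ 3
    S₀≈1 = ≈-trans (≡⇒≈ (trans (∑-cong′ p (λ k → cong (w k) (solve 1 (λ P → κ 2 :* κ 0 :+ κ 1 :- P := :- P :+ κ 1) refl P)))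
        (∑-head (dbl h) (λ k → w k (- P + 1#)))))
      (≈-trans (≈-+ ≈-refl (≈-∑ (dbl h) term))
      (≈-trans (≡⇒≈ (cong (1# +_) (linear (dbl h))))
      (≈-trans (≈-+ ≈-refl (≈-- (≈-P* e-sum≈0) (≈-P²* Gs-2h≈0)))
        (≡⇒≈ (solve 1 (λ P → κ 1 :+ (P :* κ 0 :- P :* P :* κ 0) := κ 1) refl P)))))
      where
      linear : ∀ n → ∑ n (λ k → P * e (suc k) - P * P * (e (suc k) * e (suc k))) ≡ P * ∑ n (λ k → e (suc k)) - P * P * Gs n
      linear zero    = solve 1 (λ P → κ 0 := P :* κ 0 :- P :* P :* κ 0) refl P
      linear (suc n) = trans (cong (_+ (P * e (suc n) - P * P * (e (suc n) * e (suc n)))) (linear n))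
        (solve 4 (λ P x g E → P :* x :- P :* P :* g :+ (P :* E :- P :* P :* (E :* E)) := P :* (x :+ E) :- P :* P :* (g :+ E :* E))
          refl P (∑ n (λ k → e (suc k))) (Gs n) (e (suc n)))
      term : ∀ k → k ℕ.< dbl h → w (suc k) (- P + 1#) ≈ P * e (suc k) - P * P * (e (suc k) * e (suc k)) mod^ 3
      term k k<2h = expand (π-≈ (-‿integral 1-integral) (solve 1 (λ P → :- P := (:- κ 1) :* P) refl P) k (ℕₚ.<⇒≤ k<2h))
        where
        D E : Carrier
        D = ι 2 * (ι k + 1#)
        E = e (suc k)
        iE : Integral E
        iE = e-integral k<2h
        iD : Integral D
        iD = *-integral (ι-integral 2) (+-integral (ι-integral k) 1-integral)
        identity : ∀ P D E w π G r → D * E ≡ 1# → D * D * w ≡ - - P * (D + - P) * π → π ≡ 1# - - P * - P * G + P ^ 3 * r →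
          w ≡ P * E - P * P * (E * E) + P * P * P * ((D - P) * (E * E) * (P * r - G))
        identity P D E w _ G r DE h refl = lin₂ (P * E - w * (D * E + 1#)) DE (E * E) h
          (solve 6 (λ P D E w G r → let X = κ 1 :- (:- P) :* (:- P) :* G :+ P :* (P :* (P :* κ 1)) :* r; C = P :* E :- w :* (D :* E :+ κ 1) in
             w :+ C :* κ 1 :+ E :* E :* ((:- (:- P)) :* (D :+ (:- P)) :* X)
          := P :* E :- P :* P :* (E :* E) :+ P :* P :* P :* ((D :- P) :* (E :* E) :* (P :* r :- G)) :+ C :* (D :* E)
               :+ E :* E :* (D :* D :* w)) refl P D E w G r)
        expand : π k (- P) ≈ 1# - - P * - P * Gs k mod^ 3 → w (suc k) (- P + 1#) ≈ P * E - P * P * (E * E) mod^ 3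
        expand (quot {r} ir eq) = mod-P³ ((D - P) * (E * E) * (P * r - Gs k))
          (*-integral (*-integral (+-integral iD (-‿integral P-integral)) (*-integral iE iE))
            (+-integral (*-integral P-integral ir) (-‿integral (Gs-integral k (ℕₚ.<⇒≤ k<2h)))))
          (identity P D E (w (suc k) (- P + 1#)) (π k (- P)) (Gs k) r (e-inverse k) (w-π k (- P)) eq)

    S≈ : ∀ n → n ℕ.≤ h → S n ≈ sgn n * (1# - ι 2 * (P * P) * Ās n) mod^ 3
    S≈ zero    _   = ≈-trans S₀≈1 (≡⇒≈ (solve 1 (λ x → κ 1 := κ 1 :* (κ 1 :- κ 2 :* x :* κ 0)) refl (P * P)))
    S≈ (suc n) n<h = ≈-trans (≡⇒≈ (S-step n))
      (≈-trans (≈-- (≈-*ˡ (ι-integral 2) (Q≈ n n<h)) (S≈ n (ℕₚ.<⇒≤ n<h)))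
        (≡⇒≈ (lin₁ (ι 2 * (P * P) * (e (suc n) * e (suc n))) (sgn² n)
          (solve 4 (λ Q E² σ A → κ 2 :* (:- (Q :* E²)) :- σ :* (κ 1 :- κ 2 :* Q :* A) :+ κ 2 :* Q :* E² :* κ 1
            := (:- σ) :* (κ 1 :- κ 2 :* Q :* (A :+ (:- σ) :* E²)) :+ κ 2 :* Q :* E² :* (σ :* σ)) refl
            (P * P) (e (suc n) * e (suc n)) (sgn n) (Ās n)))))

    ∑b-all≈ : ∑ p b ≈ σ - P * P * Y mod^ 3
    ∑b-all≈ = ≈-trans (≡⇒≈ (∑-cong′ p (λ k → trans (b-w k) (cong (w k) (sym (trans (cong (λ t → odd h - t) P≡) (-‿inverseʳ (odd h))))))))
      (≈-trans (S≈ h ℕₚ.≤-refl) (≡⇒≈ (solve 3 (λ σ Q A → σ :* (κ 1 :- κ 2 :* Q :* A) := σ :- Q :* (κ 2 :* (σ :* A))) refl σ (P * P) (Ās h))))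

    -- Past the index `h` the numerator contains `odd h = P`, while the denominators stay prime to
    -- `p`.
    a-tail≈0 : ∀ i → suc (h ℕ.+ i) ℕ.≤ dbl h → a (suc (h ℕ.+ i)) ≈ 0# mod^ 1
    a-tail≈0 zero h<2h rewrite ℕₚ.+-identityʳ h = mod-P (a h * e (suc h)) (*-integral (a-integral h h≤2h) (e-integral h<2h))
      (trans (cong (λ t → a h * t * e (suc h)) (sym P≡)) (solve 3 (λ A P E → A :* P :* E := κ 0 :+ P :* (A :* E)) refl (a h) P (e (suc h))))
    a-tail≈0 (suc i) h+i<2h rewrite ℕₚ.+-suc h i = ≈-trans (≈-*ʳ (e-integral h+i<2h) (≈-*ʳ (odd-integral (suc (h ℕ.+ i))) (a-tail≈0 i (ℕₚ.<⇒≤ h+i<2h))))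
      (≡⇒≈ (solve 2 (λ x y → κ 0 :* x :* y := κ 0) refl _ _))

    ∑-split : ∀ m n (f : ℕ → Carrier) → ∑ (m ℕ.+ n) f ≡ ∑ m f + ∑ n (λ i → f (m ℕ.+ i))
    ∑-split m zero    f = trans (cong (λ t → ∑ t f) (ℕₚ.+-identityʳ m)) (sym (+-identityʳ _))
    ∑-split m (suc n) f = trans (cong (λ t → ∑ t f) (ℕₚ.+-suc m n))
      (trans (cong (_+ f (m ℕ.+ n)) (∑-split m n f)) (+-assoc _ _ _))

    ∑bG-all≈ : ∑ p (λ k → b k * Gs k) ≈ - Y mod^ 1
    ∑bG-all≈ = ≈-trans (≡⇒≈ (trans (cong (λ t → ∑ t (λ k → b k * Gs k)) p≡) (∑-split (suc h) h _)))
      (≈-trans (≈-+ W≈-Y (≈-trans (≈-∑ h {g = λ _ → 0#} tail) (≡⇒≈ (∑-0 h (λ _ _ → refl))))) (≡⇒≈ (+-identityʳ _)))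
      where
      p≡ : p ≡ suc h ℕ.+ h
      p≡ = cong suc (trans (dbl≡2* h) (cong (h ℕ.+_) (ℕₚ.+-identityʳ h)))
      tail : ∀ i → i ℕ.< h → b (suc (h ℕ.+ i)) * Gs (suc (h ℕ.+ i)) ≈ 0# mod^ 1
      tail i i<h = ≈-trans (≈-*ʳ (Gs-integral _ ≤2h) (≈-*ʳ (a-integral _ ≤2h) (a-tail≈0 i ≤2h)))
        (≡⇒≈ (solve 2 (λ x y → κ 0 :* x :* y := κ 0) refl _ _))
        where
        ≤2h : suc (h ℕ.+ i) ℕ.≤ dbl h
        ≤2h = subst (suc (h ℕ.+ i) ℕ.≤_) (sym (ℕₚ.suc-injective p≡)) (ℕₚ.+-monoʳ-< h i<h)

    -- The constant 3 is `4 - 1`: the argument `2P` weights `∑ b k * Gs k`, congruent to `- Y`, by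
    -- `-4P²`, and `∑ p b` itself contributes `-P² Y`.
    ∑bπ≈ : ∑ p (λ k → b k * π k (ι 2 * P)) ≈ σ + P * P * (ι 3 * Y) mod^ 3
    ∑bπ≈ = ≈-trans (≈-∑ p λ { k (s≤s k≤2h) → ≈-*ˡ (b-integral k k≤2h) (π-≈ (ι-integral 2) refl k k≤2h) })
      (≈-trans (≡⇒≈ (linear p)) (≈-trans (≈-- ∑b-all≈ (≈-P²* (≈-*ˡ (ι-integral 4) ∑bG-all≈)))
        (≡⇒≈ (solve 3 (λ σ Q Y → σ :- Q :* Y :- Q :* (κ 4 :* (:- Y)) := σ :+ Q :* (κ 3 :* Y)) refl σ (P * P) Y))))
      where
      linear : ∀ n → ∑ n (λ k → b k * (1# - ι 2 * P * (ι 2 * P) * Gs k)) ≡ ∑ n b - P * P * (ι 4 * ∑ n (λ k → b k * Gs k))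
      linear zero    = solve 1 (λ P → κ 0 := κ 0 :- P :* P :* (κ 4 :* κ 0)) refl P
      linear (suc n) = trans (cong (_+ b n * (1# - ι 2 * P * (ι 2 * P) * Gs n)) (linear n))
        (solve 5 (λ x y b g P → x :- P :* P :* (κ 4 :* y) :+ b :* (κ 1 :- κ 2 :* P :* (κ 2 :* P) :* g)
           := x :+ b :- P :* P :* (κ 4 :* (y :+ b :* g))) refl (∑ n b) (∑ n (λ k → b k * Gs k)) (b n) (Gs n) P)

  alternating-sum-mod : ∑ p (λ n → odd n * sgn n * s n) ≈ P * (σ + P * P * (ι 3 * Y)) mod^ 4
  alternating-sum-mod = ≈-trans (≡⇒≈ (trans (alternating-sum (dbl h))
      (trans (cong (λ t → t * P * ∑ p (λ k → b k * π k (ι 2 * P))) (sgn-dbl h))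
        (cong (_* ∑ p (λ k → b k * π k (ι 2 * P))) (*-identityˡ P)))))
    (≈-P* ∑bπ≈)

-- Binomial theorem and the alternating power sums behind the Euler numbers

nC0≡1 : ∀ n → n choose 0 ≡ 1
nC0≡1 zero    = refl
nC0≡1 (suc n) = refl

module Binomial (R : ℚ-Algebra) where

  open ℚ-Algebra R
  open HarmonicSums R

  pascal : ∀ n k → ι (suc n choose suc k) ≡ ι (n choose k) + ι (n choose suc k)
  pascal n k = trans (cong ι (sym (nCk+nC[k+1]≡[n+1]C[k+1] n k))) (ι-+ (n choose k) (n choose suc k))

  absorption : ∀ n k → ι (suc n choose suc k) * (ι k + 1#) ≡ (ι n + 1#) * ι (n choose k)
  absorption zero zero    = *-comm 1# (ι 0 + 1#)
  absorption zero (suc k) = trans (cong (λ t → ι t * (ι (suc k) + 1#)) (k>n⇒nCk≡0 {1} {suc (suc k)} (s≤s (s≤s z≤n))))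
    (trans (zeroˡ _) (sym (trans (cong (λ t → (ι 0 + 1#) * ι t) (k>n⇒nCk≡0 {0} {suc k} (s≤s z≤n))) (zeroʳ _))))
  absorption (suc n) zero = begin
    ι (suc (suc n) choose 1) * (ι 0 + 1#)
      ≡⟨ cong (_* (ι 0 + 1#)) (pascal (suc n) 0) ⟩
    (ι (suc n choose 0) + ι (suc n choose 1)) * (ι 0 + 1#)
      ≡⟨ distribʳ _ _ _ ⟩
    ι (suc n choose 0) * (ι 0 + 1#) + ι (suc n choose 1) * (ι 0 + 1#)
      ≡⟨ cong₂ _+_ (cong (λ t → ι t * (ι 0 + 1#)) (nC0≡1 (suc n))) (trans (absorption n 0) (cong (λ t → (ι n + 1#) * ι t) (nC0≡1 n))) ⟩
    1# * (ι 0 + 1#) + (ι n + 1#) * 1#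
      ≡⟨ solve 1 (λ N → κ 1 :* (κ 0 :+ κ 1) :+ (N :+ κ 1) :* κ 1 := (N :+ κ 1 :+ κ 1) :* κ 1) refl (ι n) ⟩
    (ι n + 1# + 1#) * 1#
      ≡⟨ cong₂ (λ s t → (s + 1#) * ι t) (sym (ι-suc n)) (sym (nC0≡1 (suc n))) ⟩
    (ι (suc n) + 1#) * ι (suc n choose 0) ∎
    where open ≡-Reasoning
  absorption (suc n) (suc k) = trans
    (cong₂ (λ s t → s * (t + 1#)) (pascal (suc n) (suc k)) (ι-suc k))
    (trans (identity (ι n) (ι k) (ι (n choose k)) (ι (n choose suc k)) (ι (suc n choose suc k)) (ι (suc n choose suc (suc k))) (pascal n k) (absorption n k)
      (trans (cong (λ t → ι (suc n choose suc (suc k)) * (t + 1#)) (sym (ι-suc k))) (absorption n (suc k))))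
      (cong (λ t → (t + 1#) * ι (suc n choose suc k)) (sym (ι-suc n))))
    where
    identity : ∀ N K x y X Z → X ≡ x + y → X * (K + 1#) ≡ (N + 1#) * x → Z * (K + 1# + 1#) ≡ (N + 1#) * y →
      (X + Z) * (K + 1# + 1#) ≡ (N + 1# + 1#) * X
    identity N K x y X Z h₁ h₂ h₃ = lin₃ (- (N + 1#)) h₁ 1# h₂ 1# h₃
      (solve 6 (λ N K x y X Z → (X :+ Z) :* (K :+ κ 1 :+ κ 1) :+ (:- (N :+ κ 1)) :* (x :+ y) :+ κ 1 :* ((N :+ κ 1) :* x)
          :+ κ 1 :* ((N :+ κ 1) :* y)
        := (N :+ κ 1 :+ κ 1) :* X :+ (:- (N :+ κ 1)) :* X :+ κ 1 :* (X :* (K :+ κ 1)) :+ κ 1 :* (Z :* (K :+ κ 1 :+ κ 1)))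
        refl N K x y X Z)

  binomial : ∀ n x y → ∑ (suc n) (λ k → ι (n choose k) * (y ^ k * x ^ (n ℕ.∸ k))) ≡ (x + y) ^ n
  binomial zero    x y = solve 0 (κ 0 :+ κ 1 :* (κ 1 :* κ 1) := κ 1) refl
  binomial (suc n) x y = begin
    ∑ (suc (suc n)) (λ k → ι (suc n choose k) * (y ^ k * x ^ (suc n ℕ.∸ k)))
      ≡⟨ ∑-head (suc n) _ ⟩
    ι (suc n choose 0) * (1# * x ^ suc n) + ∑ (suc n) (λ k → ι (suc n choose suc k) * (y ^ suc k * x ^ (n ℕ.∸ k)))
      ≡⟨ cong₂ _+_ (cong (λ t → ι t * (1# * x ^ suc n)) (trans (nC0≡1 (suc n)) (sym (nC0≡1 n))))
           (trans (∑-cong′ (suc n) split) (∑-+ (suc n) _ _)) ⟩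
    ι (n choose 0) * (1# * x ^ suc n) + (∑ (suc n) (λ k → y * f k) + ∑ (suc n) (λ k → ι (n choose suc k) * (y ^ suc k * x ^ (n ℕ.∸ k))))
      ≡⟨ solve 3 (λ a b c → a :+ (b :+ c) := b :+ (a :+ c)) refl _ _ _ ⟩
    ∑ (suc n) (λ k → y * f k) + (ι (n choose 0) * (1# * x ^ suc n) + ∑ (suc n) (λ k → ι (n choose suc k) * (y ^ suc k * x ^ (n ℕ.∸ k))))
      ≡⟨ cong₂ _+_ (∑-* (suc n) y f) (sym (∑-head (suc n) (λ k → ι (n choose k) * (y ^ k * x ^ (suc n ℕ.∸ k))))) ⟩
    y * ∑ (suc n) f + (∑ (suc n) (λ k → ι (n choose k) * (y ^ k * x ^ (suc n ℕ.∸ k))) + ι (n choose suc n) * (y ^ suc n * x ^ (n ℕ.∸ n)))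
      ≡⟨ cong₂ (λ s t → y * ∑ (suc n) f + (s + ι t * (y ^ suc n * x ^ (n ℕ.∸ n))))
           (trans (∑-cong (suc n) shift) (∑-* (suc n) x f)) (k>n⇒nCk≡0 {n} {suc n} (ℕₚ.n<1+n n)) ⟩
    y * ∑ (suc n) f + (x * ∑ (suc n) f + 0# * (y ^ suc n * x ^ (n ℕ.∸ n)))
      ≡⟨ solve 4 (λ x y s t → y :* s :+ (x :* s :+ κ 0 :* t) := (x :+ y) :* s) refl x y (∑ (suc n) f) _ ⟩
    (x + y) * ∑ (suc n) f
      ≡⟨ cong ((x + y) *_) (binomial n x y) ⟩
    (x + y) ^ suc n ∎
    where
    open ≡-Reasoning
    f : ℕ → Carrier
    f k = ι (n choose k) * (y ^ k * x ^ (n ℕ.∸ k))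
    split : ∀ k → ι (suc n choose suc k) * (y ^ suc k * x ^ (n ℕ.∸ k)) ≡ y * f k + ι (n choose suc k) * (y ^ suc k * x ^ (n ℕ.∸ k))
    split k = trans (cong (_* (y ^ suc k * x ^ (n ℕ.∸ k))) (pascal n k))
      (solve 5 (λ a b y s t → (a :+ b) :* (y :* s :* t) := y :* (a :* (s :* t)) :+ b :* (y :* s :* t)) refl
        (ι (n choose k)) (ι (n choose suc k)) y (y ^ k) (x ^ (n ℕ.∸ k)))
    shift : ∀ k → k ℕ.< suc n → ι (n choose k) * (y ^ k * x ^ (suc n ℕ.∸ k)) ≡ x * f k
    shift k (s≤s k≤n) = trans (cong (λ t → ι (n choose k) * (y ^ k * x ^ t)) (ℕₚ.+-∸-assoc 1 k≤n))
      (solve 4 (λ c y x t → c :* (y :* (x :* t)) := x :* (c :* (y :* t))) refl (ι (n choose k)) (y ^ k) x (x ^ (n ℕ.∸ k)))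

  1^ : ∀ n → 1# ^ n ≡ 1#
  1^ zero    = refl
  1^ (suc n) = trans (*-identityˡ _) (1^ n)

  -1^ : ∀ n → (- 1#) ^ n ≡ sgn n
  -1^ zero    = refl
  -1^ (suc n) = trans (cong (- 1# *_) (-1^ n)) (solve 1 (λ s → (:- κ 1) :* s := :- s) refl (sgn n))

  ^-neg-dbl : ∀ x n → (- x) ^ dbl n ≡ x ^ dbl n
  ^-neg-dbl x zero    = refl
  ^-neg-dbl x (suc n) = trans (cong (λ t → - x * (- x * t)) (^-neg-dbl x n))
    (solve 2 (λ x t → (:- x) :* ((:- x) :* t) := x :* (x :* t)) refl x (x ^ dbl n))

  ev : ℕ → Carrier
  ev zero          = 1#
  ev (suc zero)    = 0#
  ev (suc (suc k)) = ev k

  2ev : ∀ k → ι 2 * ev k ≡ 1# + sgn k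
  2ev zero          = solve 0 (κ 2 :* κ 1 := κ 1 :+ κ 1) refl
  2ev (suc zero)    = solve 0 (κ 2 :* κ 0 := κ 1 :+ :- κ 1) refl
  2ev (suc (suc k)) = trans (2ev k) (solve 1 (λ s → κ 1 :+ s := κ 1 :+ :- (:- s)) refl (sgn k))

  Φ : ℕ → Carrier → Carrier
  Φ n x = ∑ (suc n) (λ k → ev k * ι (n choose k) * x ^ (n ℕ.∸ k))

  2Φ : ∀ n x → ι 2 * Φ n x ≡ (x + 1#) ^ n + (x - 1#) ^ n
  2Φ n x = trans (sym (∑-* (suc n) (ι 2) _)) (trans (∑-cong′ (suc n) term)
    (trans (∑-+ (suc n) _ _) (cong₂ _+_ (binomial n x 1#) (binomial n x (- 1#)))))
    where
    term : ∀ k → ι 2 * (ev k * ι (n choose k) * x ^ (n ℕ.∸ k))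
      ≡ ι (n choose k) * (1# ^ k * x ^ (n ℕ.∸ k)) + ι (n choose k) * ((- 1#) ^ k * x ^ (n ℕ.∸ k))
    term k = trans (solve 4 (λ t v c x → t :* (v :* c :* x) := (t :* v) :* (c :* x)) refl (ι 2) (ev k) (ι (n choose k)) (x ^ (n ℕ.∸ k)))
      (trans (cong (_* (ι (n choose k) * x ^ (n ℕ.∸ k))) (2ev k))
      (trans (solve 3 (λ s c x → (κ 1 :+ s) :* (c :* x) := c :* (κ 1 :* x) :+ c :* (s :* x)) refl (sgn k) (ι (n choose k)) (x ^ (n ℕ.∸ k)))
        (cong₂ (λ u v → ι (n choose k) * (u * x ^ (n ℕ.∸ k)) + ι (n choose k) * (v * x ^ (n ℕ.∸ k))) (sym (1^ k)) (sym (-1^ k)))))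

  -- Modulo 2m+1 these power sums satisfy the recurrence of the Euler numbers.
  F : ℕ → ℕ → Carrier
  F m n = sgn m * (0# ^ n + ∑ m (λ j → sgn (suc j) * ((ι 2 * ι (suc j)) ^ n + (- (ι 2 * ι (suc j))) ^ n)))

  F-0 : ∀ m → F m 0 ≡ 1#
  F-0 m = trans (cong (sgn m *_) (inner m)) (sgn² m)
    where
    inner : ∀ m → 1# + ∑ m (λ j → sgn (suc j) * (1# + 1#)) ≡ sgn m
    inner zero    = +-identityʳ 1#
    inner (suc m) = trans (sym (+-assoc _ _ _)) (trans (cong (_+ - sgn m * (1# + 1#)) (inner m))
      (solve 1 (λ s → s :+ (:- s) :* (κ 1 :+ κ 1) := :- s) refl (sgn m)))

  private
    g : ℕ → ℕ → Carrier
    g n j = odd j ^ n + (- odd j) ^ n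

  -- Doubled, the Euler recurrence turns `xⁿ` into `(x+1)ⁿ + (x-1)ⁿ`. Over the even `x` from `-2m`
  -- to `2m` with alternating signs, adjacent terms cancel at the odd number between them; only the
  -- ends `2m+1` and `-(2m+1)` survive, and for `m = h` these are divisible by `P` when `n > 0`.
  F-recurrence : ∀ m n → ι 2 * ∑ (suc n) (λ k → ev k * ι (n choose k) * F m (n ℕ.∸ k)) ≡ odd m ^ n + (- odd m) ^ n
  F-recurrence m n = begin
    ι 2 * ∑ (suc n) (λ k → ev k * ι (n choose k) * F m (n ℕ.∸ k))
      ≡⟨ cong (ι 2 *_) (expand m) ⟩
    ι 2 * (sgn m * (Φ n 0# + ∑ m (λ j → sgn (suc j) * (Φ n (x j) + Φ n (- x j)))))
      ≡⟨ solve 3 (λ s a b → κ 2 :* (s :* (a :+ b)) := s :* (κ 2 :* a :+ κ 2 :* b)) refl (sgn m) (Φ n 0#) _ ⟩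
    sgn m * (ι 2 * Φ n 0# + ι 2 * ∑ m (λ j → sgn (suc j) * (Φ n (x j) + Φ n (- x j))))
      ≡⟨ cong (sgn m *_) (cong₂ _+_ 2Φ0 (sym (∑-* m (ι 2) _))) ⟩
    sgn m * (g n 0 + ∑ m (λ j → ι 2 * (sgn (suc j) * (Φ n (x j) + Φ n (- x j)))))
      ≡⟨ cong (λ t → sgn m * (g n 0 + t)) (trans (∑-cong′ m term) (∑-telescope m (λ j → sgn j * g n j))) ⟩
    sgn m * (g n 0 + (sgn m * g n m - 1# * g n 0))
      ≡⟨ lin₁ (g n m) (sgn² m) (solve 3 (λ s a b → s :* (a :+ (s :* b :- κ 1 :* a)) :+ b :* κ 1 := b :+ b :* (s :* s)) refl (sgn m) (g n 0) (g n m)) ⟩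
    g n m ∎
    where
    open ≡-Reasoning
    x : ℕ → Carrier
    x j = ι 2 * ι (suc j)
    c : ℕ → Carrier
    c k = ev k * ι (n choose k)
    2Φ0 : ι 2 * Φ n 0# ≡ g n 0
    2Φ0 = trans (2Φ n 0#) (cong₂ (λ s t → s ^ n + t ^ n)
      (solve 0 (κ 0 :+ κ 1 := κ 2 :* κ 0 :+ κ 1) refl) (solve 0 (κ 0 :- κ 1 := :- (κ 2 :* κ 0 :+ κ 1)) refl))
    inner : ∀ m → ∑ (suc n) (λ k → c k * ∑ m (λ j → sgn (suc j) * (x j ^ (n ℕ.∸ k) + (- x j) ^ (n ℕ.∸ k))))
      ≡ ∑ m (λ j → sgn (suc j) * (Φ n (x j) + Φ n (- x j)))
    inner m = trans (∑-cong′ (suc n) (λ k → sym (∑-* m (c k) _))) (trans (∑-swap (suc n) m _)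
      (∑-cong′ m (λ j → trans (∑-cong′ (suc n) (λ k → solve 4 (λ c s u v → c :* (s :* (u :+ v)) := s :* (c :* u :+ c :* v)) refl
          (c k) (sgn (suc j)) (x j ^ (n ℕ.∸ k)) ((- x j) ^ (n ℕ.∸ k))))
        (trans (∑-* (suc n) (sgn (suc j)) _) (cong (sgn (suc j) *_) (∑-+ (suc n) _ _))))))
    expand : ∀ m → ∑ (suc n) (λ k → c k * F m (n ℕ.∸ k))
      ≡ sgn m * (Φ n 0# + ∑ m (λ j → sgn (suc j) * (Φ n (x j) + Φ n (- x j))))
    expand m = trans (∑-cong′ (suc n) (λ k → solve 4 (λ c s u v → c :* (s :* (u :+ v)) := s :* (c :* u :+ c :* v)) refl
        (c k) (sgn m) (0# ^ (n ℕ.∸ k)) (∑ m (λ j → sgn (suc j) * (x j ^ (n ℕ.∸ k) + (- x j) ^ (n ℕ.∸ k))))))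
      (trans (∑-* (suc n) (sgn m) _) (cong (sgn m *_) (trans (∑-+ (suc n) _ _) (cong (Φ n 0# +_) (inner m)))))
    term : ∀ j → ι 2 * (sgn (suc j) * (Φ n (x j) + Φ n (- x j))) ≡ sgn (suc j) * g n (suc j) - sgn j * g n j
    term j = trans (solve 4 (λ t s u v → t :* (s :* (u :+ v)) := s :* (t :* u :+ t :* v)) refl (ι 2) (sgn (suc j)) (Φ n (x j)) (Φ n (- x j)))
      (trans (cong₂ (λ u v → sgn (suc j) * (u + v)) (2Φ n (x j)) (2Φ n (- x j)))
      (trans (cong₂ (λ u v → sgn (suc j) * (odd (suc j) ^ n + u + v)) (cong (_^ n) x-1)
          (cong₂ (λ u v → u ^ n + v ^ n) (trans (solve 1 (λ y → :- y :+ κ 1 := :- (y :- κ 1)) refl (x j)) (cong (λ t → - t) x-1))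
            (solve 1 (λ y → :- y :- κ 1 := :- (y :+ κ 1)) refl (x j))))
        (solve 5 (λ s a b c d → (:- s) :* (a :+ b :+ (c :+ d)) := (:- s) :* (a :+ d) :- s :* (b :+ c)) refl
          (sgn j) (odd (suc j) ^ n) (odd j ^ n) ((- odd j) ^ n) ((- odd (suc j)) ^ n))))
      where
      x-1 : x j - 1# ≡ odd j
      x-1 = trans (cong (λ t → ι 2 * t - 1#) (ι-suc j)) (solve 1 (λ J → κ 2 :* (J :+ κ 1) :- κ 1 := κ 2 :* J :+ κ 1) refl (ι j))

-- Euler numbers modulo `p` and the two congruences

module EulerCongruence (R : ℚ-Algebra) (h : ℕ) (L : LocalSubring R (suc (dbl h)))
  (p-prime : Prime (suc (dbl h))) (3<p : 3 ℕ.< suc (dbl h)) where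

  open ℚ-Algebra R
  open OddPrime R h L p-prime 3<p public
  open Binomial R

  ev-integral : ∀ k → Integral (ev k)
  ev-integral zero          = 1-integral
  ev-integral (suc zero)    = 0-integral
  ev-integral (suc (suc k)) = ev-integral k

  binomial≈0 : ∀ k → k ℕ.< dbl h → ι (p choose suc k) ≈ 0# mod^ 1
  binomial≈0 k k<2h = mod-P (ι (dbl h choose k) * (ι 2 * e (suc k))) (*-integral (ι-integral (dbl h choose k)) (*-integral (ι-integral 2) (e-integral k<2h)))
    (identity (ι k) (ι (dbl h choose k)) (ι (p choose suc k)) (e (suc k)) P (e-inverse k)
      (trans (absorption (dbl h) k) (cong (_* ι (dbl h choose k)) (sym (ι-suc (dbl h))))))
    where
    identity : ∀ K c C E P → ι 2 * (K + 1#) * E ≡ 1# → C * (K + 1#) ≡ P * c → C ≡ 0# + P * (c * (ι 2 * E))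
    identity K c C E P h₁ h₂ = lin₂ (- C) h₁ (ι 2 * E) h₂ (solve 5 (λ K c C E P →
        C :+ (:- C) :* κ 1 :+ κ 2 :* E :* (P :* c)
          := κ 0 :+ P :* (c :* (κ 2 :* E)) :+ (:- C) :* (κ 2 :* (K :+ κ 1) :* E) :+ κ 2 :* E :* (C :* (K :+ κ 1))) refl K c C E P)

  fermat : ∀ n → ι n ^ p ≈ ι n mod^ 1
  fermat zero    = ≡⇒≈ (zeroˡ _)
  fermat (suc n) = ≈-trans (≡⇒≈ (trans (cong (_^ p) (ι-suc n)) (sym (binomial p (ι n) 1#))))
    (≈-trans (≡⇒≈ (trans (cong (_+ f p) (∑-head (dbl h) f)) (cong₂ (λ s t → s + ∑ (dbl h) (λ k → f (suc k)) + t) first last)))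
    (≈-trans (≈-+ (≈-+ (fermat n) (≈-trans (≈-∑ (dbl h) {g = λ _ → 0#} middle) (≡⇒≈ (∑-0 (dbl h) (λ _ _ → refl))))) ≈-refl)
      (≡⇒≈ (trans (cong (_+ 1#) (+-identityʳ (ι n))) (sym (ι-suc n))))))
    where
    f : ℕ → Carrier
    f k = ι (p choose k) * (1# ^ k * ι n ^ (p ℕ.∸ k))
    first : f 0 ≡ ι n ^ p
    first = trans (*-identityˡ _) (*-identityˡ _)
    last : f p ≡ 1#
    last = trans (cong₂ (λ c t → ι c * (1# ^ p * ι n ^ t)) (nCn≡1 p) (ℕₚ.n∸n≡0 p))
      (trans (*-identityˡ _) (trans (*-identityʳ _) (1^ p)))
    middle : ∀ k → k ℕ.< dbl h → f (suc k) ≈ 0# mod^ 1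
    middle k k<2h = ≈-trans (≈-*ʳ (*-integral (^-integral (suc k) 1-integral) (^-integral (dbl h ℕ.∸ k) (ι-integral n))) (binomial≈0 k k<2h))
      (≡⇒≈ (zeroˡ _))

  module _ (Eu : ℕ → Carrier) (Eu-0 : Eu 0 ≡ 1#)
    (Eu-suc : ∀ n → Eu (suc n) ≡ - ∑ (suc n) (λ k → ev (suc k) * ι (suc n choose suc k) * Eu (n ℕ.∸ k))) where

    private
      F-suc≈ : ∀ n → F h (suc n) ≈ - ∑ (suc n) (λ k → ev (suc k) * ι (suc n choose suc k) * F h (n ℕ.∸ k)) mod^ 1
      F-suc≈ n = ≈-trans (≡⇒≈ (solve 2 (λ x y → x := κ 1 :* κ 1 :* x :+ y :- y) refl (F h (suc n)) rest))
        (≈-trans (≈-- (≈-trans (≡⇒≈ (sym (∑-head (suc n) (λ k → ev k * ι (suc n choose k) * F h (suc n ℕ.∸ k))))) ∑≈0) ≈-refl)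
          (≡⇒≈ (+-identityˡ _)))
        where
        rest : Carrier
        rest = ∑ (suc n) (λ k → ev (suc k) * ι (suc n choose suc k) * F h (n ℕ.∸ k))
        ∑≈0 : ∑ (suc (suc n)) (λ k → ev k * ι (suc n choose k) * F h (suc n ℕ.∸ k)) ≈ 0# mod^ 1
        ∑≈0 = ≈-cancel (inv-inverse 1) inv2-integral (≈-trans (≡⇒≈ (trans (F-recurrence h (suc n))
            (cong (λ t → t ^ suc n + (- t) ^ suc n) (sym P≡))))
          (mod-P (P ^ n - (- P) ^ n) (+-integral (^-integral n P-integral) (-‿integral (^-integral n (-‿integral P-integral))))
            (solve 3 (λ P x y → P :* x :+ (:- P) :* y := κ 2 :* κ 0 :+ P :* (x :- y)) refl P (P ^ n) ((- P) ^ n))))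

    Eu≈F : ∀ n m → m ℕ.≤ n → Eu m ≈ F h m mod^ 1
    Eu≈F n       zero    _         = ≡⇒≈ (trans Eu-0 (sym (F-0 h)))
    Eu≈F (suc n) (suc m) (s≤s m≤n) = ≈-trans (≡⇒≈ (Eu-suc m)) (≈-trans (≈-neg (≈-∑ (suc m) (λ k _ →
      ≈-*ˡ (*-integral (ev-integral (suc k)) (ι-integral (suc m choose suc k))) (Eu≈F n (m ℕ.∸ k) (ℕₚ.≤-trans (ℕₚ.m∸n≤m m k) m≤n)))))
      (≈-sym (F-suc≈ m)))

    -- For `h = g+2` the index `2g+2` is `p-3`. Fermat turns the power `p-3` of an even number prime
    -- to `p` into its inverse square, and the exponent is even, so opposite arguments contribute
    -- equally.
    Eu-[p-3]≈ : ∀ g → h ≡ suc (suc g) → Eu (dbl (suc g)) ≈ ι 2 * (sgn h * Ās h) mod^ 1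
    Eu-[p-3]≈ g h≡ = ≈-trans (Eu≈F (dbl (suc g)) (dbl (suc g)) ℕₚ.≤-refl)
      (≈-trans (≈-*ˡ (sgn-integral h) (≈-trans (≈-+ (≡⇒≈ (zeroˡ _)) (≈-∑ h term)) (≡⇒≈ (trans (+-identityˡ _) (∑-* h (ι 2) _)))))
        (≡⇒≈ (solve 3 (λ s t x → s :* (t :* x) := t :* (s :* x)) refl (sgn h) (ι 2) (Ās h))))
      where
      N : ℕ
      N = dbl (suc g)
      power : ∀ j → j ℕ.< h → (ι 2 * ι (suc j)) ^ N ≈ e (suc j) * e (suc j) mod^ 1
      power j j<h = ≈-trans (≡⇒≈ (lin₁ _ Dt≡1 (solve 3 (λ D t X → X :+ (:- (X :* (D :* t :* (D :* t) :+ D :* t :+ κ 1))) :* κ 1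
            := D :* (D :* (D :* X)) :* (t :* t :* t) :+ (:- (X :* (D :* t :* (D :* t) :+ D :* t :+ κ 1))) :* (D :* t)) refl D t (D ^ N))))
        (≈-trans (≈-*ʳ (*-integral (*-integral it it) it) D^p≈D)
          (≡⇒≈ (lin₁ (t * t) (Dt≡1) (solve 2 (λ D t → D :* (t :* t :* t) :+ t :* t :* κ 1 := t :* t :+ t :* t :* (D :* t)) refl D t))))
        where
        D t : Carrier
        D = ι 2 * ι (suc j)
        t = e (suc j)
        it : Integral t
        it = e-integral′ j<h
        Dt≡1 : D * t ≡ 1#
        Dt≡1 = trans (cong (λ x → ι 2 * x * t) (ι-suc j)) (e-inverse j)
        D^p≈D : D * (D * (D * D ^ N)) ≈ D mod^ 1
        D^p≈D = subst (λ x → D ^ suc (dbl x) ≈ D mod^ 1) h≡ (subst (λ x → x ^ p ≈ x mod^ 1) (ι-* 2 (suc j)) (fermat (2 ℕ.* suc j)))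
      term : ∀ j → j ℕ.< h → sgn (suc j) * ((ι 2 * ι (suc j)) ^ N + (- (ι 2 * ι (suc j))) ^ N)
        ≈ ι 2 * (sgn (suc j) * (e (suc j) * e (suc j))) mod^ 1
      term j j<h = ≈-trans (≡⇒≈ (trans (cong (λ x → sgn (suc j) * ((ι 2 * ι (suc j)) ^ N + x)) (^-neg-dbl (ι 2 * ι (suc j)) (suc g)))
          (solve 2 (λ s x → s :* (x :+ x) := κ 2 :* (s :* x)) refl (sgn (suc j)) ((ι 2 * ι (suc j)) ^ N))))
        (≈-*ˡ (ι-integral 2) (≈-*ˡ (sgn-integral (suc j)) (power j j<h)))

    private
      lift : ∀ c {X} → Eu (dbl h ℕ.∸ 2) ≈ X mod^ 1 → P * (sgn h + P * P * (ι c * X)) ≈ sgn h * P + ι c * P ^ 3 * Eu (dbl h ℕ.∸ 2) mod^ 4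
      lift c {X} eu = ≈-trans (≈-P* (≈-+ ≈-refl (≈-P²* (≈-*ˡ (ι-integral c) (≈-sym eu)))))
        (≡⇒≈ (solve 4 (λ P s c y → P :* (s :+ P :* P :* (c :* y)) := s :* P :+ c :* (P :* (P :* (P :* κ 1))) :* y) refl P (sgn h) (ι c) (Eu (dbl h ℕ.∸ 2))))

      Eu≈ : Eu (dbl h ℕ.∸ 2) ≈ ι 2 * (sgn h * Ās h) mod^ 1
      Eu≈ = go h refl
        where
        go : ∀ m → h ≡ m → Eu (dbl h ℕ.∸ 2) ≈ ι 2 * (sgn h * Ās h) mod^ 1
        go (suc (suc m)) h≡ = subst (λ x → Eu x ≈ ι 2 * (sgn h * Ās h) mod^ 1) (sym (cong (λ t → dbl t ℕ.∸ 2) h≡)) (Eu-[p-3]≈ m h≡)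
        go zero h≡ with s≤s () ← subst (λ t → 3 ℕ.< suc (dbl t)) h≡ 3<p
        go (suc zero) h≡ with s≤s (s≤s (s≤s ())) ← subst (λ t → 3 ℕ.< suc (dbl t)) h≡ 3<p

    congruence₁ : ∑ p (λ n → (ι n + 1#) * ι 2 ^ n * s n) ≈ sgn h * P + ι 5 * P ^ 3 * Eu (dbl h ℕ.∸ 2) mod^ 4
    congruence₁ = ≈-trans weighted-sum-mod (lift 5 Eu≈)

    congruence₂ : ∑ p (λ n → odd n * sgn n * s n) ≈ sgn h * P + ι 3 * P ^ 3 * Eu (dbl h ℕ.∸ 2) mod^ 4
    congruence₂ = ≈-trans alternating-sum-mod (lift 3 Eu≈)

-- From binomial coefficients and fractions to `a` and `s`

module Translation (R : ℚ-Algebra) where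

  open ℚ-Algebra R
  open HarmonicSums R
  open Binomial R

  ι-^ : ∀ m n → ι (m ℕ.^ n) ≡ ι m ^ n
  ι-^ m zero    = refl
  ι-^ m (suc n) = trans (ι-* m (m ℕ.^ n)) (cong (ι m *_) (ι-^ m n))

  ι-sumN : ∀ n f → ι (Defs.sumN n f) ≡ ∑ (suc n) (λ k → ι (f k))
  ι-sumN n f = trans (cong (λ l → ι (sum l)) (map-applyUpTo (λ k → k) f (suc n))) (go (suc n) f)
    where
    go : ∀ n f → ι (sum (applyUpTo f n)) ≡ ∑ n (λ k → ι (f k))
    go zero    f = refl
    go (suc n) f = trans (ι-+ (f 0) _) (trans (cong (ι (f 0) +_) (go n (λ k → f (suc k)))) (sym (∑-head n (λ k → ι (f k)))))

  -- Two absorptions lead from row `2k` to row `2k+2`; in between, the symmetry of row `2k+1`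
  -- exchanges its two middle entries.
  central-binomial : ∀ k → ι ((2 ℕ.* k) choose k) ≡ ι 4 ^ k * a k
  central-binomial k = trans (cong (λ m → ι (m choose k)) (sym (dbl≡2* k))) (go k)
    where
    identity : ∀ K C₀ M C₁ C₂ E x A → ι 2 * (K + 1#) * E ≡ 1# → M ≡ ι 2 * K → C₀ ≡ x * A →
      C₁ * (K + 1#) ≡ (M + 1#) * C₀ → C₂ * (K + 1#) ≡ (M + 1# + 1#) * C₁ →
      C₂ ≡ ι 4 * x * (A * (ι 2 * K + 1#) * E)
    identity K _ _ C₁ C₂ E x A h₁ refl refl h₂ h₃ = lin₃
      (ι 4 * x * A * (ι 2 * K + 1#) * E - C₂ * (ι 2 * (K + 1#) * E + 1#)) h₁
      (ι 4 * E * E * (ι 2 * K + ι 2)) h₂ (ι 4 * E * E * (K + 1#)) h₃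
      (solve 6 (λ K C₁ C₂ E x A →
         let O = κ 2 :* K :+ κ 1
             Y = κ 2 :* (K :+ κ 1) :* E
             c = κ 4 :* x :* A :* O :* E :- C₂ :* (Y :+ κ 1) in
         C₂ :+ c :* κ 1 :+ κ 4 :* E :* E :* (κ 2 :* K :+ κ 2) :* (O :* (x :* A))
           :+ κ 4 :* E :* E :* (K :+ κ 1) :* ((O :+ κ 1) :* C₁)
      := κ 4 :* x :* (A :* O :* E) :+ c :* Y :+ κ 4 :* E :* E :* (κ 2 :* K :+ κ 2) :* (C₁ :* (K :+ κ 1))
           :+ κ 4 :* E :* E :* (K :+ κ 1) :* (C₂ :* (K :+ κ 1))) refl K C₁ C₂ E x A)
    go : ∀ k → ι (dbl k choose k) ≡ ι 4 ^ k * a k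
    go zero    = sym (*-identityˡ 1#)
    go (suc k) = identity (ι k) (ι (dbl k choose k)) (ι (dbl k)) (ι (suc (dbl k) choose suc k)) (ι (suc (suc (dbl k)) choose suc k))
      (e (suc k)) (ι 4 ^ k) (a k) (e-inverse k) (ι-dbl k) (go k) (absorption (dbl k) k)
      (trans (absorption (suc (dbl k)) k) (cong₂ (λ u v → (u + 1#) * ι v) (ι-suc (dbl k)) middle))
      where
      2k≡k+k : dbl k ≡ k ℕ.+ k
      2k≡k+k = trans (dbl≡2* k) (cong (k ℕ.+_) (ℕₚ.+-identityʳ k))
      middle : suc (dbl k) choose k ≡ suc (dbl k) choose suc k
      middle = trans (nCk≡nC[n∸k] (ℕₚ.m≤n⇒m≤1+n (subst (k ℕ.≤_) (sym 2k≡k+k) (ℕₚ.m≤m+n k k))))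
        (cong (suc (dbl k) choose_) (trans (cong (λ t → suc t ℕ.∸ k) 2k≡k+k) (ℕₚ.m+n∸n≡m (suc k) k)))

  4^-+ : ∀ m n → ι 4 ^ (m ℕ.+ n) ≡ ι 4 ^ m * ι 4 ^ n
  4^-+ zero    n = sym (*-identityˡ _)
  4^-+ (suc m) n = trans (cong (ι 4 *_) (4^-+ m n)) (sym (*-assoc _ _ _))

  4^² : ∀ n → ι 4 ^ n * ι 4 ^ n ≡ ι 16 ^ n
  4^² zero    = *-identityˡ 1#
  4^² (suc n) = trans (solve 1 (λ x → κ 4 :* x :* (κ 4 :* x) := κ 16 :* (x :* x)) refl (ι 4 ^ n)) (cong (ι 16 *_) (4^² n))

  2^*8^ : ∀ n → ι 2 ^ n * ι 8 ^ n ≡ ι 16 ^ n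
  2^*8^ zero    = *-identityˡ 1#
  2^*8^ (suc n) = trans (solve 2 (λ x y → κ 2 :* x :* (κ 8 :* y) := κ 16 :* (x :* y)) refl (ι 2 ^ n) (ι 8 ^ n)) (cong (ι 16 *_) (2^*8^ n))

  ι-S : ∀ n → ι (Defs.S n) ≡ ι 16 ^ n * s n
  ι-S n = trans (ι-sumN n summand) (trans (∑-cong (suc n) (λ { k (s≤s k≤n) → term k k≤n })) (∑-* (suc n) (ι 16 ^ n) _))
    where
    summand : ℕ → ℕ
    summand k = ((2 ℕ.* k) choose k) ℕ.^ 2 ℕ.* (((2 ℕ.* n) ℕ.∸ (2 ℕ.* k)) choose (n ℕ.∸ k)) ℕ.^ 2
    term : ∀ k → k ℕ.≤ n → ι (summand k)
      ≡ ι 16 ^ n * (b k * b (n ℕ.∸ k))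
    term k k≤n = begin
      ι (summand k)
        ≡⟨ trans (ι-* (((2 ℕ.* k) choose k) ℕ.^ 2) _) (cong₂ _*_ (ι-^ ((2 ℕ.* k) choose k) 2) (ι-^ (((2 ℕ.* n) ℕ.∸ (2 ℕ.* k)) choose (n ℕ.∸ k)) 2)) ⟩
      ι ((2 ℕ.* k) choose k) ^ 2 * ι (((2 ℕ.* n) ℕ.∸ (2 ℕ.* k)) choose (n ℕ.∸ k)) ^ 2
        ≡⟨ cong₂ (λ u v → u ^ 2 * v ^ 2) (central-binomial k)
             (trans (cong (λ t → ι (t choose (n ℕ.∸ k))) (sym (ℕₚ.*-distribˡ-∸ 2 n k))) (central-binomial (n ℕ.∸ k))) ⟩
      (ι 4 ^ k * a k) ^ 2 * (ι 4 ^ (n ℕ.∸ k) * a (n ℕ.∸ k)) ^ 2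
        ≡⟨ solve 4 (λ x A y B → (x :* A) :* ((x :* A) :* κ 1) :* ((y :* B) :* ((y :* B) :* κ 1)) := (x :* y) :* (x :* y) :* (A :* A :* (B :* B))) refl
             (ι 4 ^ k) (a k) (ι 4 ^ (n ℕ.∸ k)) (a (n ℕ.∸ k)) ⟩
      ι 4 ^ k * ι 4 ^ (n ℕ.∸ k) * (ι 4 ^ k * ι 4 ^ (n ℕ.∸ k)) * (b k * b (n ℕ.∸ k))
        ≡⟨ cong (λ t → t * t * (b k * b (n ℕ.∸ k))) (trans (sym (4^-+ k (n ℕ.∸ k))) (cong (ι 4 ^_) (ℕₚ.m+[n∸m]≡n k≤n))) ⟩
      ι 4 ^ n * ι 4 ^ n * (b k * b (n ℕ.∸ k))
        ≡⟨ cong (_* (b k * b (n ℕ.∸ k))) (4^² n) ⟩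
      ι 16 ^ n * (b k * b (n ℕ.∸ k)) ∎
      where open ≡-Reasoning

  private
    ^-inverse : ∀ m n → ι (suc m) ^ n * inv (suc m) ^ n ≡ 1#
    ^-inverse m zero    = *-identityˡ 1#
    ^-inverse m (suc n) = trans (solve 4 (λ x y u v → x :* u :* (y :* v) := x :* y :* (u :* v)) refl (ι (suc m)) (inv (suc m)) (ι (suc m) ^ n) (inv (suc m) ^ n))
      (trans (cong₂ _*_ (inv-inverse m) (^-inverse m n)) (*-identityˡ 1#))

  -- The fraction is characterised by its cross-multiplied equation, so its normal form never
  -- enters.
  weighted-summand : ∀ n x → x * ι (8 ℕ.^ n) ≡ ι (suc n ℕ.* Defs.S n) → x ≡ (ι n + 1#) * ι 2 ^ n * s n
  weighted-summand n x eq = cancel (^-inverse 7 n) (begin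
    ι 8 ^ n * x                            ≡⟨ trans (*-comm _ _) (cong (x *_) (sym (ι-^ 8 n))) ⟩
    x * ι (8 ℕ.^ n)                        ≡⟨ eq ⟩
    ι (suc n ℕ.* Defs.S n)                 ≡⟨ trans (ι-* (suc n) (Defs.S n)) (cong₂ _*_ (ι-suc n) (ι-S n)) ⟩
    (ι n + 1#) * (ι 16 ^ n * s n)          ≡⟨ cong (λ t → (ι n + 1#) * (t * s n)) (sym (2^*8^ n)) ⟩
    (ι n + 1#) * (ι 2 ^ n * ι 8 ^ n * s n) ≡⟨ solve 4 (λ N x y s → (N :+ κ 1) :* (x :* y :* s) := y :* ((N :+ κ 1) :* x :* s)) refl
                                                (ι n) (ι 2 ^ n) (ι 8 ^ n) (s n) ⟩
    ι 8 ^ n * ((ι n + 1#) * ι 2 ^ n * s n) ∎)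
    where open ≡-Reasoning

  alternating-summand : ∀ n x → x * ι (16 ℕ.^ n) ≡ sgn n * ι (suc (2 ℕ.* n) ℕ.* Defs.S n) → x ≡ odd n * sgn n * s n
  alternating-summand n x eq = cancel (^-inverse 15 n) (begin
    ι 16 ^ n * x                             ≡⟨ trans (*-comm _ _) (cong (x *_) (sym (ι-^ 16 n))) ⟩
    x * ι (16 ℕ.^ n)                         ≡⟨ eq ⟩
    sgn n * ι (suc (2 ℕ.* n) ℕ.* Defs.S n)   ≡⟨ cong (sgn n *_) (trans (ι-* (suc (2 ℕ.* n)) (Defs.S n))
                                                  (cong₂ _*_ (trans (ι-suc (2 ℕ.* n)) (cong (_+ 1#) (ι-* 2 n))) (ι-S n))) ⟩
    sgn n * (odd n * (ι 16 ^ n * s n))       ≡⟨ solve 4 (λ σ o x s → σ :* (o :* (x :* s)) := x :* (o :* σ :* s)) refl (sgn n) (odd n) (ι 16 ^ n) (s n) ⟩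
    ι 16 ^ n * (odd n * sgn n * s n)         ∎)
    where open ≡-Reasoning

-- The rational numbers and the subring of `p`-integral ones

ℚ-ring : Ring≡
ℚ-ring = record
  { Carrier = ℚ ; _+_ = ℚ._+_ ; _*_ = ℚ._*_ ; -_ = ℚ.-_ ; 0# = 0ℚ ; 1# = 1ℚ
  ; isCommutativeRing = ℚₚ.+-*-isCommutativeRing }

fromℤ : ℤ → ℚ
fromℤ i = i ℚ./ 1

private
  fromℚᵘ-+ : ∀ x y → fromℚᵘ (x ℚᵘ.+ y) ≡ fromℚᵘ x ℚ.+ fromℚᵘ y
  fromℚᵘ-+ x y = ℚₚ.toℚᵘ-injective (ℚᵘₚ.≃-trans (ℚₚ.toℚᵘ-fromℚᵘ (x ℚᵘ.+ y))
    (ℚᵘₚ.≃-sym (ℚᵘₚ.≃-trans (ℚₚ.toℚᵘ-homo-+ (fromℚᵘ x) (fromℚᵘ y)) (ℚᵘₚ.+-cong (ℚₚ.toℚᵘ-fromℚᵘ x) (ℚₚ.toℚᵘ-fromℚᵘ y)))))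

  fromℚᵘ-* : ∀ x y → fromℚᵘ (x ℚᵘ.* y) ≡ fromℚᵘ x ℚ.* fromℚᵘ y
  fromℚᵘ-* x y = ℚₚ.toℚᵘ-injective (ℚᵘₚ.≃-trans (ℚₚ.toℚᵘ-fromℚᵘ (x ℚᵘ.* y))
    (ℚᵘₚ.≃-sym (ℚᵘₚ.≃-trans (ℚₚ.toℚᵘ-homo-* (fromℚᵘ x) (fromℚᵘ y)) (ℚᵘₚ.*-cong (ℚₚ.toℚᵘ-fromℚᵘ x) (ℚₚ.toℚᵘ-fromℚᵘ y)))))

fromℤ-+ : ∀ i j → fromℤ (i ℤ.+ j) ≡ fromℤ i ℚ.+ fromℤ j
fromℤ-+ i j = trans (ℚₚ.fromℚᵘ-cong {mkℚᵘ (i ℤ.+ j) 0} {mkℚᵘ i 0 ℚᵘ.+ mkℚᵘ j 0}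
    (*≡* (cong (ℤ._* pos 1) (sym (cong₂ ℤ._+_ (ℤₚ.*-identityʳ i) (ℤₚ.*-identityʳ j))))))
  (fromℚᵘ-+ (mkℚᵘ i 0) (mkℚᵘ j 0))

fromℤ-* : ∀ i j → fromℤ (i ℤ.* j) ≡ fromℤ i ℚ.* fromℤ j
fromℤ-* i j = fromℚᵘ-* (mkℚᵘ i 0) (mkℚᵘ j 0)

/-*-denominator : ∀ i n .{{_ : ℕ.NonZero n}} → (i ℚ./ n) ℚ.* fromℤ (pos n) ≡ fromℤ i
/-*-denominator i (suc d) = trans (sym (fromℚᵘ-* (mkℚᵘ i d) (mkℚᵘ (pos (suc d)) 0)))
  (ℚₚ.fromℚᵘ-cong {mkℚᵘ i d ℚᵘ.* mkℚᵘ (pos (suc d)) 0} {mkℚᵘ i 0}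
    (*≡* (trans (ℤₚ.*-identityʳ (i ℤ.* pos (suc d))) (cong (λ t → i ℤ.* pos t) (sym (ℕₚ.*-identityʳ (suc d)))))))

module ℚA = Arithmetic ℚ-ring

ι≡fromℤ : ∀ n → ℚA.ι n ≡ fromℤ (pos n)
ι≡fromℤ zero          = refl
ι≡fromℤ (suc zero)    = refl
ι≡fromℤ (suc (suc n)) = trans (cong (ℚ._+ 1ℚ) (ι≡fromℤ (suc n)))
  (trans (sym (fromℤ-+ (pos (suc n)) (pos 1))) (cong (λ t → fromℤ (pos (suc t))) (ℕₚ.+-comm n 1)))

ℚ-algebra : ℚ-Algebra
ℚ-algebra = record { ring = ℚ-ring ; inv = inverse ; inv-inverse = inverse-law }
  where
  inverse : ℕ → ℚ
  inverse zero    = 0ℚ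
  inverse (suc n) = pos 1 ℚ./ suc n
  inverse-law : ∀ n → ℚA.ι (suc n) ℚ.* inverse (suc n) ≡ 1ℚ
  inverse-law n = trans (cong (ℚ._* inverse (suc n)) (ι≡fromℤ (suc n)))
    (trans (ℚₚ.*-comm (fromℤ (pos (suc n))) (inverse (suc n))) (/-*-denominator (pos 1) (suc n)))

-- Normalisation divides by a gcd. Hence the denominators of sums and products divide the product of
-- the given ones, and Euclid's lemma yields closure of `p`-integrality.
↧ₙ-/-∣ : ∀ i n .{{_ : ℕ.NonZero n}} → ↧ₙ (i ℚ./ n) ∣ n
↧ₙ-/-∣ i n = divides ℤ.∣ gcd i (pos n) ∣ (trans (sym (cong ℤ.∣_∣ (ℚₚ.↧-/ i n)))
  (trans (ℤₚ.abs-* (ℚ.↧ (i ℚ./ n)) (gcd i (pos n))) (ℕₚ.*-comm (↧ₙ (i ℚ./ n)) _)))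

p-integers : ∀ p → Prime p → LocalSubring ℚ-algebra p
p-integers p p-prime = record
  { Integral     = Defs.pIntegral p
  ; 1-integral   = ∤1
  ; +-integral   = λ {x} {y} → sum-integral x y
  ; *-integral   = λ {x} {y} → product-integral x y
  ; -‿integral   = λ {x} → neg-integral x
  ; inv-integral = inverse-integral
  }
  where
  ∤1 : ¬ (p ∣ 1)
  ∤1 p∣1 = ¬prime[1] (subst Prime (∣1⇒≡1 p∣1) p-prime)
  ∤-* : ∀ {m n} → ¬ (p ∣ m) → ¬ (p ∣ n) → ¬ (p ∣ m ℕ.* n)
  ∤-* {m} {n} p∤m p∤n p∣mn with euclidsLemma m n p-prime p∣mn
  ... | inj₁ p∣m = p∤m p∣m
  ... | inj₂ p∣n = p∤n p∣n
  sum-integral : ∀ x y → Defs.pIntegral p x → Defs.pIntegral p y → Defs.pIntegral p (x ℚ.+ y)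
  -- Matching on both arguments lets the sum unfold to the normalised quotient.
  sum-integral x@record{} y@record{} ix iy p∣ = ∤-* ix iy (∣-trans p∣ (↧ₙ-/-∣ (ℚ.↥ x ℤ.* ℚ.↧ y ℤ.+ ℚ.↥ y ℤ.* ℚ.↧ x) (↧ₙ x ℕ.* ↧ₙ y)))
  product-integral : ∀ x y → Defs.pIntegral p x → Defs.pIntegral p y → Defs.pIntegral p (x ℚ.* y)
  product-integral x@record{} y@record{} ix iy p∣ = ∤-* ix iy (∣-trans p∣ (↧ₙ-/-∣ (ℚ.↥ x ℤ.* ℚ.↥ y) (↧ₙ x ℕ.* ↧ₙ y)))
  neg-integral : ∀ x → Defs.pIntegral p x → Defs.pIntegral p (ℚ.- x)
  neg-integral (ℚ.mkℚ (pos zero)    _ _) ix = ix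
  neg-integral (ℚ.mkℚ (pos (suc _)) _ _) ix = ix
  neg-integral (ℚ.mkℚ -[1+ _ ]      _ _) ix = ix
  inverse-integral : ∀ n → ¬ (p ∣ n) → Defs.pIntegral p (ℚ-Algebra.inv ℚ-algebra n)
  inverse-integral zero    _   = ∤1
  inverse-integral (suc n) p∤n p∣ = p∤n (∣-trans p∣ (↧ₙ-/-∣ (pos 1) (suc n)))

module QS = Products ℚ-algebra
module QB = Binomial ℚ-algebra

foldr≡∑ : ∀ n (i : ℕ → ℕ) f → foldr ℚ._+_ 0ℚ (map f (applyUpTo i n)) ≡ QS.∑ n (λ k → f (i k))
foldr≡∑ n i f = trans (cong (foldr ℚ._+_ 0ℚ) (map-applyUpTo i f n)) (go n (λ k → f (i k)))
  where
  go : ∀ n f → foldr ℚ._+_ 0ℚ (applyUpTo f n) ≡ QS.∑ n f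
  go zero    f = refl
  go (suc n) f = trans (cong (f 0 ℚ.+_) (go n (λ k → f (suc k)))) (sym (QS.∑-head n f))

sumQ≡∑ : ∀ n f → Defs.sumQ n f ≡ QS.∑ (suc n) f
sumQ≡∑ n f = foldr≡∑ (suc n) (λ k → k) f

-- The recurrence of the Euler numbers from their list definition

private
  at-++ˡ : ∀ (l r : List ℚ) j → j ℕ.< length l → Defs.at (l ++ r) j ≡ Defs.at l j
  at-++ˡ (x ∷ l) r zero    _       = refl
  at-++ˡ (x ∷ l) r (suc j) (s≤s j<) = at-++ˡ l r j j<

  at-last : ∀ (l : List ℚ) x → Defs.at (l ++ (x ∷ [])) (length l) ≡ x
  at-last []      x = refl
  at-last (y ∷ l) x = at-last l x

  length-eulerList : ∀ n → length (Defs.eulerList n) ≡ suc n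
  length-eulerList zero    = refl
  length-eulerList (suc n) = trans (length-++ (Defs.eulerList n)) (trans (ℕₚ.+-comm _ 1) (cong suc (length-eulerList n)))

  at-eulerList : ∀ n j → j ℕ.≤ n → Defs.at (Defs.eulerList n) j ≡ Defs.E j
  at-eulerList n j j≤n = go (ℕₚ.≤⇒≤′ j≤n)
    where
    go : ∀ {n} → j ℕ.≤′ n → Defs.at (Defs.eulerList n) j ≡ Defs.E j
    go (ℕ.≤′-reflexive refl) = refl
    go (ℕ.≤′-step {n} j≤n)   = trans (at-++ˡ (Defs.eulerList n) _ j
      (subst (j ℕ.<_) (sym (length-eulerList n)) (s≤s (ℕₚ.≤′⇒≤ j≤n)))) (go j≤n)

  E-suc : ∀ n → Defs.E (suc n) ≡ Defs.nextEuler (suc n) (Defs.eulerList n)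
  E-suc n = trans (cong (Defs.at (Defs.eulerList (suc n))) (sym (length-eulerList n))) (at-last (Defs.eulerList n) _)

  -- The summand of nextEuler is local to its definition; unification recovers it.
  euler-summand : ∀ m l → Σ (ℕ → ℚ) (λ t → Defs.nextEuler m l ≡ ℚ.- (0ℚ ℚ.+ foldr ℚ._+_ 0ℚ (map t (applyUpTo suc m))))
  euler-summand m l = _ , refl

  parity : ∀ k → (k % 2 ≡ 0 × QB.ev k ≡ 1ℚ) ⊎ (k % 2 ≡ 1 × QB.ev k ≡ 0ℚ)
  parity zero          = inj₁ (refl , refl)
  parity (suc zero)    = inj₂ (refl , refl)
  parity (suc (suc k)) = parity k

  euler-summand-suc : ∀ m l k → proj₁ (euler-summand m l) (suc k)
    ≡ QB.ev (suc k) ℚ.* ℚA.ι (m choose suc k) ℚ.* Defs.at l (m ℕ.∸ suc k)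
  euler-summand-suc m l k with suc k % 2 | parity (suc k)
  ... | zero  | inj₁ (_ , ev≡) rewrite ev≡ = sym (cong (ℚ._* Defs.at l (m ℕ.∸ suc k)) (trans (ℚₚ.*-identityˡ _) (ι≡fromℤ (m choose suc k))))
  ... | suc _ | inj₂ (_ , ev≡) rewrite ev≡ = sym (trans (cong (ℚ._* Defs.at l (m ℕ.∸ suc k)) (ℚₚ.*-zeroˡ (ℚA.ι (m choose suc k)))) (ℚₚ.*-zeroˡ (Defs.at l (m ℕ.∸ suc k))))

E-recurrence : ∀ n → Defs.E (suc n) ≡ ℚ.- QS.∑ (suc n) (λ k → QB.ev (suc k) ℚ.* ℚA.ι (suc n choose suc k) ℚ.* Defs.E (n ℕ.∸ k))
E-recurrence n = trans (E-suc n) (trans (proj₂ (euler-summand (suc n) l)) (cong ℚ.-_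
  (trans (ℚₚ.+-identityˡ _) (trans (foldr≡∑ (suc n) suc t)
    (QS.∑-cong′ (suc n) (λ k → trans (euler-summand-suc (suc n) l k)
      (cong (QB.ev (suc k) ℚ.* ℚA.ι (suc n choose suc k) ℚ.*_) (at-eulerList n (n ℕ.∸ k) (ℕₚ.m∸n≤m n k)))))))))
  where
  l : List ℚ
  l = Defs.eulerList n
  t : ℕ → ℚ
  t = proj₁ (euler-summand (suc n) l)

open import Defs

-- The congruences over the rational numbers

module QT = Translation ℚ-algebra
module QH = HarmonicSums ℚ-algebra

private
  even⊎odd : ∀ n → (∃[ h ] n ≡ dbl h) ⊎ (∃[ h ] n ≡ suc (dbl h))
  even⊎odd zero    = inj₁ (0 , refl)
  even⊎odd (suc n) with even⊎odd n
  ... | inj₁ (h , n≡) = inj₂ (h , cong suc n≡)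
  ... | inj₂ (h , n≡) = inj₁ (suc h , cong suc n≡)

  odd-prime : ∀ p → Prime p → 3 < p → ∃[ h ] p ≡ suc (dbl h)
  odd-prime p p-prime 3<p with even⊎odd p
  ... | inj₂ odd        = odd
  ... | inj₁ (h , refl) with prime⇒irreducible p-prime {2} (divides h (trans (dbl≡2* h) (ℕₚ.*-comm 2 h)))
  ...   | inj₁ ()
  ...   | inj₂ 2≡p = contradiction (subst (3 <_) (sym 2≡p) 3<p) λ { (s≤s (s≤s ())) }

  fromℤ-sgn : ∀ n → fromℤ (-1ℤ ℤ.^ n) ≡ QS.sgn n
  fromℤ-sgn zero    = refl
  fromℤ-sgn (suc n) = trans (fromℤ-* -1ℤ (-1ℤ ℤ.^ n)) (trans (cong (fromℤ -1ℤ ℚ.*_) (fromℤ-sgn n))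
    (trans (sym (ℚₚ.neg-distribˡ-* 1ℚ (QS.sgn n))) (cong ℚ.-_ (ℚₚ.*-identityˡ (QS.sgn n)))))

  term₁≡ : ∀ n → term₁ n ≡ (ℚA.ι n ℚ.+ 1ℚ) ℚ.* (QS._^_ (ℚA.ι 2) n) ℚ.* QH.s n
  term₁≡ n = QT.weighted-summand n (term₁ n) (begin
    term₁ n ℚ.* ℚA.ι (8 ℕ.^ n)          ≡⟨ cong (term₁ n ℚ.*_) (ι≡fromℤ (8 ℕ.^ n)) ⟩
    term₁ n ℚ.* fromℤ (pos (8 ℕ.^ n))   ≡⟨ /-*-denominator (pos (suc n ℕ.* S n)) (8 ℕ.^ n) {{ℕₚ.m^n≢0 8 n}} ⟩
    fromℤ (pos (suc n ℕ.* S n))         ≡⟨ sym (ι≡fromℤ (suc n ℕ.* S n)) ⟩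
    ℚA.ι (suc n ℕ.* S n)                ∎)
    where open ≡-Reasoning

  term₂≡ : ∀ n → term₂ n ≡ QH.odd n ℚ.* QS.sgn n ℚ.* QH.s n
  term₂≡ n = QT.alternating-summand n (term₂ n) (begin
    term₂ n ℚ.* ℚA.ι (16 ℕ.^ n)         ≡⟨ cong (term₂ n ℚ.*_) (ι≡fromℤ (16 ℕ.^ n)) ⟩
    term₂ n ℚ.* fromℤ (pos (16 ℕ.^ n))  ≡⟨ /-*-denominator ((-1ℤ ℤ.^ n) ℤ.* pos m) (16 ℕ.^ n) {{ℕₚ.m^n≢0 16 n}} ⟩
    fromℤ ((-1ℤ ℤ.^ n) ℤ.* pos m)       ≡⟨ fromℤ-* (-1ℤ ℤ.^ n) (pos m) ⟩
    fromℤ (-1ℤ ℤ.^ n) ℚ.* fromℤ (pos m) ≡⟨ cong₂ ℚ._*_ (fromℤ-sgn n) (sym (ι≡fromℤ m)) ⟩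
    QS.sgn n ℚ.* ℚA.ι m                 ∎)
    where
    open ≡-Reasoning
    m : ℕ
    m = suc (2 ℕ.* n) ℕ.* S n

  rhs≡ : ∀ c h → rhs c (suc (dbl h))
    ≡ QS.sgn h ℚ.* ℚA.ι (suc (dbl h)) ℚ.+ ℚA.ι c ℚ.* (QS._^_ (ℚA.ι (suc (dbl h))) 3) ℚ.* E (dbl h ∸ 2)
  rhs≡ c h = cong₂ ℚ._+_ main (cong (ℚ._* E (dbl h ∸ 2)) (trans (sym (ι≡fromℤ (c ℕ.* p ℕ.^ 3)))
    (trans (ℚA.ι-* c (p ℕ.^ 3)) (cong (ℚA.ι c ℚ.*_) (QT.ι-^ p 3)))))
    where
    p : ℕ
    p = suc (dbl h)
    main : fromℤ ((-1ℤ ℤ.^ (dbl h / 2)) ℤ.* pos p) ≡ QS.sgn h ℚ.* ℚA.ι p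
    main = trans (fromℤ-* (-1ℤ ℤ.^ (dbl h / 2)) (pos p)) (cong₂ ℚ._*_
      -- The exponent `(p-1)/2` is `dbl h / 2`, that is `h`.
      (trans (cong (λ t → fromℤ (-1ℤ ℤ.^ t)) (trans (cong (_/ 2) (trans (dbl≡2* h) (ℕₚ.*-comm 2 h))) (m*n/n≡m h 2))) (fromℤ-sgn h))
      (sym (ι≡fromℤ p)))

module _ (h : ℕ) (p-prime : Prime (suc (dbl h))) (3<p : 3 < suc (dbl h)) where

  private
    p : ℕ
    p = suc (dbl h)
    module C = EulerCongruence ℚ-algebra h (p-integers p p-prime) p-prime 3<p

    CongPow-from-≈ : ∀ {x y x′ y′} → x ≡ x′ → y ≡ y′ → x′ C.≈ y′ mod^ 4 → CongPow p 4 x y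
    CongPow-from-≈ {y′ = y′} refl refl (C.quot {r} r-integral refl) = r , r-integral ,
      trans (cong (ℚ._- y′) (ℚₚ.+-comm y′ (P⁴ ℚ.* r))) (trans (ℚₚ.+-assoc (P⁴ ℚ.* r) y′ (ℚ.- y′))
        (trans (cong (P⁴ ℚ.* r ℚ.+_) (ℚₚ.+-inverseʳ y′)) (trans (ℚₚ.+-identityʳ (P⁴ ℚ.* r))
          (cong (ℚ._* r) (trans (sym (QT.ι-^ p 4)) (ι≡fromℤ (p ℕ.^ 4)))))))
      where
      P⁴ : ℚ
      P⁴ = QS._^_ (ℚA.ι p) 4

  congruences : CongPow p 4 (sumQ (dbl h) term₁) (rhs 5 p) × CongPow p 4 (sumQ (dbl h) term₂) (rhs 3 p)
  congruences =
      CongPow-from-≈ (trans (sumQ≡∑ (dbl h) term₁) (QS.∑-cong′ p term₁≡)) (rhs≡ 5 h) (C.congruence₁ E refl E-recurrence)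
    , CongPow-from-≈ (trans (sumQ≡∑ (dbl h) term₂) (QS.∑-cong′ p term₂≡)) (rhs≡ 3 h) (C.congruence₂ E refl E-recurrence)

theorem1p1 : (p : ℕ) → Prime p → 3 < p →
    CongPow p 4 (sumQ (p ∸ 1) term₁) (rhs 5 p)
    × CongPow p 4 (sumQ (p ∸ 1) term₂) (rhs 3 p)
theorem1p1 p p-prime 3<p with odd-prime p p-prime 3<p
... | h , refl = congruences h p-prime 3<p
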